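{- Let $s\geq 3$ be an integer, $m=2s$, $q=2^m$, and let $\overline{\mathcal{C}_1^{\bot}}^{\bot}$ be the binary linear code $$\overline{\mathcal{C}_1^{\bot}}^{\bot}=\{(\mathrm{Tr}_1^m(ax^5+bx^3+cx)+h)_{x\in\mathbb{F}_q}: a,b,c\in\mathbb{F}_q,\ h\in\mathbb{F}_2\}.$$ Then this code has length $2^m$ and dimension $3m+1$ over $\mathbb{F}_2$, and its weight distribution is as follows (the number of codewords of any weight not listed is $0$): - weight $0$: $1$ codeword; - weight $2^{2s-1}$: $29\cdot 2^{6s-5}-33\cdot 2^{4s-5}+17\cdot 2^{2s-3}-2$ codewords; - weight $2^{2s-1}-2^{s-1}$: $\frac{2}{15}\cdot 2^{2s}(3\cdot 2^{4s}+5\cdot 2^{2s}-8)$ codewords; - weight $2^{2s-1}+2^{s-1}$: $\frac{2}{15}\cdot 2^{2s}(3\cdot 2^{4s}+5\cdot 2^{2s}-8)$ codewords; - weight $2^{2s-1}-2^{s}$: $\frac{7}{3}\cdot 2^{4s-4}(2^{2s}-1)$ codewords; - weight $2^{2s-1}+2^{s}$: $\frac{7}{3}\cdot 2^{4s-4}(2^{2s}-1)$ codewords; - weight $2^{2s-1}-2^{s+1}$: $\frac{1}{15}\cdot 2^{2s-4}(2^{4s-2}-5\cdot 2^{2s-2}+1)$ codewords; - weight $2^{2s-1}+2^{s+1}$: $\frac{1}{15}\cdot 2^{2s-4}(2^{4s-2}-5\cdot 2^{2s-2}+1)$ codewords; - weight $2^{2s}$: $1$ codeword.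
   Context: $\mathbb{F}_q$ is the finite field with $q=2^m$ elements, and $\mathrm{Tr}_1^m$ is the trace function from $\mathbb{F}_{2^m}$ onto $\mathbb{F}_2$. The weight distribution of a code records, for each $i$, the number of codewords of Hamming weight $i$. The notation $\overline{\mathcal{C}_1^{\bot}}^{\bot}$ is just the name of the displayed code (it is the dual of the extended code of the dual of the cyclic code $\mathcal{C}_1$ formed by the vectors $(\mathrm{Tr}_1^m(ax^5+bx^3+cx))_{x\in\mathbb{F}_q^*}$). -}

module Defs where

open import Algebra.Apartness.Bundles using (HeytingCommutativeRing; HeytingField)
open import Algebra.Bundles using (CommutativeRing)
import Algebra.Definitions.RawMonoid as Sum
import Algebra.Properties.Semiring.Exp as Power
open import Data.Bool.Base using (Bool; false; if_then_else_; _∧_; _xor_)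
open import Data.Bool.Properties using (T?)
open import Data.Fin.Base using (Fin; toℕ)
open import Data.Integer.Base using (+_)
open import Data.List.Base using (List; []; _∷_; map)
open import Data.List.Membership.Propositional using (_∈_)
open import Data.List.Relation.Unary.All using (All)
open import Data.Nat.Base as ℕ using (ℕ; _∸_)
open import Data.Product.Base using (Σ; ∃-syntax; _×_; _,_; proj₁)
open import Data.Rational.Unnormalised.Base using (ℚᵘ; _/_; _≃_; _+_; _-_; _*_)
open import Data.Vec.Base as Vec using (Vec; lookup; replicate; zipWith)
open import Function.Bundles using (Inverse)
open import Level using (Level; _⊔_)
open import Relation.Binary.Bundles using (Setoid)
import Relation.Binary.Construct.On as On
open import Relation.Binary.PropositionalEquality as ≡ using (_≡_)
open import Relation.Nullary.Negation using (¬_)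
open import Relation.Unary using (Pred)

private
  variable
    a c ℓ ℓ₁ ℓ₂ : Level
    k n : ℕ

infix 4 _HasCardinality_

_HasCardinality_ : Setoid a ℓ → ℕ → Set (a ⊔ ℓ)
S HasCardinality N = Inverse S (≡.setoid (Fin N))

-- 𝔽₂ is Bool, with _xor_ as addition and _∧_ as multiplication.

Word : ℕ → Set
Word n = Vec Bool n

𝟎 : Word n
𝟎 = replicate _ false

infixl 6 _⊕_
infixr 7 _·_

_⊕_ : Word n → Word n → Word n
_⊕_ = zipWith _xor_

_·_ : Bool → Word n → Word n
b · w = Vec.map (b ∧_) w

weight : Word n → ℕ
weight = Vec.count T?

Code : ℕ → (ℓ : Level) → Set _
Code n ℓ = Pred (Word n) ℓ

length : Code n ℓ → ℕ
length {n} _ = n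

record IsLinear {n} (C : Code n ℓ) : Set ℓ where
  field
    𝟎-member : C 𝟎
    ⊕-closed : ∀ {v w} → C v → C w → C (v ⊕ w)
    ·-closed : ∀ b {w} → C w → C (b · w)

combination : Vec Bool k → Vec (Word n) k → Word n
combination bs vs = Vec.foldr′ _⊕_ 𝟎 (zipWith _·_ bs vs)

record IsBasis {n k} (C : Code n ℓ) (vs : Vec (Word n) k) : Set ℓ where
  field
    members     : ∀ i → C (lookup vs i)
    independent : ∀ bs → combination bs vs ≡ 𝟎 → bs ≡ 𝟎
    spanning    : ∀ {w} → C w → ∃[ bs ] combination bs vs ≡ w

HasDimension : Code n ℓ → ℕ → Set ℓ
HasDimension {n} C k = Σ (Vec (Word n) k) (IsBasis C)

-- Two elements are identified when their words agree, so that each codeword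
-- is counted once however many proofs of membership it has.
codewordsOfWeight : Code n ℓ → ℕ → Setoid ℓ _
codewordsOfWeight {n} C i =
  On.setoid (≡.setoid (Word n)) (proj₁ {B = λ w → C w × weight w ≡ i})

fromℕ : ℕ → ℚᵘ
fromℕ N = + N / 1

-- The table lists pairs (i , Aᵢ); the Aᵢ are rational because the closed
-- formulas for them contain fractions.
HasWeightDistribution : Code n ℓ → List (ℕ × ℚᵘ) → Set ℓ
HasWeightDistribution C table =
  All (λ (i , A) → ∃[ N ] codewordsOfWeight C i HasCardinality N × fromℕ N ≃ A) table
  × (∀ i → ¬ i ∈ map proj₁ table → codewordsOfWeight C i HasCardinality 0)

-- On a finite carrier equality is decidable and the tight apartness of a
-- Heyting field is its negation, so a finite HeytingField is a finite field.
module _ (F : HeytingField c ℓ₁ ℓ₂) where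

  open HeytingField F using (Carrier; _≈_; 0#; 1#; setoid; heytingCommutativeRing)
    renaming (_+_ to _+ᶠ_; _*_ to _*ᶠ_)
  open CommutativeRing (HeytingCommutativeRing.commutativeRing heytingCommutativeRing)
    using (+-rawMonoid; semiring)
  open Sum +-rawMonoid using (sum)
  open Power semiring using (_^_)

  -- The inclusion of 𝔽₂ as the prime field of F.
  embed : Bool → Carrier
  embed b = if b then 1# else 0#

  -- The trace of 𝔽_{2^m} over 𝔽₂, with its value in the prime field.
  Tr : ℕ → Carrier → Carrier
  Tr m x = sum {m} (λ i → x ^ (2 ℕ.^ toℕ i))

  -- The coordinates are indexed by the elements x of F through the enumeration.
  -- Comparing inside F also forces each trace value to lie in 𝔽₂.
  traceCode : ∀ {q} → setoid HasCardinality q → (m : ℕ) → Code q (c ⊔ ℓ₁)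
  traceCode enum m w =
    ∃[ a ] ∃[ b ] ∃[ c ] ∃[ h ] ∀ x →
      embed (lookup w (Inverse.to enum x))
        ≈ Tr m (a *ᶠ x ^ 5 +ᶠ b *ᶠ x ^ 3 +ᶠ c *ᶠ x) +ᶠ embed h

-- For s ≥ 3 no truncated subtraction below actually truncates.
weightTable : ℕ → List (ℕ × ℚᵘ)
weightTable s =
    (0                                     , fromℕ 1)
  ∷ (2^ (2s ∸ 1)                           , A₀)
  ∷ (2^ (2s ∸ 1) ∸ 2^ (s ∸ 1)              , A₁)
  ∷ (2^ (2s ∸ 1) ℕ.+ 2^ (s ∸ 1)            , A₁)
  ∷ (2^ (2s ∸ 1) ∸ 2^ s                    , A₂)
  ∷ (2^ (2s ∸ 1) ℕ.+ 2^ s                  , A₂)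
  ∷ (2^ (2s ∸ 1) ∸ 2^ (s ℕ.+ 1)            , A₃)
  ∷ (2^ (2s ∸ 1) ℕ.+ 2^ (s ℕ.+ 1)          , A₃)
  ∷ (2^ 2s                                 , fromℕ 1)
  ∷ []
  where
  2s 4s 6s : ℕ
  2s = 2 ℕ.* s
  4s = 4 ℕ.* s
  6s = 6 ℕ.* s

  2^_ : ℕ → ℕ
  2^ k = 2 ℕ.^ k

  pow : ℕ → ℚᵘ
  pow k = fromℕ (2^ k)

  A₀ A₁ A₂ A₃ : ℚᵘ
  A₀ = fromℕ 29 * pow (6s ∸ 5) - fromℕ 33 * pow (4s ∸ 5)
         + fromℕ 17 * pow (2s ∸ 3) - fromℕ 2
  A₁ = (+ 2 / 15) * pow 2s * (fromℕ 3 * pow 4s + fromℕ 5 * pow 2s - fromℕ 8)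
  A₂ = (+ 7 / 3) * pow (4s ∸ 4) * (pow 2s - fromℕ 1)
  A₃ = (+ 1 / 15) * pow (2s ∸ 4)
         * (pow (4s ∸ 2) - fromℕ 5 * pow (2s ∸ 2) + fromℕ 1)

{-# OPTIONS --safe #-}

-- Write f = a x⁵ + b x³ + c x and S(a,b,c) = Σ_x (-1)^Tr(f(x)), so that the codeword of (a,b,c,h) has
-- weight (q ∓ S)/2. Squaring S and translating one variable gives S² = q Σ_{y ∈ ker L} (-1)^Tr(f(y)) with
-- L(y) = a y + b² y² + b⁴ y⁸ + a⁴ y¹⁶. On ker L the summand is a character, so S² is 0 or q ∣ker L∣. For
-- (a,b) ≠ (0,0) the kernel has at most 16 elements, and it is trivial or of even order; as q and S² are
-- squares, ∣S∣ is 0, 2^s, 2^(s+1) or 2^(s+2), while S(0,0,0) = q.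
--
-- The four frequencies follow from the power moments of orders 0, 2, 4 and 6. The moment of order k is q³
-- times the number of k-tuples with Σ xᵢ = Σ xᵢ³ = Σ xᵢ⁵ = 0. For k ≤ 6 even, Newton's identities show
-- that the entries of such a tuple cancel in pairs, so that it is a closed walk of length k on the
-- hypercube 𝔽₂^q, and those are counted by a recursion on the weight.

module Submission where

open import Defs
open import Algebra.Apartness.Bundles using (HeytingField; HeytingCommutativeRing)
open import Algebra.Bundles using (CommutativeMonoid; CommutativeRing; RawRing)
open import Algebra.Core using (Op₁; Op₂)
import Algebra.Morphism.RingMonomorphism as RingMonomorphism
open import Algebra.Morphism.Structures using (IsRingMonomorphism)
import Algebra.Solver.Ring
open import Algebra.Solver.Ring.AlmostCommutativeRing
  using (_-Raw-AlmostCommutative⟶_; fromCommutativeRing)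
open import Algebra.Structures using (IsCommutativeRing)
open import Data.Bool.Base as Bool using (Bool; true; false; if_then_else_; not; _∧_; _xor_)
import Data.Bool.Properties as Bool
open import Data.Empty using (⊥-elim)
open import Data.Fin.Base using (Fin; zero; suc; toℕ; inject₁)
open import Data.Fin.Patterns
open import Data.Fin.Permutation using (permutation)
import Data.Fin.Properties as Fin
open import Data.Integer.Base as ℤ using (ℤ; +_; 0ℤ; 1ℤ; -1ℤ)
import Data.Integer.Properties as ℤ
import Data.Integer.Solver as ℤ
open import Data.List.Base as List using (List; []; _∷_; _++_; replicate)
import Data.List.Properties as List
open import Data.List.Membership.Propositional using (_∈_)
open import Data.List.Membership.Propositional.Properties
  using (∈-lookup; ∈-cartesianProductWith⁺; ∈-cartesianProduct⁺; ∈-allFin; ∈-map⁺; ∈-map⁻; ∈-filter⁺; ∈-filter⁻)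
open import Data.List.Membership.Propositional.Properties.WithK using (unique∧set⇒bag)
open import Data.List.Relation.Binary.BagAndSetEquality using (∼bag⇒↭)
open import Data.List.Relation.Binary.Permutation.Propositional.Properties using (↭-length)
open import Data.List.Relation.Unary.All as All using (All; []; _∷_)
open import Data.List.Relation.Unary.AllPairs using ([]; _∷_)
open import Data.List.Relation.Unary.Any as Any using (here; there)
open import Data.List.Relation.Unary.Any.Properties using (lookup-index)
open import Data.List.Relation.Unary.Unique.Propositional using (Unique)
import Data.List.Relation.Unary.Unique.Propositional.Properties as Unique
import Data.Maybe.Base as Maybe
open import Data.Nat.Base as ℕ using (ℕ; zero; suc)
open import Data.Nat.Divisibility using (_∣_; divides)
open import Data.Nat.Primality using (euclidsLemma; prime[2])
import Data.Nat.Properties as ℕ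
import Data.Nat.Solver as ℕ
open import Data.Product.Base using (_×_; _,_; proj₁; proj₂; ∃-syntax)
open import Data.Rational.Unnormalised.Base as ℚ using (_≃_; *≡*)
open import Data.Sum.Base using (_⊎_; inj₁; inj₂; [_,_]′)
open import Data.Vec.Base as Vec using (Vec; []; _∷_; lookup; updateAt)
import Data.Vec.Membership.Propositional as Vec
import Data.Vec.Properties as Vec
open import Data.Vec.Relation.Unary.Any using (here; there)
open import Function.Base using (_∘_; id; case_of_)
open import Function.Bundles using (Inverse; mk⇔)
open import Level using (Level)
open import Relation.Binary.Definitions using (tri<; tri≈; tri>)
import Relation.Binary.Construct.On as On
open import Relation.Binary.PropositionalEquality as ≡
  using (_≡_; _≢_)
open import Relation.Nullary using (Dec; yes; no; does; ¬_; contradiction)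
open import Relation.Nullary.Decidable
  using (map′; _×-dec_; ¬?; does-⇔; dec-true; dec-false; dec⇒maybe; decidable-stable)
open import Relation.Unary using (Pred)

-- The kernel determines only ∣S∣, never the sign of S. That is enough: the constant h = 1 replaces
-- S by -S, so the words with h = 0 and h = 1 together realise both signs equally often, and moments
-- of even order suffice. The zero triple is the only one with ∣S∣ = q, which leaves four unknown
-- frequencies for four equations.
--
-- Write r = 2^s, so that q = r². For (a,b) ≠ (0,0) and S ≠ 0, the equation S² = r² ∣ker L∣ makes
-- ∣ker L∣ a square between 1 and 16, and parity discards 9, that is ∣S∣ = 3r. The value q = r · r
-- must also differ from r, 2r and 4r, which s ≥ 3 guarantees through r ≥ 8.
--
-- The uniqueness of ∣S∣ = q shows as well that distinct coefficients give distinct words, so the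
-- dimension comes from counting words and not from an explicit basis.
--
-- All counting takes place on `Fin q`, where equality is decidable and a sum over the field is a
-- sum over an index; the operations of `F` are carried there through the enumeration.

module FiniteSums where

  -- Finite integer sums and indicator values.

  open ≡ using (refl; sym; trans; cong; cong₂)

  module SelectedSum {a ℓ} (M : CommutativeMonoid a ℓ) where
    open CommutativeMonoid M using (Carrier; _≈_; ε; identityˡ; identityʳ; ∙-congˡ)
    open import Algebra.Properties.CommutativeMonoid.Sum M using (sum; sum-replicate-zero)
    open CommutativeMonoid M using () renaming (trans to ≈-trans)

    -- Stated for any commutative monoid because it serves additively for integer sums and
    -- multiplicatively for a product over the field with one exceptional factor.
    sum-select : ∀ {n} (j : Fin n) (c : Carrier) →
      sum (λ i → if does (i Fin.≟ j) then c else ε) ≈ c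
    sum-select {suc n} zero c =
      ≈-trans (∙-congˡ (sum-replicate-zero n)) (identityʳ c)
    sum-select (suc j) c = ≈-trans (identityˡ _) (sum-select j c)

  open import Algebra.Properties.Semiring.Sum ℤ.+-*-semiring public
    using (sum; sum-cong-≗; sum-replicate-zero; ∑-distrib-+; ∑-comm; *-distribˡ-sum; *-distribʳ-sum; sum-permute)

  [_] : Bool → ℤ
  [ b ] = if b then 1ℤ else 0ℤ

  infix 4 _≟_
  _≟_ = Fin._≟_

  sum-const : ∀ n c → sum {n} (λ _ → c) ≡ + n ℤ.* c
  sum-const zero    c = refl
  sum-const (suc n) c = trans (cong (λ t → c ℤ.+ t) (sum-const n c)) (sym (ℤ.suc-* (+ n) c))

  sum-mono : ∀ {n} {f g : Fin n → ℤ} → (∀ i → f i ℤ.≤ g i) → sum f ℤ.≤ sum g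
  sum-mono {zero}  f≤g = ℤ.≤-refl
  sum-mono {suc n} f≤g = ℤ.+-mono-≤ (f≤g zero) (sum-mono (f≤g ∘ suc))

  sum-reindex : ∀ {n} (f : Fin n → ℤ) (π π⁻¹ : Fin n → Fin n) →
    (∀ i → π (π⁻¹ i) ≡ i) → (∀ i → π⁻¹ (π i) ≡ i) → sum (λ i → f (π i)) ≡ sum f
  sum-reindex f π π⁻¹ l r = sym (sum-permute f (permutation π π⁻¹ l r))

  sum-δ : ∀ {n} (j : Fin n) (f : Fin n → ℤ) → sum (λ i → [ does (i ≟ j) ] ℤ.* f i) ≡ f j
  sum-δ j f = trans (sum-cong-≗ select) (SelectedSum.sum-select ℤ.+-0-commutativeMonoid j (f j))
    where
    select : ∀ i → [ does (i ≟ j) ] ℤ.* f i ≡ (if does (i ≟ j) then f j else 0ℤ)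
    select i with i ≟ j
    ... | yes refl = ℤ.*-identityˡ (f i)
    ... | no _     = refl

  sum-δ₁ : ∀ {n} (j : Fin n) → sum (λ i → [ does (i ≟ j) ]) ≡ 1ℤ
  sum-δ₁ j = SelectedSum.sum-select ℤ.+-0-commutativeMonoid j 1ℤ

  []-cong : ∀ {p q} {P : Set p} {Q : Set q} (P? : Dec P) (Q? : Dec Q) →
    (P → Q) → (Q → P) → [ does P? ] ≡ [ does Q? ]
  []-cong P? Q? P⇒Q Q⇒P = cong [_] (does-⇔ (mk⇔ P⇒Q Q⇒P) P? Q?)

  []-true : ∀ {p} {P : Set p} (P? : Dec P) → P → [ does P? ] ≡ 1ℤ
  []-true P? p = cong [_] (dec-true P? p)

  []-false : ∀ {p} {P : Set p} (P? : Dec P) → ¬ P → [ does P? ] ≡ 0ℤ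
  []-false P? ¬p = cong [_] (dec-false P? ¬p)

  []-nonneg : ∀ b → 0ℤ ℤ.≤ [ b ]
  []-nonneg true  = ℤ.+≤+ ℕ.z≤n
  []-nonneg false = ℤ.+≤+ ℕ.z≤n

  []-≤-⊎ : ∀ {p q r} {P : Set p} {Q : Set q} {R : Set r} (P? : Dec P) (Q? : Dec Q) (R? : Dec R) →
    (P → Q ⊎ R) → [ does P? ] ℤ.≤ [ does Q? ] ℤ.+ [ does R? ]
  []-≤-⊎ (no _)  Q?      R?      P⇒Q⊎R = ℤ.+-mono-≤ ([]-nonneg (does Q?)) ([]-nonneg (does R?))
  []-≤-⊎ (yes _) (yes _) R?      P⇒Q⊎R = ℤ.+-monoʳ-≤ 1ℤ ([]-nonneg (does R?))
  []-≤-⊎ (yes _) (no _)  (yes _) P⇒Q⊎R = ℤ.≤-refl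
  []-≤-⊎ (yes p) (no ¬q) (no ¬r) P⇒Q⊎R with P⇒Q⊎R p
  ... | inj₁ q = ⊥-elim (¬q q)
  ... | inj₂ r = ⊥-elim (¬r r)

open FiniteSums

-- Finite enumerations and linear algebra over 𝔽₂.

module BinaryCodes where

  open ≡ using (refl; sym; trans; cong; cong₂; subst; module ≡-Reasoning)
  open ≡-Reasoning

  private
    variable
      a ℓ : Level
      n k : ℕ

  Unique-lookup : ∀ {A : Set a} {xs : List A} → Unique xs → ∀ {i j} → List.lookup xs i ≡ List.lookup xs j → i ≡ j
  Unique-lookup (x∉xs ∷ uxs) {zero}  {zero}  eq = refl
  Unique-lookup (x∉xs ∷ uxs) {zero}  {suc j} eq = contradiction eq (All.lookup x∉xs (∈-lookup j))
  Unique-lookup (x∉xs ∷ uxs) {suc i} {zero}  eq = contradiction (sym eq) (All.lookup x∉xs (∈-lookup i))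
  Unique-lookup (x∉xs ∷ uxs) {suc i} {suc j} eq = cong suc (Unique-lookup uxs eq)

  -- The setoid compares first components only. As `xs` has no repetitions, the position of an
  -- element does not depend on the proof of `P` that produced it, so taking the position is inverse
  -- to `List.lookup`.
  enumeration-cardinality : ∀ {A : Set a} {P : Pred A ℓ} {xs : List A} → Unique xs →
    (∀ {x} → P x → x ∈ xs) → (∀ {x} → x ∈ xs → P x) →
    On.setoid (≡.setoid A) (proj₁ {B = P}) HasCardinality List.length xs
  enumeration-cardinality {xs = xs} uxs complete sound = record
    { to        = λ (_ , px) → Any.index (complete px)
    ; from      = λ i → List.lookup xs i , sound (∈-lookup i)
    ; to-cong   = λ {(x , px)} {(y , py)} x≡y → Unique-lookup uxs
        (trans (sym (lookup-index (complete px))) (trans x≡y (lookup-index (complete py))))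
    ; from-cong = cong (List.lookup xs)
    ; inverse   = (λ {i} {(y , py)} y≡ → Unique-lookup uxs (trans (sym (lookup-index (complete py))) y≡))
                , (λ {(x , px)} {i} i≡ → trans (cong (List.lookup xs) i≡) (sym (lookup-index (complete px))))
    }

  same-elements⇒same-length : ∀ {A : Set a} {xs ys : List A} → Unique xs → Unique ys →
    (∀ {x} → x ∈ xs → x ∈ ys) → (∀ {x} → x ∈ ys → x ∈ xs) → List.length xs ≡ List.length ys
  same-elements⇒same-length uxs uys xs⊆ys ys⊆xs =
    ↭-length (∼bag⇒↭ (unique∧set⇒bag uxs uys (mk⇔ xs⊆ys ys⊆xs)))

  ⊕-assoc : (u v w : Word n) → (u ⊕ v) ⊕ w ≡ u ⊕ (v ⊕ w)
  ⊕-assoc = Vec.zipWith-assoc Bool.xor-assoc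

  ⊕-identityˡ : (w : Word n) → 𝟎 ⊕ w ≡ w
  ⊕-identityˡ = Vec.zipWith-identityˡ Bool.xor-identityˡ

  ⊕-identityʳ : (w : Word n) → w ⊕ 𝟎 ≡ w
  ⊕-identityʳ = Vec.zipWith-identityʳ Bool.xor-identityʳ

  ⊕-comm : (v w : Word n) → v ⊕ w ≡ w ⊕ v
  ⊕-comm = Vec.zipWith-comm Bool.xor-comm

  ⊕-self : (w : Word n) → w ⊕ w ≡ 𝟎
  ⊕-self []      = refl
  ⊕-self (b ∷ w) = cong₂ _∷_ (Bool.xor-same b) (⊕-self w)

  ⊕-cancelˡ : (v w : Word n) → v ⊕ (v ⊕ w) ≡ w
  ⊕-cancelˡ v w = trans (sym (⊕-assoc v v w)) (trans (cong (_⊕ w) (⊕-self v)) (⊕-identityˡ w))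

  ⊕≡𝟎⇒≡ : (v w : Word n) → v ⊕ w ≡ 𝟎 → v ≡ w
  ⊕≡𝟎⇒≡ v w eq = trans (sym (⊕-identityʳ v)) (trans (cong (v ⊕_) (sym eq)) (⊕-cancelˡ v w))

  true·_ : (w : Word n) → true · w ≡ w
  true·_ = Vec.map-id

  false·_ : (w : Word n) → false · w ≡ 𝟎
  false·_ w = Vec.map-const w false

  combination-false : ∀ bs v (vs : Vec (Word n) k) → combination (false ∷ bs) (v ∷ vs) ≡ combination bs vs
  combination-false bs v vs = trans (cong (_⊕ combination bs vs) (false· v)) (⊕-identityˡ _)

  combination-true : ∀ bs v (vs : Vec (Word n) k) → combination (true ∷ bs) (v ∷ vs) ≡ v ⊕ combination bs vs
  combination-true bs v vs = cong (_⊕ combination bs vs) (true· v)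

  xor-· : ∀ b c (v : Word n) → (b xor c) · v ≡ (b · v) ⊕ (c · v)
  xor-· false c     v = sym (trans (cong (_⊕ (c · v)) (false· v)) (⊕-identityˡ _))
  xor-· true  false v = sym (trans (cong ((true · v) ⊕_) (false· v)) (⊕-identityʳ _))
  xor-· true  true  v = trans (false· v) (sym (⊕-self (true · v)))

  ⊕-interchange : (t u v w : Word n) → (t ⊕ u) ⊕ (v ⊕ w) ≡ (t ⊕ v) ⊕ (u ⊕ w)
  ⊕-interchange t u v w = begin
    (t ⊕ u) ⊕ (v ⊕ w)    ≡⟨ ⊕-assoc t u _ ⟩
    t ⊕ (u ⊕ (v ⊕ w))    ≡⟨ cong (t ⊕_) (trans (sym (⊕-assoc u v w)) (trans (cong (_⊕ w) (⊕-comm u v)) (⊕-assoc v u w))) ⟩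
    t ⊕ (v ⊕ (u ⊕ w))    ≡⟨ ⊕-assoc t v _ ⟨
    (t ⊕ v) ⊕ (u ⊕ w)    ∎

  combination-⊕ : ∀ bs cs (vs : Vec (Word n) k) → combination (bs ⊕ cs) vs ≡ combination bs vs ⊕ combination cs vs
  combination-⊕ []       []       []       = sym (⊕-identityˡ 𝟎)
  combination-⊕ (b ∷ bs) (c ∷ cs) (v ∷ vs) = trans
    (cong₂ _⊕_ (xor-· b c v) (combination-⊕ bs cs vs))
    (⊕-interchange (b · v) (c · v) _ _)

  InSpan : Vec (Word n) k → Word n → Set
  InSpan vs w = ∃[ bs ] combination bs vs ≡ w

  -- The coefficient of the first vector `v` is 0 or 1, so the search continues for `w` and for
  -- `v ⊕ w` among the remaining vectors.
  inSpan? : (vs : Vec (Word n) k) (w : Word n) → Dec (InSpan vs w)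
  inSpan? []       w = map′ (λ 𝟎≡w → [] , 𝟎≡w) (λ { ([] , 𝟎≡w) → 𝟎≡w }) (Vec.≡-dec Bool._≟_ 𝟎 w)
  inSpan? (v ∷ vs) w with inSpan? vs w | inSpan? vs (v ⊕ w)
  ... | yes (bs , eq) | _             = yes (false ∷ bs , trans (combination-false bs v vs) eq)
  ... | no _          | yes (bs , eq) = yes (true ∷ bs , trans (combination-true bs v vs) (trans (cong (v ⊕_) eq) (⊕-cancelˡ v w)))
  ... | no ∉          | no ∉⊕         = no λ where
    (false ∷ bs , eq) → ∉ (bs , trans (sym (combination-false bs v vs)) eq)
    (true ∷ bs , eq)  → ∉⊕ (bs , trans (sym (⊕-cancelˡ v _)) (cong (v ⊕_) (trans (sym (combination-true bs v vs)) eq)))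

  Independent : Vec (Word n) k → Set
  Independent vs = ∀ bs → combination bs vs ≡ 𝟎 → bs ≡ 𝟎

  independent-∷ : ∀ {v} {vs : Vec (Word n) k} → ¬ InSpan vs v → Independent vs → Independent (v ∷ vs)
  independent-∷ {v = v} {vs} ∉ ind (false ∷ bs) eq = cong (false ∷_) (ind bs (trans (sym (combination-false bs v vs)) eq))
  independent-∷ {v = v} {vs} ∉ ind (true ∷ bs)  eq =
    contradiction (bs , sym (⊕≡𝟎⇒≡ v _ (trans (sym (combination-true bs v vs)) eq))) ∉

  combination-injective : ∀ {vs : Vec (Word n) k} → Independent vs → ∀ {bs cs} → combination bs vs ≡ combination cs vs → bs ≡ cs
  combination-injective {vs = vs} ind {bs} {cs} eq = ⊕≡𝟎⇒≡ bs cs (ind (bs ⊕ cs) (begin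
    combination (bs ⊕ cs) vs                    ≡⟨ combination-⊕ bs cs vs ⟩
    combination bs vs ⊕ combination cs vs       ≡⟨ cong (_⊕ combination cs vs) eq ⟩
    combination cs vs ⊕ combination cs vs       ≡⟨ ⊕-self _ ⟩
    𝟎                                           ∎))

  allWords : ∀ k → List (Word k)
  allWords zero    = [] ∷ []
  allWords (suc k) = List.cartesianProductWith _∷_ (false ∷ true ∷ []) (allWords k)

  allWords-complete : ∀ {k} (w : Word k) → w ∈ allWords k
  allWords-complete []      = here refl
  allWords-complete (b ∷ w) = ∈-cartesianProductWith⁺ _∷_ (bit b) (allWords-complete w)
    where
    bit : ∀ b → b ∈ false ∷ true ∷ []
    bit false = here refl
    bit true  = there (here refl)

  allWords-unique : ∀ k → Unique (allWords k)
  allWords-unique zero    = [] ∷ []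
  allWords-unique (suc k) = Unique.cartesianProductWith⁺ _∷_ Vec.∷-injective (((λ ()) ∷ []) ∷ [] ∷ []) (allWords-unique k)

  length-allWords : ∀ k → List.length (allWords k) ≡ 2 ℕ.^ k
  length-allWords zero    = refl
  length-allWords (suc k) = begin
    List.length (List.map (false ∷_) ws ++ List.map (true ∷_) ws ++ [])
      ≡⟨ List.length-++ (List.map (false ∷_) ws) ⟩
    List.length (List.map (false ∷_) ws) ℕ.+ List.length (List.map (true ∷_) ws ++ [])
      ≡⟨ cong₂ ℕ._+_ (length-map false) (trans (List.length-++ (List.map (true ∷_) ws)) (cong (ℕ._+ 0) (length-map true))) ⟩
    2 ℕ.^ suc k    ∎
    where
    ws = allWords k
    length-map : ∀ b → List.length (List.map (b Vec.∷_) ws) ≡ 2 ℕ.^ k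
    length-map b = trans (List.length-map (b ∷_) ws) (length-allWords k)

  module _ {C : Code n ℓ} (isLinear : IsLinear C) where
    open IsLinear isLinear

    combination-member : ∀ bs (vs : Vec (Word n) k) → (∀ i → C (lookup vs i)) → C (combination bs vs)
    combination-member []       []       vs∈C = 𝟎-member
    combination-member (b ∷ bs) (v ∷ vs) vs∈C = ⊕-closed (·-closed b (vs∈C zero)) (combination-member bs vs (vs∈C ∘ suc))

    -- Greedy selection: a word is kept exactly when it lies outside the span of the words already
    -- kept from the rest of the list.
    independentGenerators : ∀ {ws} → All C ws →
      ∃[ k ] ∃[ vs ] (∀ i → C (lookup {n = k} vs i)) × Independent vs × All (InSpan vs) ws
    independentGenerators [] = 0 , [] , (λ ()) , (λ { [] _ → refl }) , []
    independentGenerators {w ∷ ws} (w∈C ∷ ws∈C) with k , vs , vs∈C , ind , spans ← independentGenerators ws∈C | inSpan? vs w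
    ... | yes w∈span = k , vs , vs∈C , ind , w∈span ∷ spans
    ... | no  w∉span = suc k , w ∷ vs , (λ { zero → w∈C ; (suc i) → vs∈C i }) , independent-∷ w∉span ind
      , (true ∷ 𝟎 , trans (combination-true 𝟎 w vs) (trans (cong (w ⊕_) (combination-𝟎 vs)) (⊕-identityʳ w)))
      ∷ All.map (λ (bs , eq) → false ∷ bs , trans (combination-false bs w vs) eq) spans
      where
      combination-𝟎 : ∀ {k} (vs : Vec (Word n) k) → combination 𝟎 vs ≡ 𝟎
      combination-𝟎 []       = refl
      combination-𝟎 (v ∷ vs) = trans (combination-false 𝟎 v vs) (combination-𝟎 vs)

    -- The greedy basis has some size `j` not known in advance. Its combinations are pairwise
    -- distinct and exhaust the code, so the code has 2^j words, and comparison with the given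
    -- number 2^k identifies `j` with `k`.
    dimension-from-size : ∀ {ws} k → Unique ws → (∀ {w} → C w → w ∈ ws) → (∀ {w} → w ∈ ws → C w) →
      List.length ws ≡ 2 ℕ.^ k → HasDimension C k
    dimension-from-size {ws} k uws complete sound length≡ with j , vs , vs∈C , ind , spans ← independentGenerators (All.tabulate sound) =
      subst (HasDimension C) (2^-injective (trans (sym length≡2^j) length≡)) (vs , record
        { members     = vs∈C
        ; independent = ind
        ; spanning    = All.lookup spans ∘ complete
        })
      where
      combine : Word j → Word n
      combine bs = combination bs vs

      length≡2^j : List.length ws ≡ 2 ℕ.^ j
      length≡2^j = begin
        List.length ws                                   ≡⟨ same-elements⇒same-length uws
          (Unique.map⁺ (combination-injective ind) (allWords-unique j))
          (λ w∈ws → let bs , eq = All.lookup spans w∈ws in subst (_∈ List.map combine (allWords j)) eq (∈-map⁺ combine (allWords-complete bs)))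
          (λ w∈map → let bs , _ , eq = ∈-map⁻ combine w∈map in complete (subst C (sym eq) (combination-member bs vs vs∈C))) ⟩
        List.length (List.map combine (allWords j))      ≡⟨ List.length-map combine (allWords j) ⟩
        List.length (allWords j)                         ≡⟨ length-allWords j ⟩
        2 ℕ.^ j                                          ∎

      2^-injective : ∀ {i j} → 2 ℕ.^ i ≡ 2 ℕ.^ j → i ≡ j
      2^-injective {i} {j} eq = ℕ.≤-antisym
        (ℕ.≮⇒≥ λ j<i → ℕ.<⇒≢ (ℕ.^-monoʳ-< 2 (ℕ.s≤s (ℕ.s≤s ℕ.z≤n)) j<i) (sym eq))
        (ℕ.≮⇒≥ λ i<j → ℕ.<⇒≢ (ℕ.^-monoʳ-< 2 (ℕ.s≤s (ℕ.s≤s ℕ.z≤n)) i<j) eq)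

open BinaryCodes

-- The closed formulas of the table as rational numbers.

module RationalFormulas where

  open ≡ using (refl; sym; trans; cong; cong₂; module ≡-Reasoning)
  open ≡-Reasoning
  open ℤ.+-*-Solver
  open ℚ using (_≃_; *≡*; _/_; _+_; _-_; _*_)

  module _ (N : ℕ) (Q : ℤ) where

    -- In this and the next three lemmas `Q` stands for 2^(2s) and the `p₁`, `p₂`, `p₃` for the
    -- powers of two in the table. They are tied to `Q` by products, which keeps subtraction in
    -- exponents out of the algebra.
    formula₀ : ∀ p₁ p₂ p₃ → + 32 ℤ.* + N ≡ + 29 ℤ.* Q ℤ.* Q ℤ.* Q ℤ.- + 33 ℤ.* Q ℤ.* Q ℤ.+ + 68 ℤ.* Q ℤ.- + 64 →
      + 32 ℤ.* + p₁ ≡ Q ℤ.* Q ℤ.* Q → + 32 ℤ.* + p₂ ≡ Q ℤ.* Q → + 8 ℤ.* + p₃ ≡ Q →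
      fromℕ N ≃ fromℕ 29 * fromℕ p₁ - fromℕ 33 * fromℕ p₂ + fromℕ 17 * fromℕ p₃ - fromℕ 2
    formula₀ p₁ p₂ p₃ eq e₁ e₂ e₃ = *≡* (ℤ.*-cancelˡ-≡ (+ 32) _ _ (begin
      + 32 ℤ.* (+ N ℤ.* + 1)        ≡⟨ cong (λ t → + 32 ℤ.* t) (ℤ.*-identityʳ (+ N)) ⟩
      + 32 ℤ.* + N                  ≡⟨ eq ⟩
      + 29 ℤ.* Q ℤ.* Q ℤ.* Q ℤ.- + 33 ℤ.* Q ℤ.* Q ℤ.+ + 68 ℤ.* Q ℤ.- + 64
        ≡⟨ solve 1 (λ Q → con (+ 29) :* Q :* Q :* Q :- con (+ 33) :* Q :* Q :+ con (+ 68) :* Q :- con (+ 64)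
             := con (+ 29) :* (Q :* Q :* Q) :- con (+ 33) :* (Q :* Q) :+ con (+ 68) :* Q :- con (+ 64)) refl Q ⟩
      + 29 ℤ.* (Q ℤ.* Q ℤ.* Q) ℤ.- + 33 ℤ.* (Q ℤ.* Q) ℤ.+ + 68 ℤ.* Q ℤ.- + 64
        ≡⟨ cong (λ t → t ℤ.- + 64) (cong₂ (λ s t → s ℤ.+ + 68 ℤ.* t) (cong₂ (λ s t → + 29 ℤ.* s ℤ.- + 33 ℤ.* t) e₁ e₂) e₃) ⟨
      + 29 ℤ.* (+ 32 ℤ.* + p₁) ℤ.- + 33 ℤ.* (+ 32 ℤ.* + p₂) ℤ.+ + 68 ℤ.* (+ 8 ℤ.* + p₃) ℤ.- + 64
        -- The factors `con 1ℤ` are the unit denominators that unnormalised rational arithmetic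
        -- leaves in the numerator.
        ≡⟨ solve 3 (λ p₁ p₂ p₃ → con (+ 29) :* (con (+ 32) :* p₁) :- con (+ 33) :* (con (+ 32) :* p₂) :+ con (+ 68) :* (con (+ 8) :* p₃) :- con (+ 64)
             := con (+ 32) :* ((((con (+ 29) :* p₁ :* con 1ℤ :+ (:- (con (+ 33) :* p₂)) :* con 1ℤ) :* con 1ℤ :+ con (+ 17) :* p₃ :* con 1ℤ) :* con 1ℤ
                  :+ (:- con (+ 2)) :* con 1ℤ) :* con 1ℤ)) refl (+ p₁) (+ p₂) (+ p₃) ⟩
      _ ∎))

    formula₁ : ∀ p₁ p₂ → + 15 ℤ.* + N ≡ + 6 ℤ.* Q ℤ.* Q ℤ.* Q ℤ.+ + 10 ℤ.* Q ℤ.* Q ℤ.- + 16 ℤ.* Q →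
      + p₁ ≡ Q → + p₂ ≡ Q ℤ.* Q →
      fromℕ N ≃ (+ 2 / 15) * fromℕ p₁ * (fromℕ 3 * fromℕ p₂ + fromℕ 5 * fromℕ p₁ - fromℕ 8)
    formula₁ p₁ p₂ eq refl e₂ = *≡* (begin
      + N ℤ.* + 15                  ≡⟨ ℤ.*-comm (+ N) (+ 15) ⟩
      + 15 ℤ.* + N                  ≡⟨ eq ⟩
      + 6 ℤ.* Q ℤ.* Q ℤ.* Q ℤ.+ + 10 ℤ.* Q ℤ.* Q ℤ.- + 16 ℤ.* Q
        ≡⟨ solve 1 (λ Q → con (+ 6) :* Q :* Q :* Q :+ con (+ 10) :* Q :* Q :- con (+ 16) :* Q
             := con (+ 2) :* Q :* (con (+ 3) :* (Q :* Q) :+ con (+ 5) :* Q :- con (+ 8))) refl Q ⟩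
      + 2 ℤ.* Q ℤ.* (+ 3 ℤ.* (Q ℤ.* Q) ℤ.+ + 5 ℤ.* Q ℤ.- + 8)
        ≡⟨ cong (λ t → + 2 ℤ.* Q ℤ.* (+ 3 ℤ.* t ℤ.+ + 5 ℤ.* Q ℤ.- + 8)) e₂ ⟨
      + 2 ℤ.* Q ℤ.* (+ 3 ℤ.* + p₂ ℤ.+ + 5 ℤ.* Q ℤ.- + 8)
        ≡⟨ solve 2 (λ Q p₂ → con (+ 2) :* Q :* (con (+ 3) :* p₂ :+ con (+ 5) :* Q :- con (+ 8))
             := con (+ 2) :* Q :* ((con (+ 3) :* p₂ :* con 1ℤ :+ con (+ 5) :* Q :* con 1ℤ) :* con 1ℤ :+ (:- con (+ 8)) :* con 1ℤ) :* con 1ℤ) refl Q (+ p₂) ⟩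
      _ ∎)

    formula₂ : ∀ p₁ p₂ → + 48 ℤ.* + N ≡ + 7 ℤ.* Q ℤ.* Q ℤ.* Q ℤ.- + 7 ℤ.* Q ℤ.* Q →
      + 16 ℤ.* + p₁ ≡ Q ℤ.* Q → + p₂ ≡ Q →
      fromℕ N ≃ (+ 7 / 3) * fromℕ p₁ * (fromℕ p₂ - fromℕ 1)
    formula₂ p₁ p₂ eq e₁ refl = *≡* (ℤ.*-cancelˡ-≡ (+ 16) _ _ (begin
      + 16 ℤ.* (+ N ℤ.* + 3)        ≡⟨ solve 1 (λ N → con (+ 16) :* (N :* con (+ 3)) := con (+ 48) :* N) refl (+ N) ⟩
      + 48 ℤ.* + N                  ≡⟨ eq ⟩
      + 7 ℤ.* Q ℤ.* Q ℤ.* Q ℤ.- + 7 ℤ.* Q ℤ.* Q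
        ≡⟨ solve 1 (λ Q → con (+ 7) :* Q :* Q :* Q :- con (+ 7) :* Q :* Q := con (+ 7) :* (Q :* Q) :* (Q :- con 1ℤ)) refl Q ⟩
      + 7 ℤ.* (Q ℤ.* Q) ℤ.* (Q ℤ.- 1ℤ)          ≡⟨ cong (λ t → + 7 ℤ.* t ℤ.* (Q ℤ.- 1ℤ)) e₁ ⟨
      + 7 ℤ.* (+ 16 ℤ.* + p₁) ℤ.* (Q ℤ.- 1ℤ)
        ≡⟨ solve 2 (λ Q p₁ → con (+ 7) :* (con (+ 16) :* p₁) :* (Q :- con 1ℤ)
             := con (+ 16) :* (con (+ 7) :* p₁ :* (Q :* con 1ℤ :+ (:- con 1ℤ) :* con 1ℤ) :* con 1ℤ)) refl Q (+ p₁) ⟩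
      _ ∎))

    formula₃ : ∀ p₁ p₂ p₃ → + 960 ℤ.* + N ≡ Q ℤ.* Q ℤ.* Q ℤ.- + 5 ℤ.* Q ℤ.* Q ℤ.+ + 4 ℤ.* Q →
      + 16 ℤ.* + p₁ ≡ Q → + 4 ℤ.* + p₂ ≡ Q ℤ.* Q → + 4 ℤ.* + p₃ ≡ Q →
      fromℕ N ≃ (+ 1 / 15) * fromℕ p₁ * (fromℕ p₂ - fromℕ 5 * fromℕ p₃ + fromℕ 1)
    formula₃ p₁ p₂ p₃ eq e₁ e₂ e₃ = *≡* (ℤ.*-cancelˡ-≡ (+ 64) _ _ (begin
      + 64 ℤ.* (+ N ℤ.* + 15)       ≡⟨ solve 1 (λ N → con (+ 64) :* (N :* con (+ 15)) := con (+ 960) :* N) refl (+ N) ⟩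
      + 960 ℤ.* + N                 ≡⟨ eq ⟩
      Q ℤ.* Q ℤ.* Q ℤ.- + 5 ℤ.* Q ℤ.* Q ℤ.+ + 4 ℤ.* Q
        ≡⟨ solve 1 (λ Q → Q :* Q :* Q :- con (+ 5) :* Q :* Q :+ con (+ 4) :* Q := Q :* (Q :* Q :- con (+ 5) :* Q :+ con (+ 4))) refl Q ⟩
      Q ℤ.* (Q ℤ.* Q ℤ.- + 5 ℤ.* Q ℤ.+ + 4)
        ≡⟨ cong₂ ℤ._*_ e₁ (cong₂ (λ s t → s ℤ.- + 5 ℤ.* t ℤ.+ + 4) e₂ e₃) ⟨
      + 16 ℤ.* + p₁ ℤ.* (+ 4 ℤ.* + p₂ ℤ.- + 5 ℤ.* (+ 4 ℤ.* + p₃) ℤ.+ + 4)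
        ≡⟨ solve 3 (λ p₁ p₂ p₃ → con (+ 16) :* p₁ :* (con (+ 4) :* p₂ :- con (+ 5) :* (con (+ 4) :* p₃) :+ con (+ 4))
             := con (+ 64) :* (con 1ℤ :* p₁ :* ((p₂ :* con 1ℤ :+ (:- (con (+ 5) :* p₃)) :* con 1ℤ) :* con 1ℤ :+ con 1ℤ :* con 1ℤ) :* con 1ℤ)) refl (+ p₁) (+ p₂) (+ p₃) ⟩
      _ ∎))

open RationalFormulas

-- The field with 2^m elements on `Fin q`: characteristic 2, Frobenius and trace.

module FiniteField
  {q : ℕ} (m : ℕ) (q≡2^m : q ≡ 2 ℕ.^ m)
  {_+_ _*_ : Op₂ (Fin q)} { -_ : Op₁ (Fin q)} {0# 1# : Fin q}
  (isCommutativeRing : IsCommutativeRing _≡_ _+_ _*_ -_ 0# 1#)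
  (1≢0 : 1# ≢ 0#)
  (inverse : ∀ x → x ≢ 0# → ∃[ y ] x * y ≡ 1#) where

  open ≡ using (refl; sym; trans; cong; cong₂; subst; module ≡-Reasoning)

  infixl 6 _⊞_
  infixl 7 _⊠_
  infix  8 ⊟_

  𝔽 : Set
  𝔽 = Fin q

  _⊞_ _⊠_ : Op₂ 𝔽
  _⊞_ = _+_
  _⊠_ = _*_

  ⊟_ : Op₁ 𝔽
  ⊟_ = -_

  ring : CommutativeRing _ _
  ring = record { isCommutativeRing = isCommutativeRing }

  module R = CommutativeRing ring
  open R using (+-assoc; +-comm; *-assoc; *-comm; +-identityˡ; +-identityʳ; *-identityˡ; *-identityʳ; zeroˡ; zeroʳ; distribˡ; distribʳ)
  open import Algebra.Properties.Ring R.ring using (+-cancelʳ)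
  open import Algebra.Properties.Semiring.Exp R.semiring using (_^_; ^-assocʳ) public
  open import Algebra.Properties.Monoid.Mult R.+-monoid as Mult using () renaming (_×_ to _×ᶠ_) public
  import Algebra.Properties.CommutativeMonoid.Sum R.+-commutativeMonoid as Sum
  import Algebra.Properties.CommutativeMonoid.Sum R.*-commutativeMonoid as Product
  open ≡-Reasoning

  cancel-nonzero : ∀ {x y} → x ≢ 0# → x ⊠ y ≡ 0# → y ≡ 0#
  cancel-nonzero {x} {y} x≢0 xy≡0 with x⁻¹ , xx⁻¹≡1 ← inverse x x≢0 = begin
    y                ≡⟨ *-identityˡ y ⟨
    1# ⊠ y           ≡⟨ cong (_⊠ y) (trans (*-comm x⁻¹ x) xx⁻¹≡1) ⟨
    x⁻¹ ⊠ x ⊠ y      ≡⟨ *-assoc x⁻¹ x y ⟩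
    x⁻¹ ⊠ (x ⊠ y)    ≡⟨ cong (x⁻¹ ⊠_) xy≡0 ⟩
    x⁻¹ ⊠ 0#         ≡⟨ zeroʳ x⁻¹ ⟩
    0#               ∎

  zero-product : ∀ x y → x ⊠ y ≡ 0# → x ≡ 0# ⊎ y ≡ 0#
  zero-product x y xy≡0 with x ≟ 0#
  ... | yes x≡0 = inj₁ x≡0
  ... | no  x≢0 = inj₂ (cancel-nonzero x≢0 xy≡0)

  -- Translation by 1 permutes the field, so adding 1 to each of the `q` elements leaves the sum of
  -- all elements unchanged.
  q×1≡0 : q ×ᶠ 1# ≡ 0#
  q×1≡0 = +-cancelʳ (Sum.sum id) _ _ (begin
    q ×ᶠ 1# ⊞ Sum.sum id                   ≡⟨ cong (_⊞ Sum.sum id) (Sum.sum-replicate q {1#}) ⟨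
    Sum.sum {q} (λ _ → 1#) ⊞ Sum.sum {q} id    ≡⟨ Sum.∑-distrib-+ {q} (λ _ → 1#) id ⟨
    Sum.sum (λ x → 1# ⊞ x)                 ≡⟨ Sum.sum-permute id shift ⟨
    Sum.sum id                             ≡⟨ +-identityˡ _ ⟨
    0# ⊞ Sum.sum id                        ∎)
    where
    shift = permutation (1# ⊞_) (⊟ 1# ⊞_)
      (λ y → trans (sym (+-assoc 1# (⊟ 1#) y)) (trans (cong (_⊞ y) (R.-‿inverseʳ 1#)) (+-identityˡ y)))
      (λ y → trans (sym (+-assoc (⊟ 1#) 1# y)) (trans (cong (_⊞ y) (R.-‿inverseˡ 1#)) (+-identityˡ y)))

  -- Since `q` is a power of two, `q ×ᶠ 1#` is a power of `1# ⊞ 1#`, and there are no zero divisors.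
  2×1≡0 : 1# ⊞ 1# ≡ 0#
  2×1≡0 = from-power m (trans (cong (_×ᶠ 1#) (sym q≡2^m)) q×1≡0)
    where
    double : ∀ n → (2 ℕ.* n) ×ᶠ 1# ≡ (1# ⊞ 1#) ⊠ (n ×ᶠ 1#)
    double n = begin
      (n ℕ.+ (n ℕ.+ 0)) ×ᶠ 1#        ≡⟨ Mult.×-homo-+ 1# n (n ℕ.+ 0) ⟩
      n ×ᶠ 1# ⊞ (n ℕ.+ 0) ×ᶠ 1#      ≡⟨ cong (n ×ᶠ 1# ⊞_) (trans (Mult.×-homo-+ 1# n 0) (+-identityʳ _)) ⟩
      n ×ᶠ 1# ⊞ n ×ᶠ 1#              ≡⟨ cong₂ _⊞_ (*-identityˡ _) (*-identityˡ _) ⟨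
      1# ⊠ n ×ᶠ 1# ⊞ 1# ⊠ n ×ᶠ 1#    ≡⟨ distribʳ (n ×ᶠ 1#) 1# 1# ⟨
      (1# ⊞ 1#) ⊠ (n ×ᶠ 1#)          ∎

    from-power : ∀ k → (2 ℕ.^ k) ×ᶠ 1# ≡ 0# → 1# ⊞ 1# ≡ 0#
    from-power zero    eq = contradiction (trans (sym (+-identityʳ 1#)) eq) 1≢0
    from-power (suc k) eq with zero-product _ _ (trans (sym (double (2 ℕ.^ k))) eq)
    ... | inj₁ 2≡0   = 2≡0
    ... | inj₂ 2^k≡0 = from-power k 2^k≡0

  x+x≡0 : ∀ x → x ⊞ x ≡ 0#
  x+x≡0 x = begin
    x ⊞ x              ≡⟨ cong₂ _⊞_ (*-identityˡ x) (*-identityˡ x) ⟨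
    1# ⊠ x ⊞ 1# ⊠ x    ≡⟨ distribʳ x 1# 1# ⟨
    (1# ⊞ 1#) ⊠ x      ≡⟨ cong (_⊠ x) 2×1≡0 ⟩
    0# ⊠ x             ≡⟨ zeroˡ x ⟩
    0#                 ∎

  -x≡x : ∀ x → ⊟ x ≡ x
  -x≡x x = +-cancelʳ x _ _ (trans (R.-‿inverseˡ x) (sym (x+x≡0 x)))

  x+y≡0⇒x≡y : ∀ {x y} → x ⊞ y ≡ 0# → x ≡ y
  x+y≡0⇒x≡y {x} {y} eq = +-cancelʳ y x y (trans eq (sym (x+x≡0 y)))

  embed₂ : Bool → 𝔽
  embed₂ b = if b then 1# else 0#

  embed₂-xor : ∀ b b′ → embed₂ (b xor b′) ≡ embed₂ b ⊞ embed₂ b′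
  embed₂-xor true  true  = sym 2×1≡0
  embed₂-xor true  false = sym (+-identityʳ 1#)
  embed₂-xor false b′    = sym (+-identityˡ _)

  embed₂-∧ : ∀ b b′ → embed₂ (b ∧ b′) ≡ embed₂ b ⊠ embed₂ b′
  embed₂-∧ true  b′ = sym (*-identityˡ _)
  embed₂-∧ false b′ = sym (zeroˡ _)

  embed₂-injective : ∀ {b b′} → embed₂ b ≡ embed₂ b′ → b ≡ b′
  embed₂-injective {true}  {true}  eq = refl
  embed₂-injective {true}  {false} eq = contradiction eq 1≢0
  embed₂-injective {false} {true}  eq = contradiction (sym eq) 1≢0
  embed₂-injective {false} {false} eq = refl

  -- With coefficients in 𝔽₂ the ring solver decides identities in characteristic 2.
  boolRing : RawRing _ _
  boolRing = record
    { Carrier = Bool ; _≈_ = _≡_ ; _+_ = _xor_ ; _*_ = _∧_ ; -_ = id ; 0# = false ; 1# = true }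

  embed₂-morphism : boolRing -Raw-AlmostCommutative⟶ fromCommutativeRing ring
  embed₂-morphism = record
    { ⟦_⟧ = embed₂ ; +-homo = embed₂-xor ; *-homo = embed₂-∧
    ; -‿homo = λ b → sym (-x≡x (embed₂ b)) ; 0-homo = refl ; 1-homo = refl }

  module Char2 = Algebra.Solver.Ring boolRing (fromCommutativeRing ring) embed₂-morphism
    (λ b b′ → Maybe.map (cong embed₂) (dec⇒maybe (b Bool.≟ b′)))

  frob : ℕ → 𝔽 → 𝔽
  frob zero    x = x
  frob (suc k) x = frob k (x ⊠ x)

  ^-frob : ∀ k x → x ^ (2 ℕ.^ k) ≡ frob k x
  ^-frob zero    x = *-identityʳ x
  ^-frob (suc k) x = begin
    x ^ (2 ℕ.* 2 ℕ.^ k)        ≡⟨ ^-assocʳ x 2 (2 ℕ.^ k) ⟨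
    (x ^ 2) ^ (2 ℕ.^ k)        ≡⟨ cong (λ t → (x ⊠ t) ^ (2 ℕ.^ k)) (*-identityʳ x) ⟩
    (x ⊠ x) ^ (2 ℕ.^ k)        ≡⟨ ^-frob k (x ⊠ x) ⟩
    frob k (x ⊠ x)             ∎

  -- Replacing 0 by 1 lets a product indexed by all of `Fin q` stand for the product of the nonzero
  -- elements.
  orOne : 𝔽 → 𝔽
  orOne x = if does (x ≟ 0#) then 1# else x

  orOne-nonzero : ∀ x → orOne x ≢ 0#
  orOne-nonzero x with x ≟ 0#
  ... | yes _  = 1≢0
  ... | no x≢0 = x≢0

  product-nonzero : ∀ {n} (f : Fin n → 𝔽) → (∀ i → f i ≢ 0#) → Product.sum f ≢ 0#
  product-nonzero {zero}  f f≢0 = 1≢0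
  product-nonzero {suc n} f f≢0 eq =
    product-nonzero (f ∘ suc) (λ i → f≢0 (suc i)) (cancel-nonzero (f≢0 zero) eq)

  -- Scaling by x permutes the nonzero elements, so their product P satisfies x P = x^q P.
  x^q≡x : ∀ x → frob m x ≡ x
  x^q≡x x with x ≟ 0#
  ... | yes refl = frob-0 m
    where
    frob-0 : ∀ k → frob k 0# ≡ 0#
    frob-0 zero    = refl
    frob-0 (suc k) = trans (cong (frob k) (zeroˡ 0#)) (frob-0 k)
  ... | no x≢0 with x⁻¹ , xx⁻¹≡1 ← inverse x x≢0 = begin
    frob m x           ≡⟨ ^-frob m x ⟨
    x ^ (2 ℕ.^ m)      ≡⟨ cong (x ^_) q≡2^m ⟨
    x ^ q              ≡⟨ x+y≡0⇒x≡y (cancel-nonzero P≢0 P*0≡0) ⟨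
    x                  ∎
    where
    P = Product.sum {q} orOne
    P≢0 : P ≢ 0#
    P≢0 = product-nonzero orOne orOne-nonzero

    -- Scaling fixes 0, where `orOne` gives 1 on both sides, so one factor `x` is missing there.
    -- Supplying it makes `x` occur `q` times, which yields x^q where the nonzero elements alone
    -- would yield x^(q-1).
    factor : 𝔽 → 𝔽
    factor y = if does (y ≟ 0#) then x else 1#

    scale : ∀ y → orOne (x ⊠ y) ⊠ factor y ≡ x ⊠ orOne y
    scale y with y ≟ 0#
    ... | yes refl with x ⊠ 0# ≟ 0#
    ...   | yes _   = *-comm 1# x
    ...   | no x0≢0 = contradiction (zeroʳ x) x0≢0
    scale y | no y≢0 with x ⊠ y ≟ 0#
    ...   | yes xy≡0 = contradiction (cancel-nonzero x≢0 xy≡0) y≢0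
    ...   | no _     = *-identityʳ (x ⊠ y)

    cancel : ∀ {a b} → a ⊠ b ≡ 1# → ∀ y → a ⊠ (b ⊠ y) ≡ y
    cancel {a} {b} ab≡1 y = trans (sym (*-assoc a b y)) (trans (cong (_⊠ y) ab≡1) (*-identityˡ y))

    xP≡x^qP : x ⊠ P ≡ x ^ q ⊠ P
    xP≡x^qP = begin
      x ⊠ P                                                            ≡⟨ *-comm x P ⟩
      P ⊠ x                                                            ≡⟨ cong₂ _⊠_
        (Product.sum-permute {q} orOne (permutation (x ⊠_) (x⁻¹ ⊠_) (cancel xx⁻¹≡1) (cancel (trans (*-comm x⁻¹ x) xx⁻¹≡1))))
        (sym (SelectedSum.sum-select R.*-commutativeMonoid 0# x)) ⟩
      Product.sum (λ y → orOne (x ⊠ y)) ⊠ Product.sum factor           ≡⟨ Product.∑-distrib-+ (λ y → orOne (x ⊠ y)) factor ⟨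
      Product.sum (λ y → orOne (x ⊠ y) ⊠ factor y)                     ≡⟨ Product.sum-cong-≗ scale ⟩
      Product.sum (λ y → x ⊠ orOne y)                                  ≡⟨ Product.∑-distrib-+ {q} (λ _ → x) orOne ⟩
      Product.sum {q} (λ _ → x) ⊠ P                                    ≡⟨ cong (_⊠ P) (Product.sum-replicate q {x}) ⟩
      x ^ q ⊠ P                                                        ∎

    P*0≡0 : P ⊠ (x ⊞ x ^ q) ≡ 0#
    P*0≡0 = begin
      P ⊠ (x ⊞ x ^ q)        ≡⟨ *-comm P _ ⟩
      (x ⊞ x ^ q) ⊠ P        ≡⟨ distribʳ P x (x ^ q) ⟩
      x ⊠ P ⊞ x ^ q ⊠ P      ≡⟨ cong (_⊞ x ^ q ⊠ P) xP≡x^qP ⟩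
      x ^ q ⊠ P ⊞ x ^ q ⊠ P  ≡⟨ x+x≡0 _ ⟩
      0#                     ∎

  frob-* : ∀ k x y → frob k (x ⊠ y) ≡ frob k x ⊠ frob k y
  frob-* zero    x y = refl
  frob-* (suc k) x y = trans
    (cong (frob k) (Char2.solve 2 (λ x y → (x :* y) :* (x :* y) := (x :* x) :* (y :* y)) refl x y))
    (frob-* k (x ⊠ x) (y ⊠ y))
    where
    open Char2

  square-+ : ∀ x y → (x ⊞ y) ⊠ (x ⊞ y) ≡ x ⊠ x ⊞ y ⊠ y
  square-+ = Char2.solve 2 (λ x y → (x :+ y) :* (x :+ y) := x :* x :+ y :* y) refl
    where
    open Char2

  trace : ℕ → 𝔽 → 𝔽
  trace zero    x = 0#
  trace (suc k) x = x ⊞ trace k (x ⊠ x)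

  trace-+ : ∀ k x y → trace k (x ⊞ y) ≡ trace k x ⊞ trace k y
  trace-+ zero    x y = sym (+-identityˡ 0#)
  trace-+ (suc k) x y = begin
    x ⊞ y ⊞ trace k ((x ⊞ y) ⊠ (x ⊞ y))                ≡⟨ cong (λ t → x ⊞ y ⊞ trace k t) (square-+ x y) ⟩
    x ⊞ y ⊞ trace k (x ⊠ x ⊞ y ⊠ y)                    ≡⟨ cong (x ⊞ y ⊞_) (trace-+ k (x ⊠ x) (y ⊠ y)) ⟩
    x ⊞ y ⊞ (trace k (x ⊠ x) ⊞ trace k (y ⊠ y))        ≡⟨ Char2.solve 4 (λ x y z w → x :+ y :+ (z :+ w) := x :+ z :+ (y :+ w)) refl x y _ _ ⟩
    x ⊞ trace k (x ⊠ x) ⊞ (y ⊞ trace k (y ⊠ y))        ∎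
    where
    open Char2

  trace-square : ∀ k x → trace k (x ⊠ x) ≡ trace k x ⊠ trace k x
  trace-square zero    x = sym (zeroˡ 0#)
  trace-square (suc k) x = begin
    x ⊠ x ⊞ trace k (x ⊠ x ⊠ (x ⊠ x))                  ≡⟨ cong (x ⊠ x ⊞_) (trace-square k (x ⊠ x)) ⟩
    x ⊠ x ⊞ trace k (x ⊠ x) ⊠ trace k (x ⊠ x)          ≡⟨ square-+ x _ ⟨
    trace (suc k) x ⊠ trace (suc k) x                  ∎

  trace-last : ∀ k x → trace (suc k) x ≡ trace k x ⊞ frob k x
  trace-last zero    x = trans (+-identityʳ x) (sym (+-identityˡ x))
  trace-last (suc k) x = trans (cong (x ⊞_) (trace-last k (x ⊠ x))) (sym (+-assoc x _ _))

  -- `trace (suc m) x` can be split at its first term or at its last one. The first is x, and the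
  -- last is x^q = x.
  trace-invariant : ∀ x → trace m (x ⊠ x) ≡ trace m x
  trace-invariant x = +-cancelʳ x _ _ (begin
    trace m (x ⊠ x) ⊞ x    ≡⟨ +-comm _ x ⟩
    trace (suc m) x        ≡⟨ trace-last m x ⟩
    trace m x ⊞ frob m x   ≡⟨ cong (trace m x ⊞_) (x^q≡x x) ⟩
    trace m x ⊞ x          ∎)

  tr : 𝔽 → Bool
  tr x = does (trace m x ≟ 1#)

  -- The square of the trace t of x is the trace of x², which is t again. Hence t (t + 1) = 0, and t
  -- is 0 or 1.
  embed₂-tr : ∀ x → embed₂ (tr x) ≡ trace m x
  embed₂-tr x with trace m x ≟ 1#
  ... | yes eq = sym eq
  ... | no ≢1 with zero-product (trace m x) (trace m x ⊞ 1#) (begin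
        trace m x ⊠ (trace m x ⊞ 1#)          ≡⟨ distribˡ _ _ 1# ⟩
        trace m x ⊠ trace m x ⊞ trace m x ⊠ 1#
          ≡⟨ cong₂ _⊞_ (trans (sym (trace-square m x)) (trace-invariant x)) (*-identityʳ _) ⟩
        trace m x ⊞ trace m x                  ≡⟨ x+x≡0 _ ⟩
        0#                                     ∎)
  ...   | inj₁ t≡0   = sym t≡0
  ...   | inj₂ t+1≡0 = contradiction (x+y≡0⇒x≡y t+1≡0) ≢1

  tr-+ : ∀ x y → tr (x ⊞ y) ≡ tr x xor tr y
  tr-+ x y = embed₂-injective (begin
    embed₂ (tr (x ⊞ y))                ≡⟨ embed₂-tr (x ⊞ y) ⟩
    trace m (x ⊞ y)                    ≡⟨ trace-+ m x y ⟩
    trace m x ⊞ trace m y              ≡⟨ cong₂ _⊞_ (embed₂-tr x) (embed₂-tr y) ⟨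
    embed₂ (tr x) ⊞ embed₂ (tr y)      ≡⟨ embed₂-xor (tr x) (tr y) ⟨
    embed₂ (tr x xor tr y)             ∎)

  tr-square : ∀ x → tr (x ⊠ x) ≡ tr x
  tr-square x = cong (λ t → does (t ≟ 1#)) (trace-invariant x)

  tr-0 : tr 0# ≡ false
  tr-0 = embed₂-injective (trans (embed₂-tr 0#) (+-cancelʳ _ _ _ (begin
    trace m 0# ⊞ trace m 0#    ≡⟨ trace-+ m 0# 0# ⟨
    trace m (0# ⊞ 0#)          ≡⟨ cong (trace m) (+-identityˡ 0#) ⟩
    trace m 0#                 ≡⟨ +-identityˡ _ ⟨
    0# ⊞ trace m 0#            ∎)))

  -- Polynomials over the field and the number of their roots.

  eval : List 𝔽 → 𝔽 → 𝔽
  eval []      x = 0#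
  eval (c ∷ p) x = c ⊞ x ⊠ eval p x

  -- Synthetic division of X p(X) rather than of p: this is the quotient of X p(X) + r p(r) by X +
  -- r, which has as many coefficients as p.
  quotient : List 𝔽 → 𝔽 → List 𝔽
  quotient []      r = []
  quotient (c ∷ p) r = eval (c ∷ p) r ∷ quotient p r

  length-quotient : ∀ p r → List.length (quotient p r) ≡ List.length p
  length-quotient []      r = refl
  length-quotient (c ∷ p) r = cong suc (length-quotient p r)

  quotient-correct : ∀ p r x → x ⊠ eval p x ⊞ r ⊠ eval p r ≡ (x ⊞ r) ⊠ eval (quotient p r) x
  quotient-correct []      r x = Char2.solve 2
    (λ x r → x :* con false :+ r :* con false := (x :+ r) :* con false) refl x r
    where
    open Char2
  quotient-correct (c ∷ p) r x = begin
    x ⊠ (c ⊞ x ⊠ E) ⊞ r ⊠ (c ⊞ r ⊠ E′)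
      ≡⟨ Char2.solve 5 (λ x r c E E′ → x :* (c :+ x :* E) :+ r :* (c :+ r :* E′)
           := (x :+ r) :* (c :+ r :* E′) :+ x :* (x :* E :+ r :* E′)) refl x r c E E′ ⟩
    (x ⊞ r) ⊠ (c ⊞ r ⊠ E′) ⊞ x ⊠ (x ⊠ E ⊞ r ⊠ E′)
      ≡⟨ cong (λ t → (x ⊞ r) ⊠ (c ⊞ r ⊠ E′) ⊞ x ⊠ t) (quotient-correct p r x) ⟩
    (x ⊞ r) ⊠ (c ⊞ r ⊠ E′) ⊞ x ⊠ ((x ⊞ r) ⊠ Q)
      ≡⟨ Char2.solve 4 (λ x r d Q → (x :+ r) :* d :+ x :* ((x :+ r) :* Q)
           := (x :+ r) :* (d :+ x :* Q)) refl x r (c ⊞ r ⊠ E′) Q ⟩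
    (x ⊞ r) ⊠ (c ⊞ r ⊠ E′ ⊞ x ⊠ Q)  ∎
    where
    open Char2
    E  = eval p x
    E′ = eval p r
    Q  = eval (quotient p r) x

  Zero : List 𝔽 → Set
  Zero = All (_≡ 0#)

  eval-zero : ∀ {p} → Zero p → ∀ x → eval p x ≡ 0#
  eval-zero []           x = refl
  eval-zero (refl ∷ p≡0) x = trans (+-identityˡ _) (trans (cong (x ⊠_) (eval-zero p≡0 x)) (zeroʳ x))

  constant-zero : ∀ {c p r} → eval (c ∷ p) r ≡ 0# → Zero p → c ≡ 0#
  constant-zero {c} {p} {r} root p≡0 = begin
    c                  ≡⟨ +-identityʳ c ⟨
    c ⊞ 0#             ≡⟨ cong (c ⊞_) (trans (cong (r ⊠_) (eval-zero p≡0 r)) (zeroʳ r)) ⟨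
    eval (c ∷ p) r     ≡⟨ root ⟩
    0#                 ∎

  quotient-zero : ∀ p {r} → Zero (quotient p r) → Zero p
  quotient-zero []          []          = []
  quotient-zero (c ∷ p) (c≡0 ∷ q≡0) = constant-zero c≡0 p≡0 ∷ p≡0
    where p≡0 = quotient-zero p q≡0

  roots : (𝔽 → 𝔽) → ℤ
  roots f = sum (λ x → [ does (f x ≟ 0#) ])

  -- If r is a root, the polynomial c + X p(X) equals (X + r) Q(X) with Q the `quotient` of p, so
  -- every root is r or a root of Q. Q is nonzero and one coefficient shorter than the polynomial,
  -- which allows induction on the length.
  roots-bound : ∀ c p → ¬ Zero (c ∷ p) → roots (eval (c ∷ p)) ℤ.≤ + List.length p
  roots-bound c p = bound (List.length p) c p refl
    where
    bound : ∀ n c p → List.length p ≡ n → ¬ Zero (c ∷ p) → roots (eval (c ∷ p)) ℤ.≤ + n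
    bound n c p len nz with Fin.any? (λ r → eval (c ∷ p) r ≟ 0#)
    ... | no ∄root = ℤ.≤-trans (ℤ.≤-reflexive (trans
            (sum-cong-≗ λ x → []-false (eval (c ∷ p) x ≟ 0#) (λ eq → ∄root (x , eq)))
            (sum-replicate-zero q))) (ℤ.+≤+ ℕ.z≤n)
    bound n c [] len nz | yes (r , root) = contradiction (constant-zero root [] ∷ []) nz
    bound (suc n) c (d ∷ p) len nz | yes (r , root) = ℤ.≤-trans (sum-mono split)
      (ℤ.≤-trans (ℤ.≤-reflexive (trans (∑-distrib-+ {q} _ _) (cong (λ t → t ℤ.+ roots (eval Q)) (sum-δ₁ r))))
        (ℤ.+-monoʳ-≤ 1ℤ (bound n _ _ (trans (length-quotient p r) (ℕ.suc-injective len)) Q≢0)))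
      where
      Q = quotient (d ∷ p) r

      Q≢0 : ¬ Zero Q
      Q≢0 Q≡0 = nz (constant-zero root dp≡0 ∷ dp≡0)
        where dp≡0 = quotient-zero (d ∷ p) Q≡0

      factor : ∀ x → eval (c ∷ d ∷ p) x ≡ (x ⊞ r) ⊠ eval Q x
      factor x = begin
        eval (c ∷ d ∷ p) x                              ≡⟨ +-identityʳ _ ⟨
        eval (c ∷ d ∷ p) x ⊞ 0#                         ≡⟨ cong (eval (c ∷ d ∷ p) x ⊞_) root ⟨
        eval (c ∷ d ∷ p) x ⊞ eval (c ∷ d ∷ p) r
          ≡⟨ Char2.solve 3 (λ c s t → (c :+ s) :+ (c :+ t) := s :+ t) refl c _ _ ⟩
        x ⊠ eval (d ∷ p) x ⊞ r ⊠ eval (d ∷ p) r         ≡⟨ quotient-correct (d ∷ p) r x ⟩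
        (x ⊞ r) ⊠ eval Q x                              ∎
        where
        open Char2

      split : ∀ x → [ does (eval (c ∷ d ∷ p) x ≟ 0#) ] ℤ.≤ [ does (x ≟ r) ] ℤ.+ [ does (eval Q x ≟ 0#) ]
      split x = []-≤-⊎ (eval (c ∷ d ∷ p) x ≟ 0#) (x ≟ r) (eval Q x ≟ 0#) λ x-root →
        [ inj₁ ∘ x+y≡0⇒x≡y , inj₂ ]′ (zero-product _ _ (trans (sym (factor x)) x-root))

  eval-shift : ∀ n p x → eval (replicate n 0# ++ p) x ≡ x ^ n ⊠ eval p x
  eval-shift zero    p x = sym (*-identityˡ _)
  eval-shift (suc n) p x = begin
    0# ⊞ x ⊠ eval (replicate n 0# ++ p) x    ≡⟨ +-identityˡ _ ⟩
    x ⊠ eval (replicate n 0# ++ p) x         ≡⟨ cong (x ⊠_) (eval-shift n p x) ⟩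
    x ⊠ (x ^ n ⊠ eval p x)                   ≡⟨ *-assoc x _ _ ⟨
    x ^ suc n ⊠ eval p x                     ∎

  -- The coefficients of Σ_{j<k} X^(2^(i+j) - 2^i).
  traceTail : ℕ → ℕ → List 𝔽
  traceTail i zero    = []
  traceTail i (suc k) = 1# ∷ replicate (ℕ.pred (2 ℕ.^ i)) 0# ++ traceTail (suc i) k

  suc-pred-2^ : ∀ i → suc (ℕ.pred (2 ℕ.^ i)) ≡ 2 ℕ.^ i
  suc-pred-2^ i = ℕ.suc-pred (2 ℕ.^ i) {{ℕ.m^n≢0 2 i}}

  length-traceTail : ∀ i k → List.length (traceTail i k) ℕ.+ 2 ℕ.^ i ≡ 2 ℕ.^ (i ℕ.+ k)
  length-traceTail i zero    = cong (2 ℕ.^_) (sym (ℕ.+-identityʳ i))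
  length-traceTail i (suc k) = begin
    suc (List.length (replicate N 0# ++ T)) ℕ.+ 2 ℕ.^ i
      ≡⟨ cong (λ l → suc l ℕ.+ 2 ℕ.^ i) (trans (List.length-++ (replicate N 0#)) (cong (ℕ._+ List.length T) (List.length-replicate N))) ⟩
    suc N ℕ.+ List.length T ℕ.+ 2 ℕ.^ i                 ≡⟨ cong (λ l → l ℕ.+ List.length T ℕ.+ 2 ℕ.^ i) (suc-pred-2^ i) ⟩
    2 ℕ.^ i ℕ.+ List.length T ℕ.+ 2 ℕ.^ i               ≡⟨ cong (ℕ._+ 2 ℕ.^ i) (ℕ.+-comm (2 ℕ.^ i) _) ⟩
    List.length T ℕ.+ 2 ℕ.^ i ℕ.+ 2 ℕ.^ i               ≡⟨ ℕ.+-assoc (List.length T) _ _ ⟩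
    List.length T ℕ.+ (2 ℕ.^ i ℕ.+ 2 ℕ.^ i)             ≡⟨ cong (λ l → List.length T ℕ.+ (2 ℕ.^ i ℕ.+ l)) (ℕ.+-identityʳ _) ⟨
    List.length T ℕ.+ 2 ℕ.^ suc i                       ≡⟨ length-traceTail (suc i) k ⟩
    2 ℕ.^ (suc i ℕ.+ k)                                 ≡⟨ cong (2 ℕ.^_) (ℕ.+-suc i k) ⟨
    2 ℕ.^ (i ℕ.+ suc k)                                 ∎
    where
    N = ℕ.pred (2 ℕ.^ i)
    T = traceTail (suc i) k

  frob-suc : ∀ k x → frob (suc k) x ≡ frob k x ⊠ frob k x
  frob-suc k x = frob-* k x x

  eval-traceTail : ∀ i k x → frob i x ⊠ eval (traceTail i k) x ≡ trace k (frob i x)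
  eval-traceTail i zero    x = zeroʳ _
  eval-traceTail i (suc k) x = begin
    frob i x ⊠ (1# ⊞ x ⊠ eval (replicate N 0# ++ T) x)     ≡⟨ cong (λ t → frob i x ⊠ (1# ⊞ x ⊠ t)) (eval-shift N T x) ⟩
    frob i x ⊠ (1# ⊞ x ⊠ (x ^ N ⊠ eval T x))               ≡⟨ cong (λ t → frob i x ⊠ (1# ⊞ t)) (*-assoc x _ _) ⟨
    frob i x ⊠ (1# ⊞ x ^ suc N ⊠ eval T x)
      ≡⟨ cong (λ t → frob i x ⊠ (1# ⊞ t ⊠ eval T x)) (trans (cong (x ^_) (suc-pred-2^ i)) (^-frob i x)) ⟩
    frob i x ⊠ (1# ⊞ frob i x ⊠ eval T x)
      ≡⟨ Char2.solve 2 (λ u E → u :* (con true :+ u :* E) := u :+ (u :* u) :* E) refl (frob i x) (eval T x) ⟩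
    frob i x ⊞ frob i x ⊠ frob i x ⊠ eval T x              ≡⟨ cong (λ t → frob i x ⊞ t ⊠ eval T x) (frob-suc i x) ⟨
    frob i x ⊞ frob (suc i) x ⊠ eval T x                   ≡⟨ cong (frob i x ⊞_) (eval-traceTail (suc i) k x) ⟩
    frob i x ⊞ trace k (frob (suc i) x)                    ≡⟨ cong (λ t → frob i x ⊞ trace k t) (frob-suc i x) ⟩
    trace (suc k) (frob i x)                               ∎
    where
    open Char2
    N = ℕ.pred (2 ℕ.^ i)
    T = traceTail (suc i) k

  m-positive : ∃[ m′ ] m ≡ suc m′
  m-positive = positive m refl
    where
    positive : ∀ n → m ≡ n → ∃[ m′ ] m ≡ suc m′
    positive zero    m≡0 = contradiction (begin
      1#                         ≡⟨ +-identityʳ 1# ⟨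
      1 ×ᶠ 1#                    ≡⟨ cong (_×ᶠ 1#) (trans q≡2^m (cong (2 ℕ.^_) m≡0)) ⟨
      q ×ᶠ 1#                    ≡⟨ q×1≡0 ⟩
      0#                         ∎) 1≢0
    positive (suc n) m≡sn = n , m≡sn

  -- The trace polynomial has degree below q, so it cannot vanish identically.
  tr-surjective : ∃[ t ] tr t ≡ true
  tr-surjective with Fin.any? (λ t → tr t Bool.≟ true)
  ... | yes t = t
  ... | no ∄t = contradiction q≤q-1 (ℤ.<⇒≱ (ℤ.+<+ (ℕ.≤-reflexive (trans (ℕ.+-comm 1 _) (trans (length-traceTail 0 m) (sym q≡2^m))))))
    where
    trace≡0 : ∀ x → trace m x ≡ 0#
    trace≡0 x = trans (sym (embed₂-tr x)) (cong embed₂ (Bool.¬-not (λ eq → ∄t (x , eq))))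

    vanish : ∀ x → eval (0# ∷ traceTail 0 m) x ≡ 0#
    vanish x = trans (+-identityˡ _) (trans (eval-traceTail 0 m x) (trace≡0 x))

    nonzero : ¬ Zero (0# ∷ traceTail 0 m)
    nonzero z with m′ , refl ← m-positive with _ ∷ 1≡0 ∷ _ ← z = 1≢0 1≡0

    q≤q-1 : + q ℤ.≤ + List.length (traceTail 0 m)
    q≤q-1 = ℤ.≤-trans (ℤ.≤-reflexive (sym (trans
      (sum-cong-≗ λ x → []-true (eval (0# ∷ traceTail 0 m) x ≟ 0#) (vanish x))
      (trans (sum-const q 1ℤ) (ℤ.*-identityʳ (+ q)))))) (roots-bound 0# (traceTail 0 m) nonzero)

  -- The additive character of the trace and its orthogonality relations.

  σ : Bool → ℤ
  σ b = if b then -1ℤ else 1ℤ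

  σ-xor : ∀ b b′ → σ (b xor b′) ≡ σ b ℤ.* σ b′
  σ-xor true  true  = refl
  σ-xor true  false = refl
  σ-xor false b′    = sym (ℤ.*-identityˡ (σ b′))

  χ : 𝔽 → ℤ
  χ x = σ (tr x)

  χ-+ : ∀ x y → χ (x ⊞ y) ≡ χ x ℤ.* χ y
  χ-+ x y = trans (cong σ (tr-+ x y)) (σ-xor (tr x) (tr y))

  χ-0 : χ 0# ≡ 1ℤ
  χ-0 = cong σ tr-0

  χ-square : ∀ x → χ (x ⊠ x) ≡ χ x
  χ-square x = cong σ (tr-square x)

  sum-translate : ∀ (g : 𝔽 → ℤ) y → sum (λ x → g (y ⊞ x)) ≡ sum g
  sum-translate g y = sum-reindex g (y ⊞_) (y ⊞_) involutive involutive
    where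
    involutive : ∀ x → y ⊞ (y ⊞ x) ≡ x
    involutive x = Char2.solve 2 (λ x y → y :+ (y :+ x) := x) refl x y
      where
      open Char2

  -- Translation by `y` preserves the sum and also negates it, so twice the sum is 0.
  sum-vanishes : ∀ (g : 𝔽 → ℤ) y → (∀ x → g (y ⊞ x) ≡ -1ℤ ℤ.* g x) → sum g ≡ 0ℤ
  sum-vanishes g y flips = ℤ.*-cancelˡ-≡ (+ 2) _ _ (begin
    + 2 ℤ.* sum g                        ≡⟨ ℤ.suc-* 1ℤ (sum g) ⟩
    sum g ℤ.+ 1ℤ ℤ.* sum g               ≡⟨ cong (λ t → sum g ℤ.+ t) (ℤ.*-identityˡ (sum g)) ⟩
    sum g ℤ.+ sum g                      ≡⟨ cong (λ t → sum g ℤ.+ t) sum≡-sum ⟩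
    sum g ℤ.+ -1ℤ ℤ.* sum g              ≡⟨ cong (λ t → sum g ℤ.+ t) (ℤ.-1*i≡-i (sum g)) ⟩
    sum g ℤ.+ ℤ.- sum g                  ≡⟨ ℤ.+-inverseʳ (sum g) ⟩
    + 2 ℤ.* 0ℤ                           ∎)
    where
    sum≡-sum : sum g ≡ -1ℤ ℤ.* sum g
    sum≡-sum = begin
      sum g                          ≡⟨ sum-translate g y ⟨
      sum (λ x → g (y ⊞ x))          ≡⟨ sum-cong-≗ flips ⟩
      sum (λ x → -1ℤ ℤ.* g x)        ≡⟨ *-distribˡ-sum -1ℤ g ⟨
      -1ℤ ℤ.* sum g                  ∎

  -- The root is w^(2^(m-1)), whose square is w^q = w.
  sqrt : ∀ w → ∃[ x ] x ⊠ x ≡ w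
  sqrt w with m′ , m≡sm′ ← m-positive = frob m′ w , (begin
    frob m′ w ⊠ frob m′ w    ≡⟨ frob-suc m′ w ⟨
    frob (suc m′) w          ≡⟨ cong (λ n → frob n w) m≡sm′ ⟨
    frob m w                 ≡⟨ x^q≡x w ⟩
    w                        ∎)

  fourth : 𝔽 → 𝔽
  fourth x = x ⊠ x ⊠ (x ⊠ x)

  fourth-+ : ∀ x y → fourth (x ⊞ y) ≡ fourth x ⊞ fourth y
  fourth-+ = Char2.solve 2 (λ x y → (x :+ y) :* (x :+ y) :* ((x :+ y) :* (x :+ y))
    := x :* x :* (x :* x) :+ y :* y :* (y :* y)) refl
    where
    open Char2

  module _ (π : 𝔽 → 𝔽) (π-+ : ∀ x y → π (x ⊞ y) ≡ π x ⊞ π y) (π-surjective : ∀ w → ∃[ x ] π x ≡ w) where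

    -- For z ≠ 0 take t of trace 1 and y with π y = t z⁻¹: translation by y negates every summand.
    -- The map `π` is the identity when moments are computed and the fourth power when S is squared,
    -- because the polar form comes out with the factor x⁴.
    orthogonality : ∀ z → sum (λ x → χ (π x ⊠ z)) ≡ + q ℤ.* [ does (z ≟ 0#) ]
    orthogonality z with z ≟ 0#
    ... | yes refl = trans (sum-cong-≗ λ x → trans (cong χ (zeroʳ (π x))) χ-0) (sum-const q 1ℤ)
    ... | no z≢0 with z⁻¹ , zz⁻¹≡1 ← inverse z z≢0 | t , tr-t ← tr-surjective
                 with y , πy≡ ← π-surjective (t ⊠ z⁻¹) =
          trans (sum-vanishes (λ x → χ (π x ⊠ z)) y flips) (sym (ℤ.*-zeroʳ (+ q)))
      where
      πyz≡t : π y ⊠ z ≡ t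
      πyz≡t = begin
        π y ⊠ z           ≡⟨ cong (_⊠ z) πy≡ ⟩
        t ⊠ z⁻¹ ⊠ z       ≡⟨ *-assoc t z⁻¹ z ⟩
        t ⊠ (z⁻¹ ⊠ z)     ≡⟨ cong (t ⊠_) (trans (*-comm z⁻¹ z) zz⁻¹≡1) ⟩
        t ⊠ 1#            ≡⟨ *-identityʳ t ⟩
        t                 ∎

      flips : ∀ x → χ (π (y ⊞ x) ⊠ z) ≡ -1ℤ ℤ.* χ (π x ⊠ z)
      flips x = begin
        χ (π (y ⊞ x) ⊠ z)                 ≡⟨ cong χ (trans (cong (_⊠ z) (π-+ y x)) (distribʳ z _ _)) ⟩
        χ (π y ⊠ z ⊞ π x ⊠ z)             ≡⟨ χ-+ _ _ ⟩
        χ (π y ⊠ z) ℤ.* χ (π x ⊠ z)       ≡⟨ cong (λ t → χ t ℤ.* χ (π x ⊠ z)) πyz≡t ⟩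
        χ t ℤ.* χ (π x ⊠ z)               ≡⟨ cong (λ b → σ b ℤ.* χ (π x ⊠ z)) tr-t ⟩
        -1ℤ ℤ.* χ (π x ⊠ z)               ∎

  orthogonality₁ : ∀ z → sum (λ x → χ (x ⊠ z)) ≡ + q ℤ.* [ does (z ≟ 0#) ]
  orthogonality₁ = orthogonality id (λ _ _ → refl) (λ w → w , refl)

  orthogonality₄ : ∀ z → sum (λ x → χ (fourth x ⊠ z)) ≡ + q ℤ.* [ does (z ≟ 0#) ]
  orthogonality₄ = orthogonality fourth fourth-+ λ w → case sqrt w of λ where
    (y , y²≡w) → case sqrt y of λ where
      (x , x²≡y) → x , trans (cong₂ _⊠_ x²≡y x²≡y) y²≡w

  -- The exponential sum S(a,b,c), its square and the kernel of L.

  module _ (a b c : 𝔽) where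

    form : 𝔽 → 𝔽
    form x = a ⊠ x ^ 5 ⊞ b ⊠ x ^ 3 ⊞ c ⊠ x

    S : ℤ
    S = sum (λ x → χ (form x))

    -- The polar form of Tr ∘ form is (x , y) ↦ Tr (x⁴ L(y)), so its radical is the kernel of L.
    L : 𝔽 → 𝔽
    L y = a ⊠ y ⊞ b ⊠ b ⊠ (y ⊠ y) ⊞ fourth b ⊠ (fourth y ⊠ fourth y) ⊞ fourth a ⊠ fourth (fourth y)

    -- Besides `form y`, four mixed terms remain: a y x⁴, b y x², b x y² and a x y⁴. The trace does
    -- not change under squaring, so the second may be squared and the last two raised to the fourth
    -- power. All then contain x⁴, and the cofactor is L(y); this is the origin of its degree 16.
    χ-polar : ∀ x y → χ (form x ⊞ form (x ⊞ y)) ≡ χ (form y) ℤ.* χ (fourth x ⊠ L y)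
    χ-polar x y = begin
      χ (form x ⊞ form (x ⊞ y))
        ≡⟨ cong χ (Char2.solve 5 (λ a b c x y →
             (a :* x :^ 5 :+ b :* x :^ 3 :+ c :* x) :+ (a :* (x :+ y) :^ 5 :+ b :* (x :+ y) :^ 3 :+ c :* (x :+ y))
             := (a :* y :^ 5 :+ b :* y :^ 3 :+ c :* y) :+ ((a :* y :* (x :* x :* (x :* x)) :+ b :* y :* (x :* x))
               :+ (b :* x :* (y :* y) :+ a :* x :* (y :* y :* (y :* y))))) refl a b c x y) ⟩
      χ (form y ⊞ ((t₁ ⊞ t₂) ⊞ (t₃ ⊞ t₄)))
        ≡⟨ trans (χ-+ _ _) (cong (λ t → χ (form y) ℤ.* t) (trans (χ-+ _ _) (cong₂ ℤ._*_ (χ-+ t₁ t₂) (χ-+ t₃ t₄)))) ⟩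
      χ (form y) ℤ.* ((χ t₁ ℤ.* χ t₂) ℤ.* (χ t₃ ℤ.* χ t₄))
        ≡⟨ cong (λ t → χ (form y) ℤ.* t) (cong₂ ℤ._*_
             (cong (λ t → χ t₁ ℤ.* t) (sym (χ-square t₂)))
             (cong₂ ℤ._*_ (χ-fourth t₃) (χ-fourth t₄))) ⟩
      χ (form y) ℤ.* ((χ t₁ ℤ.* χ (t₂ ⊠ t₂)) ℤ.* (χ (fourth t₃) ℤ.* χ (fourth t₄)))
        ≡⟨ cong (λ t → χ (form y) ℤ.* t) (trans (χ-+ _ _) (cong₂ ℤ._*_ (χ-+ t₁ _) (χ-+ (fourth t₃) _))) ⟨
      χ (form y) ℤ.* χ (t₁ ⊞ t₂ ⊠ t₂ ⊞ (fourth t₃ ⊞ fourth t₄))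
        ≡⟨ cong (λ t → χ (form y) ℤ.* χ t) (Char2.solve 4 (λ a b x y → let f = λ u → u :* u :* (u :* u) in
             a :* y :* f x :+ (b :* y :* (x :* x)) :* (b :* y :* (x :* x)) :+ (f (b :* x :* (y :* y)) :+ f (a :* x :* f y))
             := f x :* (a :* y :+ b :* b :* (y :* y) :+ f b :* (f y :* f y) :+ f a :* f (f y))) refl a b x y) ⟩
      χ (form y) ℤ.* χ (fourth x ⊠ L y)  ∎
      where
      open Char2
      t₁ = a ⊠ y ⊠ fourth x
      t₂ = b ⊠ y ⊠ (x ⊠ x)
      t₃ = b ⊠ x ⊠ (y ⊠ y)
      t₄ = a ⊠ x ⊠ fourth y

      χ-fourth : ∀ t → χ t ≡ χ (fourth t)
      χ-fourth t = sym (trans (χ-square (t ⊠ t)) (χ-square t))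

    kernelSum : ℤ
    kernelSum = sum (λ y → χ (form y) ℤ.* [ does (L y ≟ 0#) ])

    S²≡q*kernelSum : S ℤ.* S ≡ + q ℤ.* kernelSum
    S²≡q*kernelSum = begin
      S ℤ.* S                                                          ≡⟨ *-distribʳ-sum S (χ ∘ form) ⟩
      sum (λ x → χ (form x) ℤ.* S)                                     ≡⟨ sum-cong-≗ (λ x → trans
        (cong (λ t → χ (form x) ℤ.* t) (sym (sum-translate (χ ∘ form) x))) (*-distribˡ-sum {q} (χ (form x)) _)) ⟩
      sum (λ x → sum (λ y → χ (form x) ℤ.* χ (form (x ⊞ y))))          ≡⟨ sum-cong-≗ (λ x → sum-cong-≗ λ y →
        trans (sym (χ-+ (form x) _)) (χ-polar x y)) ⟩
      sum (λ x → sum (λ y → χ (form y) ℤ.* χ (fourth x ⊠ L y)))        ≡⟨ ∑-comm {q} {q} _ ⟩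
      sum (λ y → sum (λ x → χ (form y) ℤ.* χ (fourth x ⊠ L y)))        ≡⟨ sum-cong-≗ (λ y → trans
        (sym (*-distribˡ-sum {q} (χ (form y)) _)) (cong (λ t → χ (form y) ℤ.* t) (orthogonality₄ (L y)))) ⟩
      sum (λ y → χ (form y) ℤ.* (+ q ℤ.* [ does (L y ≟ 0#) ]))         ≡⟨ sum-cong-≗ (λ y → exchange (χ (form y)) (+ q) _) ⟩
      sum (λ y → + q ℤ.* (χ (form y) ℤ.* [ does (L y ≟ 0#) ]))         ≡⟨ *-distribˡ-sum {q} (+ q) _ ⟨
      + q ℤ.* kernelSum                                                ∎
      where
      exchange : ∀ i j k → i ℤ.* (j ℤ.* k) ≡ j ℤ.* (i ℤ.* k)
      exchange i j k = trans (sym (ℤ.*-assoc i j k)) (trans (cong (λ t → t ℤ.* k) (ℤ.*-comm i j)) (ℤ.*-assoc j i k))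

    L-+ : ∀ x y → L (x ⊞ y) ≡ L x ⊞ L y
    L-+ x y = Char2.solve 6 (λ p₁ p₂ p₃ p₄ x y → let f = λ u → u :* u :* (u :* u) in let g = λ y → p₁ :* y :+ p₂ :* (y :* y) :+ p₃ :* (f y :* f y) :+ p₄ :* f (f y) in
       g (x :+ y) := g x :+ g y) refl a (b ⊠ b) (fourth b) (fourth a) x y
      where
      open Char2

    kernelSize : ℤ
    kernelSize = roots L

    -- By `χ-polar`, translation by a kernel element y multiplies `χ (form x)` by `χ (form y)`. A
    -- kernel element of sign -1 therefore cancels the sum, and without one every summand on the
    -- kernel is 1.
    kernelSum-values : kernelSum ≡ 0ℤ ⊎ kernelSum ≡ kernelSize
    kernelSum-values with Fin.any? (λ y → (L y ≟ 0#) ×-dec (tr (form y) Bool.≟ true))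
    ... | yes (y , Ly≡0 , tr≡1) = inj₁ (sum-vanishes _ y λ x → begin
      χ (form (y ⊞ x)) ℤ.* [ does (L (y ⊞ x) ≟ 0#) ]
        ≡⟨ cong₂ (λ s t → s ℤ.* [ does (t ≟ 0#) ]) (χ-form x)
             (trans (L-+ y x) (trans (cong (_⊞ L x) Ly≡0) (+-identityˡ _))) ⟩
      -1ℤ ℤ.* χ (form x) ℤ.* [ does (L x ≟ 0#) ]    ≡⟨ ℤ.*-assoc -1ℤ (χ (form x)) _ ⟩
      -1ℤ ℤ.* (χ (form x) ℤ.* [ does (L x ≟ 0#) ])  ∎)
      where
      χ-form : ∀ x → χ (form (y ⊞ x)) ≡ -1ℤ ℤ.* χ (form x)
      χ-form x = begin
        χ (form (y ⊞ x))
          ≡⟨ cong χ (trans (cong form (+-comm y x)) (Char2.solve 2 (λ u v → v := u :+ (u :+ v)) refl (form x) _)) ⟩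
        χ (form x ⊞ (form x ⊞ form (x ⊞ y)))                  ≡⟨ χ-+ _ _ ⟩
        χ (form x) ℤ.* χ (form x ⊞ form (x ⊞ y))              ≡⟨ cong (λ t → χ (form x) ℤ.* t) (χ-polar x y) ⟩
        χ (form x) ℤ.* (χ (form y) ℤ.* χ (fourth x ⊠ L y))
          ≡⟨ cong (λ t → χ (form x) ℤ.* t) (cong₂ ℤ._*_ (cong σ tr≡1) (trans (cong χ (trans (cong (fourth x ⊠_) Ly≡0) (zeroʳ _))) χ-0)) ⟩
        χ (form x) ℤ.* -1ℤ                                    ≡⟨ ℤ.*-comm (χ (form x)) -1ℤ ⟩
        -1ℤ ℤ.* χ (form x)                                    ∎
        where
        open Char2
    ... | no ∄y = inj₂ (sum-cong-≗ λ y → trivial y)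
      where
      trivial : ∀ y → χ (form y) ℤ.* [ does (L y ≟ 0#) ] ≡ [ does (L y ≟ 0#) ]
      trivial y with L y ≟ 0#
      ... | no _     = ℤ.*-zeroʳ (χ (form y))
      ... | yes Ly≡0 = trans (ℤ.*-identityʳ (χ (form y)))
        (cong σ (Bool.¬-not (λ eq → ∄y (y , Ly≡0 , eq))))

    kernelSize≤16 : ¬ (a ≡ 0# × b ≡ 0#) → kernelSize ℤ.≤ + 16
    kernelSize≤16 ab≢0 = ℤ.≤-trans
      (ℤ.≤-reflexive (sum-cong-≗ λ y → cong (λ t → [ does (t ≟ 0#) ]) (sym (eval-L y))))
      (roots-bound 0# tail nonzero)
      where
      tail : List 𝔽
      -- The coefficients of L in degrees 1 to 16; the nonconstant terms of L sit in degrees 1, 2, 8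
      -- and 16.
      tail = a ∷ b ⊠ b ∷ 0# ∷ 0# ∷ 0# ∷ 0# ∷ 0# ∷ fourth b ∷ 0# ∷ 0# ∷ 0# ∷ 0# ∷ 0# ∷ 0# ∷ 0# ∷ fourth a ∷ []

      eval-L : ∀ y → eval (0# ∷ tail) y ≡ L y
      eval-L y = Char2.solve 5 (λ p₁ p₂ p₃ p₄ y → let f = λ u → u :* u :* (u :* u); o = con false; h = λ c t → c :+ y :* t in
        h o (h p₁ (h p₂ (h o (h o (h o (h o (h o (h p₃ (h o (h o (h o (h o (h o (h o (h o (h p₄ o))))))))))))))))
        := p₁ :* y :+ p₂ :* (y :* y) :+ p₃ :* (f y :* f y) :+ p₄ :* f (f y)) refl a (b ⊠ b) (fourth b) (fourth a) y
        where
        open Char2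

      nonzero : ¬ Zero (0# ∷ tail)
      nonzero (_ ∷ a≡0 ∷ b²≡0 ∷ _) = ab≢0 (a≡0 , [ id , id ]′ (zero-product b b b²≡0))

  -- Power moments of S as numbers of solutions of power-sum equations.

  ∑³ : (𝔽 → 𝔽 → 𝔽 → ℤ) → ℤ
  ∑³ f = sum λ a → sum λ b → sum λ c → f a b c

  ∑³-cong : ∀ {f g} → (∀ a b c → f a b c ≡ g a b c) → ∑³ f ≡ ∑³ g
  ∑³-cong eq = sum-cong-≗ λ a → sum-cong-≗ λ b → sum-cong-≗ λ c → eq a b c

  ∑³-swap : ∀ {n} (f : Fin n → 𝔽 → 𝔽 → 𝔽 → ℤ) → ∑³ (λ a b c → sum λ x → f x a b c) ≡ sum (λ x → ∑³ (f x))
  ∑³-swap {n} f = begin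
    ∑³ (λ a b c → sum λ x → f x a b c)
      ≡⟨ sum-cong-≗ {q} (λ a → sum-cong-≗ {q} λ b → ∑-comm {q} {n} λ c x → f x a b c) ⟩
    sum (λ a → sum λ b → sum λ x → sum λ c → f x a b c)    ≡⟨ sum-cong-≗ {q} (λ a → ∑-comm {q} {n} _) ⟩
    sum (λ a → sum λ x → sum λ b → sum λ c → f x a b c)    ≡⟨ ∑-comm {q} {n} _ ⟩
    sum (λ x → ∑³ (f x))                                   ∎

  ∑³-*ˡ : ∀ k f → ∑³ (λ a b c → k ℤ.* f a b c) ≡ k ℤ.* ∑³ f
  ∑³-*ˡ k f = sym (begin
    k ℤ.* ∑³ f                                             ≡⟨ *-distribˡ-sum {q} k _ ⟩
    sum (λ a → k ℤ.* sum λ b → sum λ c → f a b c)          ≡⟨ sum-cong-≗ {q} (λ a → *-distribˡ-sum {q} k _) ⟩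
    sum (λ a → sum λ b → k ℤ.* sum λ c → f a b c)
      ≡⟨ sum-cong-≗ {q} (λ a → sum-cong-≗ {q} λ b → *-distribˡ-sum {q} k _) ⟩
    ∑³ (λ a b c → k ℤ.* f a b c)                           ∎)

  ∑³-product : ∀ (f g h : 𝔽 → ℤ) → ∑³ (λ a b c → f a ℤ.* g b ℤ.* h c) ≡ sum f ℤ.* sum g ℤ.* sum h
  ∑³-product f g h = begin
    ∑³ (λ a b c → f a ℤ.* g b ℤ.* h c)
      ≡⟨ sum-cong-≗ (λ a → sum-cong-≗ λ b → sym (*-distribˡ-sum {q} (f a ℤ.* g b) h)) ⟩
    sum (λ a → sum λ b → f a ℤ.* g b ℤ.* sum h)
      ≡⟨ sum-cong-≗ (λ a → trans (sym (*-distribʳ-sum {q} (sum h) _)) (cong (λ t → t ℤ.* sum h) (sym (*-distribˡ-sum {q} (f a) g)))) ⟩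
    sum (λ a → f a ℤ.* sum g ℤ.* sum h)
      ≡⟨ trans (sym (*-distribʳ-sum {q} (sum h) _)) (cong (λ t → t ℤ.* sum h) (sym (*-distribʳ-sum {q} (sum g) f))) ⟩
    sum f ℤ.* sum g ℤ.* sum h  ∎

  δ : 𝔽 → 𝔽 → 𝔽 → ℤ
  δ A B C = [ does (A ≟ 0#) ] ℤ.* [ does (B ≟ 0#) ] ℤ.* [ does (C ≟ 0#) ]

  -- The number of k-tuples with Σ xᵢ⁵ = A, Σ xᵢ³ = B and Σ xᵢ = C. In characteristic 2 moving a
  -- term to the other side needs no sign.
  representations : ℕ → 𝔽 → 𝔽 → 𝔽 → ℤ
  representations zero    A B C = δ A B C
  representations (suc k) A B C = sum λ x → representations k (x ^ 5 ⊞ A) (x ^ 3 ⊞ B) (x ⊞ C)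

  twistedMoment : ℕ → 𝔽 → 𝔽 → 𝔽 → ℤ
  twistedMoment k A B C = ∑³ λ a b c → S a b c ℤ.^ k ℤ.* χ (a ⊠ A ⊞ b ⊠ B ⊞ c ⊠ C)

  q³ : ℤ
  q³ = + q ℤ.* + q ℤ.* + q

  -- Writing out one factor S as a sum over x shifts the twist by (x⁵, x³, x), exactly as the
  -- recursion of `representations` does. The twist is there to make this induction possible; at k =
  -- 0 orthogonality in a, b and c remains.
  twistedMoment≡q³*representations : ∀ k A B C → twistedMoment k A B C ≡ q³ ℤ.* representations k A B C
  twistedMoment≡q³*representations zero A B C = begin
    ∑³ (λ a b c → 1ℤ ℤ.* χ (a ⊠ A ⊞ b ⊠ B ⊞ c ⊠ C))
      ≡⟨ ∑³-cong (λ a b c → trans (ℤ.*-identityˡ _) (trans (χ-+ _ _) (cong (λ t → t ℤ.* χ (c ⊠ C)) (χ-+ _ _)))) ⟩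
    ∑³ (λ a b c → χ (a ⊠ A) ℤ.* χ (b ⊠ B) ℤ.* χ (c ⊠ C))   ≡⟨ ∑³-product (λ a → χ (a ⊠ A)) (λ b → χ (b ⊠ B)) (λ c → χ (c ⊠ C)) ⟩
    sum (λ a → χ (a ⊠ A)) ℤ.* sum (λ b → χ (b ⊠ B)) ℤ.* sum (λ c → χ (c ⊠ C))
      ≡⟨ cong₂ ℤ._*_ (cong₂ ℤ._*_ (orthogonality₁ A) (orthogonality₁ B)) (orthogonality₁ C) ⟩
    + q ℤ.* [ does (A ≟ 0#) ] ℤ.* (+ q ℤ.* [ does (B ≟ 0#) ]) ℤ.* (+ q ℤ.* [ does (C ≟ 0#) ])
      ≡⟨ solve 4 (λ q a b c → q :* a :* (q :* b) :* (q :* c) := q :* q :* q :* (a :* b :* c)) refl (+ q) [ does (A ≟ 0#) ] [ does (B ≟ 0#) ] [ does (C ≟ 0#) ] ⟩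
    q³ ℤ.* δ A B C  ∎
    where
    open ℤ.+-*-Solver
  twistedMoment≡q³*representations (suc k) A B C = begin
    ∑³ (λ a b c → S a b c ℤ.* S a b c ℤ.^ k ℤ.* χ (a ⊠ A ⊞ b ⊠ B ⊞ c ⊠ C))
      ≡⟨ ∑³-cong (λ a b c → expand a b c) ⟩
    ∑³ (λ a b c → sum λ x → S a b c ℤ.^ k ℤ.* χ (a ⊠ (x ^ 5 ⊞ A) ⊞ b ⊠ (x ^ 3 ⊞ B) ⊞ c ⊠ (x ⊞ C)))   ≡⟨ ∑³-swap {q} _ ⟩
    sum (λ x → twistedMoment k (x ^ 5 ⊞ A) (x ^ 3 ⊞ B) (x ⊞ C))
      ≡⟨ sum-cong-≗ {q} (λ x → twistedMoment≡q³*representations k (x ^ 5 ⊞ A) (x ^ 3 ⊞ B) (x ⊞ C)) ⟩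
    sum (λ x → q³ ℤ.* representations k (x ^ 5 ⊞ A) (x ^ 3 ⊞ B) (x ⊞ C))                ≡⟨ *-distribˡ-sum {q} q³ _ ⟨
    q³ ℤ.* representations (suc k) A B C                                                ∎
    where
    expand : ∀ a b c → S a b c ℤ.* S a b c ℤ.^ k ℤ.* χ (a ⊠ A ⊞ b ⊠ B ⊞ c ⊠ C)
      ≡ sum (λ x → S a b c ℤ.^ k ℤ.* χ (a ⊠ (x ^ 5 ⊞ A) ⊞ b ⊠ (x ^ 3 ⊞ B) ⊞ c ⊠ (x ⊞ C)))
    expand a b c = begin
      S a b c ℤ.* S a b c ℤ.^ k ℤ.* χ V                                ≡⟨ ℤ.*-assoc (S a b c) _ _ ⟩
      S a b c ℤ.* (S a b c ℤ.^ k ℤ.* χ V)                              ≡⟨ *-distribʳ-sum {q} _ _ ⟩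
      sum (λ x → χ (form a b c x) ℤ.* (S a b c ℤ.^ k ℤ.* χ V))         ≡⟨ sum-cong-≗ (λ x → begin
        χ (form a b c x) ℤ.* (S a b c ℤ.^ k ℤ.* χ V)      ≡⟨ ℤ.*-comm (χ (form a b c x)) _ ⟩
        S a b c ℤ.^ k ℤ.* χ V ℤ.* χ (form a b c x)        ≡⟨ ℤ.*-assoc (S a b c ℤ.^ k) _ _ ⟩
        S a b c ℤ.^ k ℤ.* (χ V ℤ.* χ (form a b c x))      ≡⟨ cong (λ t → S a b c ℤ.^ k ℤ.* t) (χ-+ V (form a b c x)) ⟨
        S a b c ℤ.^ k ℤ.* χ (V ⊞ form a b c x)
          ≡⟨ cong (λ t → S a b c ℤ.^ k ℤ.* χ t) (Char2.solve 9 (λ a b c A B C x₅ x₃ x →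
               (a :* A :+ b :* B :+ c :* C) :+ (a :* x₅ :+ b :* x₃ :+ c :* x)
               := a :* (x₅ :+ A) :+ b :* (x₃ :+ B) :+ c :* (x :+ C)) refl a b c A B C (x ^ 5) (x ^ 3) x) ⟩
        S a b c ℤ.^ k ℤ.* χ (a ⊠ (x ^ 5 ⊞ A) ⊞ b ⊠ (x ^ 3 ⊞ B) ⊞ c ⊠ (x ⊞ C))  ∎) ⟩
      sum (λ x → S a b c ℤ.^ k ℤ.* χ (a ⊠ (x ^ 5 ⊞ A) ⊞ b ⊠ (x ^ 3 ⊞ B) ⊞ c ⊠ (x ⊞ C)))  ∎
      where
      open Char2
      V = a ⊠ A ⊞ b ⊠ B ⊞ c ⊠ C

  moment : ℕ → ℤ
  moment k = ∑³ λ a b c → S a b c ℤ.^ k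

  moment≡q³*representations : ∀ k → moment k ≡ q³ ℤ.* representations k 0# 0# 0#
  moment≡q³*representations k = trans
    (∑³-cong λ a b c → sym (trans (cong (λ t → S a b c ℤ.^ k ℤ.* t) (trans (cong χ (Char2.solve 3
      (λ a b c → a :* con false :+ b :* con false :+ c :* con false := con false) refl a b c)) χ-0)) (ℤ.*-identityʳ _)))
    (twistedMoment≡q³*representations k 0# 0# 0#)
    where
    open Char2

  -- From tuples of field elements to walks on the hypercube.

  flip : ∀ {n} → Fin n → Word n → Word n
  flip i w = updateAt w i not

  flip-involutive : ∀ {n} i (w : Word n) → flip i (flip i w) ≡ w
  flip-involutive zero    (b ∷ w) = cong (_∷ w) (Bool.not-involutive b)
  flip-involutive (suc i) (b ∷ w) = cong (b ∷_) (flip-involutive i w)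

  flip-comm : ∀ {n} i j (w : Word n) → flip i (flip j w) ≡ flip j (flip i w)
  flip-comm zero    zero    (b ∷ w) = refl
  flip-comm zero    (suc j) (b ∷ w) = refl
  flip-comm (suc i) zero    (b ∷ w) = refl
  flip-comm (suc i) (suc j) (b ∷ w) = cong (b ∷_) (flip-comm i j w)

  flips : ∀ {n k} → Vec (Fin n) k → Word n → Word n
  flips []       w = w
  flips (i ∷ is) w = flips is (flip i w)

  -- Flips commute, so the first one can be carried to its later copy, where the two undo each
  -- other.
  remove-twins : ∀ {n k i} {is : Vec (Fin n) (suc k)} → i Vec.∈ is → ∃[ js ] ∀ w → flips (i ∷ is) w ≡ flips {k = k} js w
  remove-twins {i = i} {is = _ ∷ is} (here refl) = is , λ w → cong (flips is) (flip-involutive i w)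
  remove-twins {k = suc k} {i} {j ∷ is} (there i∈is) with js , eq ← remove-twins i∈is =
    j ∷ js , λ w → trans (cong (flips is) (flip-comm j i w)) (eq (flip j w))

  evaluate : ∀ {n} → (Fin n → 𝔽) → Word n → 𝔽
  evaluate g []      = 0#
  evaluate g (b ∷ w) = embed₂ b ⊠ g zero ⊞ evaluate (g ∘ suc) w

  evaluate-𝟎 : ∀ {n} (g : Fin n → 𝔽) → evaluate g 𝟎 ≡ 0#
  evaluate-𝟎 {zero}  g = refl
  evaluate-𝟎 {suc n} g = trans (cong₂ _⊞_ (zeroˡ _) (evaluate-𝟎 (g ∘ suc))) (+-identityˡ 0#)

  evaluate-flip : ∀ {n} (g : Fin n → 𝔽) i w → evaluate g (flip i w) ≡ g i ⊞ evaluate g w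
  evaluate-flip g zero    (true  ∷ w) = Char2.solve 2 (λ x y → con false :* x :+ y := x :+ (con true :* x :+ y)) refl (g zero) _
    where
    open Char2
  evaluate-flip g zero    (false ∷ w) = Char2.solve 2 (λ x y → con true :* x :+ y := x :+ (con false :* x :+ y)) refl (g zero) _
    where
    open Char2
  evaluate-flip g (suc i) (b ∷ w)     = trans (cong (embed₂ b ⊠ g zero ⊞_) (evaluate-flip (g ∘ suc) i w))
    (Char2.solve 3 (λ x y z → x :+ (y :+ z) := y :+ (x :+ z)) refl _ _ _)
    where
    open Char2

  walks : ∀ {n} → ℕ → (Word n → ℤ) → Word n → ℤ
  walks zero    φ w = φ w
  walks (suc k) φ w = sum λ i → walks k φ (flip i w)

  -- Agreement is asked only at the ends of walks of length `k` from `w`: that a word with vanishing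
  -- power sums is 𝟎 is established only for words reached from 𝟎 in 2, 4 or 6 steps.
  walks-cong : ∀ {n} k {φ ψ : Word n → ℤ} w → (∀ (is : Vec (Fin n) k) → φ (flips is w) ≡ ψ (flips is w)) →
    walks k φ w ≡ walks k ψ w
  walks-cong zero    w eq = eq []
  walks-cong (suc k) w eq = sum-cong-≗ λ i → walks-cong k (flip i w) (λ is → eq (i ∷ is))

  -- In characteristic 2 a power sum depends only on which elements occur an odd number of times. A
  -- tuple can thus be replaced by its word of parities, and appending an entry becomes a flip.
  power₁ power₃ power₅ : Word q → 𝔽
  power₁ = evaluate id
  power₃ = evaluate (_^ 3)
  power₅ = evaluate (_^ 5)

  representations≡walks : ∀ k w → representations k (power₅ w) (power₃ w) (power₁ w) ≡ walks k (λ w → δ (power₅ w) (power₃ w) (power₁ w)) w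
  representations≡walks zero    w = refl
  representations≡walks (suc k) w = sum-cong-≗ λ x → begin
    representations k (x ^ 5 ⊞ power₅ w) (x ^ 3 ⊞ power₃ w) (x ⊞ power₁ w)
      ≡⟨ cong₂ (λ A B → representations k A B (x ⊞ power₁ w)) (evaluate-flip (_^ 5) x w) (evaluate-flip (_^ 3) x w) ⟨
    representations k (power₅ (flip x w)) (power₃ (flip x w)) (x ⊞ power₁ w)
      ≡⟨ cong (representations k _ _) (evaluate-flip id x w) ⟨
    representations k (power₅ (flip x w)) (power₃ (flip x w)) (power₁ (flip x w))    ≡⟨ representations≡walks k (flip x w) ⟩
    walks k (λ w → δ (power₅ w) (power₃ w) (power₁ w)) (flip x w)                    ∎

  record Null (w : Word q) : Set where
    constructor null
    field
      power₅≡0 : power₅ w ≡ 0#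
      power₃≡0 : power₃ w ≡ 0#
      power₁≡0 : power₁ w ≡ 0#

  powerSum : ∀ {k} → (𝔽 → 𝔽) → Vec 𝔽 k → 𝔽
  powerSum g []       = 0#
  powerSum g (x ∷ xs) = g x ⊞ powerSum g xs

  evaluate-flips : ∀ {k} (g : 𝔽 → 𝔽) (xs : Vec 𝔽 k) w → evaluate g (flips xs w) ≡ powerSum g xs ⊞ evaluate g w
  evaluate-flips g []       w = sym (+-identityˡ _)
  evaluate-flips g (x ∷ xs) w = begin
    evaluate g (flips xs (flip x w))             ≡⟨ evaluate-flips g xs (flip x w) ⟩
    powerSum g xs ⊞ evaluate g (flip x w)        ≡⟨ cong (powerSum g xs ⊞_) (evaluate-flip g x w) ⟩
    powerSum g xs ⊞ (g x ⊞ evaluate g w)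
      ≡⟨ Char2.solve 3 (λ p x e → p :+ (x :+ e) := x :+ p :+ e) refl _ (g x) _ ⟩
    powerSum g (x ∷ xs) ⊞ evaluate g w           ∎
    where
    open Char2

  powerSum≡evaluate : ∀ {k} (g : 𝔽 → 𝔽) (xs : Vec 𝔽 k) → powerSum g xs ≡ evaluate g (flips xs 𝟎)
  powerSum≡evaluate g xs = sym (trans (evaluate-flips g xs 𝟎) (trans (cong (powerSum g xs ⊞_) (evaluate-𝟎 g)) (+-identityʳ _)))

  last-term : ∀ {x y} → x ⊞ y ≡ 0# → y ≡ x
  last-term eq = sym (x+y≡0⇒x≡y eq)

  differences : ∀ {k} → 𝔽 → Vec 𝔽 k → 𝔽
  differences x []       = 1#
  differences x (y ∷ ys) = (x ⊞ y) ⊠ differences x ys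

  differences≡0⇒∈ : ∀ {k} x (ys : Vec 𝔽 k) → differences x ys ≡ 0# → x Vec.∈ ys
  differences≡0⇒∈ x []       1≡0 = contradiction 1≡0 1≢0
  differences≡0⇒∈ x (y ∷ ys) eq with zero-product (x ⊞ y) (differences x ys) eq
  ... | inj₁ x+y≡0 = here (x+y≡0⇒x≡y x+y≡0)
  ... | inj₂ ≡0    = there (differences≡0⇒∈ x ys ≡0)

  -- Newton's identities for the differences to the first element: when the first power sum
  -- vanishes, e₃ = p₃ and e₅ = p₅ + e₂ p₃ in characteristic 2.
  twin₂ : ∀ (xs : Vec 𝔽 2) → Null (flips xs 𝟎) → ∃[ x ] ∃[ ys ] xs ≡ x ∷ ys × x Vec.∈ ys
  twin₂ xs@(x₁ ∷ x₂ ∷ []) (null _ _ p₁≡0) = _ , _ , refl ,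
    here (x+y≡0⇒x≡y (trans (cong (x₁ ⊞_) (sym (+-identityʳ x₂))) (trans (powerSum≡evaluate id xs) p₁≡0)))

  twin₄ : ∀ (xs : Vec 𝔽 4) → Null (flips xs 𝟎) → ∃[ x ] ∃[ ys ] xs ≡ x ∷ ys × x Vec.∈ ys
  twin₄ xs@(x₁ ∷ x₂ ∷ x₃ ∷ x₄ ∷ []) (null _ p₃≡0 p₁≡0) = _ , _ , refl ,
    differences≡0⇒∈ x₁ (x₂ ∷ x₃ ∷ x₄ ∷ []) product≡0
    where
    open Char2
    x₄≡ : x₄ ≡ x₁ ⊞ (x₂ ⊞ x₃)
    x₄≡ = last-term (begin
      x₁ ⊞ (x₂ ⊞ x₃) ⊞ x₄           ≡⟨ Char2.solve 4 (λ x₁ x₂ x₃ x₄ → x₁ :+ (x₂ :+ x₃) :+ x₄ := x₁ :+ (x₂ :+ (x₃ :+ (x₄ :+ con false)))) refl x₁ x₂ x₃ x₄ ⟩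
      powerSum id xs                ≡⟨ trans (powerSum≡evaluate id xs) p₁≡0 ⟩
      0#                            ∎)

    product≡0 : differences x₁ (x₂ ∷ x₃ ∷ x₄ ∷ []) ≡ 0#
    product≡0 = begin
      differences x₁ (x₂ ∷ x₃ ∷ x₄ ∷ [])                         ≡⟨ cong (λ t → differences x₁ (x₂ ∷ x₃ ∷ t ∷ [])) x₄≡ ⟩
      differences x₁ (x₂ ∷ x₃ ∷ x₁ ⊞ (x₂ ⊞ x₃) ∷ [])
        ≡⟨ Char2.solve 3 (λ x₁ x₂ x₃ → (x₁ :+ x₂) :* ((x₁ :+ x₃) :* ((x₁ :+ (x₁ :+ (x₂ :+ x₃))) :* con true))
             := x₁ :^ 3 :+ (x₂ :^ 3 :+ (x₃ :^ 3 :+ ((x₁ :+ (x₂ :+ x₃)) :^ 3 :+ con false)))) refl x₁ x₂ x₃ ⟩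
      powerSum (_^ 3) (x₁ ∷ x₂ ∷ x₃ ∷ (x₁ ⊞ (x₂ ⊞ x₃)) ∷ [])     ≡⟨ cong (λ t → powerSum (_^ 3) (x₁ ∷ x₂ ∷ x₃ ∷ t ∷ [])) x₄≡ ⟨
      powerSum (_^ 3) xs                                         ≡⟨ trans (powerSum≡evaluate (_^ 3) xs) p₃≡0 ⟩
      0#                                                         ∎

  twin₆ : ∀ (xs : Vec 𝔽 6) → Null (flips xs 𝟎) → ∃[ x ] ∃[ ys ] xs ≡ x ∷ ys × x Vec.∈ ys
  twin₆ xs@(x₁ ∷ x₂ ∷ x₃ ∷ x₄ ∷ x₅ ∷ x₆ ∷ []) (null p₅≡0 p₃≡0 p₁≡0) = _ , _ , refl ,
    differences≡0⇒∈ x₁ (x₂ ∷ x₃ ∷ x₄ ∷ x₅ ∷ x₆ ∷ []) product≡0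
    where
    open Char2
    s = x₁ ⊞ (x₂ ⊞ (x₃ ⊞ (x₄ ⊞ x₅)))

    x₆≡ : x₆ ≡ s
    x₆≡ = last-term (begin
      s ⊞ x₆                        ≡⟨ Char2.solve 6 (λ x₁ x₂ x₃ x₄ x₅ x₆ → x₁ :+ (x₂ :+ (x₃ :+ (x₄ :+ x₅))) :+ x₆
                                         := x₁ :+ (x₂ :+ (x₃ :+ (x₄ :+ (x₅ :+ (x₆ :+ con false)))))) refl x₁ x₂ x₃ x₄ x₅ x₆ ⟩
      powerSum id xs                ≡⟨ trans (powerSum≡evaluate id xs) p₁≡0 ⟩
      0#                            ∎)

    xs′ : Vec 𝔽 6
    xs′ = x₁ ∷ x₂ ∷ x₃ ∷ x₄ ∷ x₅ ∷ s ∷ []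

    powerSum-xs′ : ∀ g → powerSum g xs ≡ 0# → powerSum g xs′ ≡ 0#
    powerSum-xs′ g = trans (cong (λ t → powerSum g (x₁ ∷ x₂ ∷ x₃ ∷ x₄ ∷ x₅ ∷ t ∷ [])) (sym x₆≡))

    -- The second elementary symmetric function of the five differences to x₁. The last difference
    -- x₁ + s equals x₂ + x₃ + x₄ + x₅, the sum of the other four, and so contributes the square.
    e₂ = (x₁ ⊞ x₂) ⊠ (x₁ ⊞ x₃) ⊞ (x₁ ⊞ x₂) ⊠ (x₁ ⊞ x₄) ⊞ (x₁ ⊞ x₂) ⊠ (x₁ ⊞ x₅) ⊞ (x₁ ⊞ x₃) ⊠ (x₁ ⊞ x₄)
       ⊞ (x₁ ⊞ x₃) ⊠ (x₁ ⊞ x₅) ⊞ (x₁ ⊞ x₄) ⊠ (x₁ ⊞ x₅)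
       ⊞ (x₂ ⊞ x₃ ⊞ x₄ ⊞ x₅) ⊠ (x₂ ⊞ x₃ ⊞ x₄ ⊞ x₅)

    product≡0 : differences x₁ (x₂ ∷ x₃ ∷ x₄ ∷ x₅ ∷ x₆ ∷ []) ≡ 0#
    product≡0 = begin
      differences x₁ (x₂ ∷ x₃ ∷ x₄ ∷ x₅ ∷ x₆ ∷ [])    ≡⟨ cong (λ t → differences x₁ (x₂ ∷ x₃ ∷ x₄ ∷ x₅ ∷ t ∷ [])) x₆≡ ⟩
      differences x₁ (x₂ ∷ x₃ ∷ x₄ ∷ x₅ ∷ s ∷ [])
        ≡⟨ Char2.solve 5 (λ x₁ x₂ x₃ x₄ x₅ → let s = x₁ :+ (x₂ :+ (x₃ :+ (x₄ :+ x₅))) in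
             (x₁ :+ x₂) :* ((x₁ :+ x₃) :* ((x₁ :+ x₄) :* ((x₁ :+ x₅) :* ((x₁ :+ s) :* con true))))
             := (x₁ :^ 5 :+ (x₂ :^ 5 :+ (x₃ :^ 5 :+ (x₄ :^ 5 :+ (x₅ :^ 5 :+ (s :^ 5 :+ con false))))))
             :+ ((x₁ :+ x₂) :* (x₁ :+ x₃) :+ (x₁ :+ x₂) :* (x₁ :+ x₄) :+ (x₁ :+ x₂) :* (x₁ :+ x₅) :+ (x₁ :+ x₃) :* (x₁ :+ x₄)
                 :+ (x₁ :+ x₃) :* (x₁ :+ x₅) :+ (x₁ :+ x₄) :* (x₁ :+ x₅)
                 :+ (x₂ :+ x₃ :+ x₄ :+ x₅) :* (x₂ :+ x₃ :+ x₄ :+ x₅))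
                :* (x₁ :^ 3 :+ (x₂ :^ 3 :+ (x₃ :^ 3 :+ (x₄ :^ 3 :+ (x₅ :^ 3 :+ (s :^ 3 :+ con false)))))))
             refl x₁ x₂ x₃ x₄ x₅ ⟩
      powerSum (_^ 5) xs′ ⊞ e₂ ⊠ powerSum (_^ 3) xs′
        ≡⟨ cong₂ (λ s t → s ⊞ e₂ ⊠ t)
             (powerSum-xs′ (_^ 5) (trans (powerSum≡evaluate (_^ 5) xs) p₅≡0))
             (powerSum-xs′ (_^ 3) (trans (powerSum≡evaluate (_^ 3) xs) p₃≡0)) ⟩
      0# ⊞ e₂ ⊠ 0#      ≡⟨ trans (+-identityˡ _) (zeroʳ e₂) ⟩
      0#                ∎

  Null-𝟎 : Null 𝟎
  Null-𝟎 = null (evaluate-𝟎 (_^ 5)) (evaluate-𝟎 (_^ 3)) (evaluate-𝟎 id)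

  -- Dropping two equal entries keeps the end of the walk, hence also its power sums. This drives
  -- the descent from six entries to four, two and none.
  untwin : ∀ {k} (xs : Vec 𝔽 (2 ℕ.+ k)) → (∃[ x ] ∃[ ys ] xs ≡ x ∷ ys × x Vec.∈ ys) →
    ∃[ zs ] flips xs 𝟎 ≡ flips {k = k} zs 𝟎
  untwin _ (x , ys , refl , x∈ys) with zs , eq ← remove-twins x∈ys = zs , eq 𝟎

  Null₂⇒𝟎 : ∀ (xs : Vec 𝔽 2) → Null (flips xs 𝟎) → flips xs 𝟎 ≡ 𝟎
  Null₂⇒𝟎 xs n with untwin xs (twin₂ xs n)
  ... | [] , eq = eq

  Null₄⇒𝟎 : ∀ (xs : Vec 𝔽 4) → Null (flips xs 𝟎) → flips xs 𝟎 ≡ 𝟎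
  Null₄⇒𝟎 xs n with untwin xs (twin₄ xs n)
  ... | zs , eq = trans eq (Null₂⇒𝟎 zs (subst Null eq n))

  Null₆⇒𝟎 : ∀ (xs : Vec 𝔽 6) → Null (flips xs 𝟎) → flips xs 𝟎 ≡ 𝟎
  Null₆⇒𝟎 xs n with untwin xs (twin₆ xs n)
  ... | zs , eq = trans eq (Null₄⇒𝟎 zs (subst Null eq n))

  -- From a word of length n and weight j, exactly j of the flips lower the weight and the other n -
  -- j raise it.
  step : ℕ → (ℕ → ℤ) → ℕ → ℤ
  step n f zero    = + n ℤ.* f 1
  step n f (suc j) = + suc j ℤ.* f j ℤ.+ (+ n ℤ.- + suc j) ℤ.* f (2 ℕ.+ j)

  sum-flip : ∀ {n} (f : ℕ → ℤ) (w : Word n) → sum (λ i → f (weight (flip i w))) ≡ step n f (weight w)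
  sum-flip f []          = refl
  sum-flip {suc n} f (true ∷ w) = trans (cong (λ t → f (weight w) ℤ.+ t) (sum-flip (f ∘ suc) w)) (shift (weight w))
    where
    open ℤ.+-*-Solver
    shift : ∀ j → f j ℤ.+ step n (f ∘ suc) j ≡ step (suc n) f (suc j)
    shift zero    = solve 3 (λ n a b → a :+ n :* b := con 1ℤ :* a :+ (con 1ℤ :+ n :- con 1ℤ) :* b) refl (+ n) (f 0) (f 2)
    shift (suc j) = solve 4 (λ n j a b → a :+ (j :* a :+ (n :- j) :* b)
      := (con 1ℤ :+ j) :* a :+ (con 1ℤ :+ n :- (con 1ℤ :+ j)) :* b) refl (+ n) (+ suc j) (f (suc j)) (f (3 ℕ.+ j))
  sum-flip {suc n} f (false ∷ w) = trans (cong (λ t → f (suc (weight w)) ℤ.+ t) (sum-flip f w)) (shift (weight w))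
    where
    open ℤ.+-*-Solver
    shift : ∀ j → f (suc j) ℤ.+ step n f j ≡ step (suc n) f j
    shift zero    = solve 2 (λ n a → a :+ n :* a := (con 1ℤ :+ n) :* a) refl (+ n) (f 1)
    shift (suc j) = solve 4 (λ n j a b → b :+ (j :* a :+ (n :- j) :* b)
      := j :* a :+ (con 1ℤ :+ n :- j) :* b) refl (+ n) (+ suc j) (f j) (f (2 ℕ.+ j))

  -- The number of walks of length k on the n-dimensional hypercube that start at a word of weight j
  -- and end at 𝟎.
  returns : ℕ → ℕ → ℕ → ℤ
  returns n zero    j = [ does (j ℕ.≟ 0) ]
  returns n (suc k) j = step n (returns n k) j

  weight-𝟎 : ∀ n → weight (𝟎 {n}) ≡ 0
  weight-𝟎 zero    = refl
  weight-𝟎 (suc n) = weight-𝟎 n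

  weight≡0⇒𝟎 : ∀ {n} (w : Word n) → weight w ≡ 0 → w ≡ 𝟎
  weight≡0⇒𝟎 []          eq = refl
  weight≡0⇒𝟎 (false ∷ w) eq = cong (false ∷_) (weight≡0⇒𝟎 w eq)

  walks≡returns : ∀ {n} k (w : Word n) → walks k (λ w → [ does (weight w ℕ.≟ 0) ]) w ≡ returns n k (weight w)
  walks≡returns     zero    w = refl
  walks≡returns {n} (suc k) w = trans (sum-cong-≗ λ i → walks≡returns k (flip i w)) (sum-flip (returns n k) w)

  δ-Null : ∀ w → Null w → δ (power₅ w) (power₃ w) (power₁ w) ≡ 1ℤ
  δ-Null w n rewrite []-true (power₅ w ≟ 0#) (Null.power₅≡0 n)
                   | []-true (power₃ w ≟ 0#) (Null.power₃≡0 n)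
                   | []-true (power₁ w ≟ 0#) (Null.power₁≡0 n) = refl

  δ≡[weight≡0] : ∀ w → (Null w → w ≡ 𝟎) → δ (power₅ w) (power₃ w) (power₁ w) ≡ [ does (weight w ℕ.≟ 0) ]
  δ≡[weight≡0] w Null⇒𝟎 = case weight w ℕ.≟ 0 of λ where
      (yes wt≡0) → trans (δ-Null w (subst Null (sym (weight≡0⇒𝟎 w wt≡0)) Null-𝟎))
                     (sym ([]-true (weight w ℕ.≟ 0) wt≡0))
      (no wt≢0)  → trans (δ-¬Null λ n → wt≢0 (trans (cong weight (Null⇒𝟎 n)) (weight-𝟎 q)))
                     (sym ([]-false (weight w ℕ.≟ 0) wt≢0))
    where
    δ-¬Null : ¬ Null w → δ (power₅ w) (power₃ w) (power₁ w) ≡ 0ℤ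
    δ-¬Null ¬n with power₅ w ≟ 0# | power₃ w ≟ 0# | power₁ w ≟ 0#
    ... | yes p₅ | yes p₃ | yes p₁ = contradiction (null p₅ p₃ p₁) ¬n
    ... | no _   | _      | _      = refl
    ... | yes _  | no _   | _      = refl
    ... | yes _  | yes _  | no _   = refl

  moment≡q³*returns : ∀ k → (∀ (xs : Vec 𝔽 k) → Null (flips xs 𝟎) → flips xs 𝟎 ≡ 𝟎) → moment k ≡ q³ ℤ.* returns q k 0
  moment≡q³*returns k Null⇒𝟎 = begin
    moment k                                                            ≡⟨ moment≡q³*representations k ⟩
    q³ ℤ.* representations k 0# 0# 0#
      ≡⟨ cong (λ t → q³ ℤ.* t) (begin
           representations k 0# 0# 0#
             ≡⟨ cong₂ (λ A B → representations k A B 0#) Null-𝟎.power₅≡0 Null-𝟎.power₃≡0 ⟨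
           representations k (power₅ 𝟎) (power₃ 𝟎) 0#               ≡⟨ cong (representations k _ _) Null-𝟎.power₁≡0 ⟨
           representations k (power₅ 𝟎) (power₃ 𝟎) (power₁ 𝟎)       ≡⟨ representations≡walks k 𝟎 ⟩
           walks k (λ w → δ (power₅ w) (power₃ w) (power₁ w)) 𝟎
             ≡⟨ walks-cong k 𝟎 (λ xs → δ≡[weight≡0] (flips xs 𝟎) (Null⇒𝟎 xs)) ⟩
           walks k (λ w → [ does (weight w ℕ.≟ 0) ]) 𝟎              ≡⟨ walks≡returns k 𝟎 ⟩
           returns q k (weight (𝟎 {q}))                             ≡⟨ cong (returns q k) (weight-𝟎 q) ⟩
           returns q k 0                                            ∎) ⟩
    q³ ℤ.* returns q k 0                                                ∎
    where module Null-𝟎 = Null Null-𝟎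

  returns₂ : ∀ n → returns n 2 0 ≡ + n
  returns₂ n = solve 1 (λ n → n :* (con 1ℤ :* con 1ℤ :+ (n :- con 1ℤ) :* con 0ℤ) := n) refl (+ n)
    where
    open ℤ.+-*-Solver

  module ReturnsPolynomial where
    open ℤ.+-*-Solver

    -- The recursion is repeated on formal polynomials so that the solver can expand it in `n`.
    -- Their evaluation unfolds definitionally to `returns`.
    stepₚ : Polynomial 1 → (ℕ → Polynomial 1) → ℕ → Polynomial 1
    stepₚ n f zero    = n :* f 1
    stepₚ n f (suc j) = con (+ suc j) :* f j :+ (n :- con (+ suc j)) :* f (2 ℕ.+ j)

    returnsₚ : Polynomial 1 → ℕ → ℕ → Polynomial 1
    returnsₚ n zero    j = con [ does (j ℕ.≟ 0) ]
    returnsₚ n (suc k) j = stepₚ n (returnsₚ n k) j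

    returns₄ : ∀ n → returns n 4 0 ≡ + 3 ℤ.* + n ℤ.* + n ℤ.- + 2 ℤ.* + n
    returns₄ n = solve 1 (λ n → returnsₚ n 4 0 := con (+ 3) :* n :* n :- con (+ 2) :* n) refl (+ n)

    returns₆ : ∀ n → returns n 6 0 ≡ + 15 ℤ.* + n ℤ.* + n ℤ.* + n ℤ.- + 30 ℤ.* + n ℤ.* + n ℤ.+ + 16 ℤ.* + n
    returns₆ n = solve 1 (λ n → returnsₚ n 6 0
      := con (+ 15) :* n :* n :* n :- con (+ 30) :* n :* n :+ con (+ 16) :* n) refl (+ n)

  moment₂ : moment 2 ≡ q³ ℤ.* + q
  moment₂ = trans (moment≡q³*returns 2 Null₂⇒𝟎) (cong (λ t → q³ ℤ.* t) (returns₂ q))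

  moment₄ : moment 4 ≡ q³ ℤ.* (+ 3 ℤ.* + q ℤ.* + q ℤ.- + 2 ℤ.* + q)
  moment₄ = trans (moment≡q³*returns 4 Null₄⇒𝟎) (cong (λ t → q³ ℤ.* t) (ReturnsPolynomial.returns₄ q))

  moment₆ : moment 6 ≡ q³ ℤ.* (+ 15 ℤ.* + q ℤ.* + q ℤ.* + q ℤ.- + 30 ℤ.* + q ℤ.* + q ℤ.+ + 16 ℤ.* + q)
  moment₆ = trans (moment≡q³*returns 6 Null₆⇒𝟎) (cong (λ t → q³ ℤ.* t) (ReturnsPolynomial.returns₆ q))

  -- Even degree m = 2s: the values of ∣S∣.

  module EvenDegree (s : ℕ) (m≡2s : m ≡ 2 ℕ.* s) (3≤s : 3 ℕ.≤ s) where

    module _ where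
      open ℕ.+-*-Solver

      square-even : ∀ n k → n ℕ.* n ≡ 4 ℕ.* k → ∃[ h ] n ≡ h ℕ.* 2 × h ℕ.* h ≡ k
      square-even n k eq = halve ([ id , id ]′ (euclidsLemma n n prime[2]
        (divides (2 ℕ.* k) (trans eq (solve 1 (λ k → con 4 :* k := con 2 :* k :* con 2) refl k)))))
        where
        halve : 2 ∣ n → ∃[ h ] n ≡ h ℕ.* 2 × h ℕ.* h ≡ k
        halve (divides h refl) = h , refl , ℕ.*-cancelˡ-≡ _ _ 4
          (trans (solve 1 (λ h → con 4 :* (h :* h) := h :* con 2 :* (h :* con 2)) refl h) eq)

      private
        quarter : ∀ x k → 2 ℕ.* x ℕ.* (2 ℕ.* x) ℕ.* k ≡ 4 ℕ.* (x ℕ.* x ℕ.* k)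
        quarter = solve 2 (λ x k → con 2 :* x :* (con 2 :* x) :* k := con 4 :* (x :* x :* k)) refl

        double : ∀ t x → t ℕ.* x ℕ.* 2 ≡ t ℕ.* (2 ℕ.* x)
        double = solve 2 (λ t x → t :* x :* con 2 := t :* (con 2 :* x)) refl

      -- A number whose square is divisible by 4 is even, so each factor 4 of the square takes one
      -- factor 2 out of `n`.
      square-2^ : ∀ s n k → n ℕ.* n ≡ 2 ℕ.^ s ℕ.* 2 ℕ.^ s ℕ.* k → ∃[ t ] n ≡ t ℕ.* 2 ℕ.^ s × t ℕ.* t ≡ k
      square-2^ zero    n k eq = n , sym (ℕ.*-identityʳ n) , trans eq (ℕ.+-identityʳ k)
      square-2^ (suc s) n k eq
        with h , n≡2h , h²≡ ← square-even n (2 ℕ.^ s ℕ.* 2 ℕ.^ s ℕ.* k) (trans eq (quarter (2 ℕ.^ s) k))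
        with t , h≡ , t²≡k ← square-2^ s h k h²≡
        = t , trans n≡2h (trans (cong (ℕ._* 2) h≡) (double t (2 ℕ.^ s))) , t²≡k

    r : ℕ
    r = 2 ℕ.^ s

    q≡r² : q ≡ r ℕ.* r
    q≡r² = begin
      q                              ≡⟨ q≡2^m ⟩
      2 ℕ.^ m                        ≡⟨ cong (2 ℕ.^_) m≡2s ⟩
      2 ℕ.^ (s ℕ.+ (s ℕ.+ 0))        ≡⟨ ℕ.^-distribˡ-+-* 2 s (s ℕ.+ 0) ⟩
      r ℕ.* 2 ℕ.^ (s ℕ.+ 0)          ≡⟨ cong (λ n → r ℕ.* 2 ℕ.^ n) (ℕ.+-identityʳ s) ⟩
      r ℕ.* r                        ∎

    8≤r : 8 ℕ.≤ r
    8≤r = ℕ.^-monoʳ-≤ 2 3≤s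

    module _ (a b c : 𝔽) where

      L-0 : L a b c 0# ≡ 0#
      L-0 = begin
        L a b c 0#                   ≡⟨ cong (L a b c) (+-identityˡ 0#) ⟨
        L a b c (0# ⊞ 0#)            ≡⟨ L-+ a b c 0# 0# ⟩
        L a b c 0# ⊞ L a b c 0#      ≡⟨ x+x≡0 _ ⟩
        0#                           ∎

      -- A nonzero z in the kernel pairs y with y + z; the pairs are counted through their smaller member.
      kernelSize-parity : kernelSize a b c ≡ 1ℤ ⊎ ∃[ j ] kernelSize a b c ≡ j ℤ.+ j
      kernelSize-parity with Fin.any? (λ z → ¬? (z ≟ 0#) ×-dec (L a b c z ≟ 0#))
      ... | no ∄z = inj₁ (trans
        (sum-cong-≗ λ y → []-cong (L a b c y ≟ 0#) (y ≟ 0#)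
          (λ Ly≡0 → case y ≟ 0# of λ where
            (yes y≡0) → y≡0
            (no y≢0)  → contradiction (y , y≢0 , Ly≡0) ∄z)
          (λ y≡0 → trans (cong (L a b c) y≡0) L-0))
        (sum-δ₁ 0#))
      ... | yes (z , z≢0 , Lz≡0) = inj₂ (sum smaller , (begin
        kernelSize a b c                                    ≡⟨ sum-cong-≗ split ⟩
        sum (λ y → smaller y ℤ.+ smaller (z ⊞ y))           ≡⟨ ∑-distrib-+ {q} smaller (λ y → smaller (z ⊞ y)) ⟩
        sum smaller ℤ.+ sum (λ y → smaller (z ⊞ y))         ≡⟨ cong (λ t → sum smaller ℤ.+ t) (sum-translate smaller z) ⟩
        sum smaller ℤ.+ sum smaller                         ∎))
        where
        smaller : 𝔽 → ℤ
        smaller y = [ does (L a b c y ≟ 0#) ] ℤ.* [ does (y Fin.<? z ⊞ y) ]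

        L-shift : ∀ y → L a b c (z ⊞ y) ≡ L a b c y
        L-shift y = trans (L-+ a b c z y) (trans (cong (_⊞ L a b c y) Lz≡0) (+-identityˡ _))

        one : ∀ y → 1ℤ ≡ [ does (y Fin.<? z ⊞ y) ] ℤ.+ [ does (z ⊞ y Fin.<? y) ]
        one y with Fin.<-cmp y (z ⊞ y)
        ... | tri< lt _ ≯ = sym (cong₂ ℤ._+_ ([]-true (y Fin.<? z ⊞ y) lt) ([]-false (z ⊞ y Fin.<? y) ≯))
        ... | tri> ≮ _ gt = sym (cong₂ ℤ._+_ ([]-false (y Fin.<? z ⊞ y) ≮) ([]-true (z ⊞ y Fin.<? y) gt))
        ... | tri≈ _ y≡z+y _ = contradiction (+-cancelʳ y z 0# (trans (sym y≡z+y) (sym (+-identityˡ y)))) z≢0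

        split : ∀ y → [ does (L a b c y ≟ 0#) ] ≡ smaller y ℤ.+ smaller (z ⊞ y)
        split y = begin
          [ does (L a b c y ≟ 0#) ]                ≡⟨ ℤ.*-identityʳ _ ⟨
          [ does (L a b c y ≟ 0#) ] ℤ.* 1ℤ         ≡⟨ cong (λ t → [ does (L a b c y ≟ 0#) ] ℤ.* t) (one y) ⟩
          [ does (L a b c y ≟ 0#) ] ℤ.* ([ does (y Fin.<? z ⊞ y) ] ℤ.+ [ does (z ⊞ y Fin.<? y) ])
            ≡⟨ ℤ.*-distribˡ-+ [ does (L a b c y ≟ 0#) ] _ _ ⟩
          smaller y ℤ.+ [ does (L a b c y ≟ 0#) ] ℤ.* [ does (z ⊞ y Fin.<? y) ]
            ≡⟨ cong (λ t → smaller y ℤ.+ t) (cong₂ (λ u v → [ does (u ≟ 0#) ] ℤ.* [ does (z ⊞ y Fin.<? v) ]) (sym (L-shift y)) (sym z+z+y≡y)) ⟩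
          smaller y ℤ.+ smaller (z ⊞ y)            ∎
          where
          z+z+y≡y : z ⊞ (z ⊞ y) ≡ y
          z+z+y≡y = trans (sym (+-assoc z z y)) (trans (cong (_⊞ y) (x+x≡0 z)) (+-identityˡ y))

      -- Among the squares up to 16 only 9 is odd and larger than 1, so the parity of the kernel is
      -- what excludes ∣S∣ = 3 · 2^s.
      kernelSize≢9 : kernelSize a b c ≢ + 9
      kernelSize≢9 eq with kernelSize-parity
      ... | inj₁ one       = case trans (sym one) eq of λ ()
      ... | inj₂ (j , two) = odd j (trans (sym two) eq)
        where
        odd-ℕ : ∀ n → n ℕ.+ n ≢ 9
        odd-ℕ 0 ()
        odd-ℕ 1 ()
        odd-ℕ 2 ()
        odd-ℕ 3 ()
        odd-ℕ 4 ()
        odd-ℕ (suc (suc (suc (suc (suc n))))) eq = case subst (ℕ._≤ 9) (cong (5 ℕ.+_) (ℕ.+-comm n (5 ℕ.+ n))) (ℕ.≤-reflexive eq) of λ where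
          (ℕ.s≤s (ℕ.s≤s (ℕ.s≤s (ℕ.s≤s (ℕ.s≤s (ℕ.s≤s (ℕ.s≤s (ℕ.s≤s (ℕ.s≤s ())))))))))
        odd : ∀ j → j ℤ.+ j ≢ + 9
        odd (+ n)      eq = odd-ℕ n (ℤ.+-injective eq)
        odd ℤ.-[1+ n ] ()

      kernelSize-ℕ : ∃[ k ] kernelSize a b c ≡ + k
      kernelSize-ℕ with kernelSize a b c | nonneg
        where
        nonneg : 0ℤ ℤ.≤ kernelSize a b c
        nonneg = ℤ.≤-trans (ℤ.≤-reflexive (sym (sum-replicate-zero q))) (sum-mono {q} λ y → []-nonneg (does (L a b c y ≟ 0#)))
      ... | + k | _ = k , refl

    -- The t with t² ≤ 16 and t² ≠ 9; these are the quotients ∣S∣ / 2^s away from the zero triple.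
    data Height : ℕ → Set where
      zero : Height 0
      one  : Height 1
      two  : Height 2
      four : Height 4

    height : ∀ t → t ℕ.* t ℕ.≤ 16 → t ℕ.* t ≢ 9 → Height t
    height 0 _ _ = zero
    height 1 _ _ = one
    height 2 _ _ = two
    height 3 _ ≢9 = contradiction refl ≢9
    height 4 _ _ = four
    height (suc (suc (suc (suc (suc t))))) ≤16 _ =
      -- Here t² is at least 5² = 17 + 8, which exceeds 16.
      contradiction (ℕ.≤-trans (ℕ.*-mono-≤ (ℕ.m≤m+n 5 t) (ℕ.m≤m+n 5 t)) ≤16) (ℕ.<⇒≱ (ℕ.m≤m+n 17 8))

    ∣S∣²≡ : ∀ a b c {k} → kernelSum a b c ≡ + k → ℤ.∣ S a b c ∣ ℕ.* ℤ.∣ S a b c ∣ ≡ r ℕ.* r ℕ.* k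
    ∣S∣²≡ a b c {k} eq = begin
      ℤ.∣ S a b c ∣ ℕ.* ℤ.∣ S a b c ∣    ≡⟨ ℤ.∣i*j∣≡∣i∣*∣j∣ (S a b c) (S a b c) ⟨
      ℤ.∣ S a b c ℤ.* S a b c ∣          ≡⟨ cong ℤ.∣_∣ (trans (S²≡q*kernelSum a b c) (cong (λ t → + q ℤ.* t) eq)) ⟩
      ℤ.∣ + q ℤ.* + k ∣                  ≡⟨ ℤ.∣i*j∣≡∣i∣*∣j∣ (+ q) (+ k) ⟩
      q ℕ.* k                            ≡⟨ cong (ℕ._* k) q≡r² ⟩
      r ℕ.* r ℕ.* k                      ∎

    S-linear : ∀ c → S 0# 0# c ≡ + q ℤ.* [ does (c ≟ 0#) ]
    S-linear c = trans (sum-cong-≗ λ x → cong χ (Char2.solve 4 (λ x₅ x₃ x c → con false :* x₅ :+ con false :* x₃ :+ c :* x := x :* c) refl (x ^ 5) (x ^ 3) x c)) (orthogonality₁ c)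
      where
      open Char2

    S-000 : S 0# 0# 0# ≡ + q
    S-000 = trans (S-linear 0#) (trans (cong (λ t → + q ℤ.* t) ([]-true (0# ≟ 0#) refl)) (ℤ.*-identityʳ (+ q)))

    ∣S∣-values-nonlinear : ∀ a b c → ¬ (a ≡ 0# × b ≡ 0#) → ∃[ t ] Height t × ℤ.∣ S a b c ∣ ≡ t ℕ.* r
    ∣S∣-values-nonlinear a b c ab≢0 with kernelSum-values a b c
    ... | inj₁ K≡0 with t , ∣S∣≡ , t²≡0 ← square-2^ s _ _ (∣S∣²≡ a b c K≡0) =
      t , height t (subst (ℕ._≤ 16) (sym t²≡0) ℕ.z≤n) (λ t²≡9 → case trans (sym t²≡0) t²≡9 of λ ()) , ∣S∣≡
    ... | inj₂ K≡size with k , size≡k ← kernelSize-ℕ a b c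
                      with t , ∣S∣≡ , t²≡k ← square-2^ s _ _ (∣S∣²≡ a b c (trans K≡size size≡k)) =
      t , height t (subst (ℕ._≤ 16) (sym t²≡k) (ℤ.drop‿+≤+ (subst (ℤ._≤ + 16) size≡k (kernelSize≤16 a b c ab≢0))))
            (λ t²≡9 → kernelSize≢9 a b c (trans size≡k (cong +_ (trans (sym t²≡k) t²≡9)))) , ∣S∣≡

    ∣S∣-values : ∀ a b c → (a ≡ 0# × b ≡ 0# × c ≡ 0#) ⊎ ∃[ t ] Height t × ℤ.∣ S a b c ∣ ≡ t ℕ.* r
    ∣S∣-values a b c with a ≟ 0# | b ≟ 0# | c ≟ 0#
    ... | yes a≡0  | yes b≡0  | yes c≡0 = inj₁ (a≡0 , b≡0 , c≡0)
    ... | yes refl | yes refl | no c≢0  = inj₂ (0 , zero ,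
      cong ℤ.∣_∣ (trans (S-linear c) (trans (cong (λ t → + q ℤ.* t) ([]-false (c ≟ 0#) c≢0)) (ℤ.*-zeroʳ (+ q)))))
    ... | no a≢0   | _        | _       = inj₂ (∣S∣-values-nonlinear a b c (λ (a≡0 , _) → a≢0 a≡0))
    ... | yes a≡0  | no b≢0   | _       = inj₂ (∣S∣-values-nonlinear a b c (λ (_ , b≡0) → b≢0 b≡0))

    -- The last quotient belongs to the zero triple, for which S = q = r · r.
    multiple : Fin 5 → ℕ
    multiple 0F = 0
    multiple 1F = 1
    multiple 2F = 2
    multiple 3F = 4
    multiple 4F = r

    value : Fin 5 → ℕ
    value j = multiple j ℕ.* r

    instance
      r-nonZero : ℕ.NonZero r
      r-nonZero = ℕ.m^n≢0 2 s

    -- After cancelling r it remains to distinguish 0, 1, 2, 4 and r, and `8≤r` keeps r apart from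
    -- the rest.
    value-injective : ∀ i j → value i ≡ value j → i ≡ j
    value-injective i j eq with r′ , refl-r ← ℕ.m≤n⇒∃[o]m+o≡n 8≤r = begin
      i                      ≡⟨ decode-multiple i ⟨
      decode (multiple i)    ≡⟨ cong decode (ℕ.*-cancelʳ-≡ (multiple i) (multiple j) r eq) ⟩
      decode (multiple j)    ≡⟨ decode-multiple j ⟩
      j                      ∎
      where
      decode : ℕ → Fin 5
      decode 0 = 0F
      decode 1 = 1F
      decode 2 = 2F
      decode 4 = 3F
      decode _ = 4F

      decode-multiple : ∀ i → decode (multiple i) ≡ i
      decode-multiple 0F = refl
      decode-multiple 1F = refl
      decode-multiple 2F = refl
      decode-multiple 3F = refl
      -- With r in the form 8 + r′ the argument lies beyond all literals of `decode`, so the last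
      -- clause computes.
      decode-multiple 4F = cong decode (sym refl-r)

    ∣S∣≡value : ∀ a b c → ∃[ j ] ℤ.∣ S a b c ∣ ≡ value j
    ∣S∣≡value a b c with ∣S∣-values a b c
    ... | inj₁ (refl , refl , refl) = 4F , trans (cong ℤ.∣_∣ S-000) q≡r²
    ... | inj₂ (_ , zero , eq) = 0F , eq
    ... | inj₂ (_ , one  , eq) = 1F , eq
    ... | inj₂ (_ , two  , eq) = 2F , eq
    ... | inj₂ (_ , four , eq) = 3F , eq

    -- None of 0, r, 2r and 4r equals q = r². Besides fixing the frequency of q as 1, this makes the
    -- coefficients recoverable from the word.
    ∣S∣≡q⇒zero : ∀ a b c → ℤ.∣ S a b c ∣ ≡ q → a ≡ 0# × b ≡ 0# × c ≡ 0#
    ∣S∣≡q⇒zero a b c ∣S∣≡q with ∣S∣-values a b c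
    ... | inj₁ abc≡0 = abc≡0
    ... | inj₂ (_ , h , eq) = absurd h (trans (sym eq) (trans ∣S∣≡q q≡r²))
      where
      absurd : ∀ {A : Set} {t} → Height t → t ℕ.* r ≡ r ℕ.* r → A
      absurd zero eq = case value-injective 0F 4F eq of λ ()
      absurd one  eq = case value-injective 1F 4F eq of λ ()
      absurd two  eq = case value-injective 2F 4F eq of λ ()
      absurd four eq = case value-injective 3F 4F eq of λ ()

    count : Fin 5 → ℤ
    count j = ∑³ λ a b c → [ does (ℤ.∣ S a b c ∣ ℕ.≟ value j) ]

    -- The five values are distinct and exhaust ∣S∣, so for each triple exactly one indicator is 1.
    ∑³-by-value : ∀ (g : ℕ → ℤ) → ∑³ (λ a b c → g ℤ.∣ S a b c ∣) ≡ sum (λ j → count j ℤ.* g (value j))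
    ∑³-by-value g = begin
      ∑³ (λ a b c → g ℤ.∣ S a b c ∣)                                       ≡⟨ ∑³-cong pointwise ⟩
      ∑³ (λ a b c → sum λ j → g (value j) ℤ.* [ does (ℤ.∣ S a b c ∣ ℕ.≟ value j) ])
        ≡⟨ ∑³-swap {5} (λ j a b c → g (value j) ℤ.* [ does (ℤ.∣ S a b c ∣ ℕ.≟ value j) ]) ⟩
      sum (λ j → ∑³ λ a b c → g (value j) ℤ.* [ does (ℤ.∣ S a b c ∣ ℕ.≟ value j) ])
        ≡⟨ sum-cong-≗ {5} (λ j → trans (∑³-*ˡ (g (value j)) λ a b c → [ does (ℤ.∣ S a b c ∣ ℕ.≟ value j) ]) (ℤ.*-comm (g (value j)) (count j))) ⟩
      sum (λ j → count j ℤ.* g (value j))                                  ∎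
      where
      pointwise : ∀ a b c → g ℤ.∣ S a b c ∣ ≡ sum {5} (λ j → g (value j) ℤ.* [ does (ℤ.∣ S a b c ∣ ℕ.≟ value j) ])
      pointwise a b c with j , eq ← ∣S∣≡value a b c = begin
        g ℤ.∣ S a b c ∣                                              ≡⟨ cong g eq ⟩
        g (value j)                                                  ≡⟨ sum-δ j (g ∘ value) ⟨
        sum (λ i → [ does (i ≟ j) ] ℤ.* g (value i))
          ≡⟨ sum-cong-≗ {5} (λ i → trans (ℤ.*-comm _ (g (value i))) (cong (λ t → g (value i) ℤ.* t)
               ([]-cong (i ≟ j) (ℤ.∣ S a b c ∣ ℕ.≟ value i)
                 (λ i≡j → trans eq (cong value (sym i≡j)))
                 (λ eq′ → value-injective i j (trans (sym eq′) eq))))) ⟩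
        sum (λ i → g (value i) ℤ.* [ does (ℤ.∣ S a b c ∣ ℕ.≟ value i) ])  ∎

    ∑³-δ : ∑³ δ ≡ 1ℤ
    ∑³-δ = trans (∑³-product zero? zero? zero?) (cong (λ t → t ℤ.* t ℤ.* t) (sum-δ₁ 0#))
      where
      zero? : 𝔽 → ℤ
      zero? x = [ does (x ≟ 0#) ]

    count₄ : count 4F ≡ 1ℤ
    count₄ = trans (∑³-cong pointwise) ∑³-δ
      where
      pointwise : ∀ a b c → [ does (ℤ.∣ S a b c ∣ ℕ.≟ r ℕ.* r) ] ≡ δ a b c
      pointwise a b c = case ∣S∣≡q⇒zero a b c of λ zero-if → go zero-if
        where
        go : (ℤ.∣ S a b c ∣ ≡ q → a ≡ 0# × b ≡ 0# × c ≡ 0#) → [ does (ℤ.∣ S a b c ∣ ℕ.≟ r ℕ.* r) ] ≡ δ a b c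
        go only with a ≟ 0# | b ≟ 0# | c ≟ 0#
        ... | yes refl | yes refl | yes refl = []-true (ℤ.∣ S 0# 0# 0# ∣ ℕ.≟ r ℕ.* r) (trans (cong ℤ.∣_∣ S-000) q≡r²)
        ... | no a≢0 | _      | _      = []-false (ℤ.∣ S a b c ∣ ℕ.≟ r ℕ.* r) (λ eq → a≢0 (proj₁ (only (trans eq (sym q≡r²)))))
        ... | yes _  | no b≢0 | _      = []-false (ℤ.∣ S a b c ∣ ℕ.≟ r ℕ.* r) (λ eq → b≢0 (proj₁ (proj₂ (only (trans eq (sym q≡r²))))))
        ... | yes _  | yes _  | no c≢0 = []-false (ℤ.∣ S a b c ∣ ℕ.≟ r ℕ.* r) (λ eq → c≢0 (proj₂ (proj₂ (only (trans eq (sym q≡r²))))))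

    even-power : ∀ k i → i ℤ.^ (2 ℕ.* k) ≡ (+ ℤ.∣ i ∣) ℤ.^ (2 ℕ.* k)
    even-power k i = begin
      i ℤ.^ (2 ℕ.* k)              ≡⟨ ℤ.^-*-assoc i 2 k ⟨
      (i ℤ.^ 2) ℤ.^ k              ≡⟨ cong (ℤ._^ k) (square i) ⟩
      ((+ ℤ.∣ i ∣) ℤ.^ 2) ℤ.^ k    ≡⟨ ℤ.^-*-assoc (+ ℤ.∣ i ∣) 2 k ⟩
      (+ ℤ.∣ i ∣) ℤ.^ (2 ℕ.* k)    ∎
      where
      square : ∀ i → i ℤ.^ 2 ≡ (+ ℤ.∣ i ∣) ℤ.^ 2
      square (+ n)      = refl
      square ℤ.-[1+ n ] = trans (cong (λ t → ℤ.-[1+ n ] ℤ.* t) (ℤ.*-identityʳ ℤ.-[1+ n ]))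
        (sym (cong (λ t → + suc n ℤ.* t) (ℤ.*-identityʳ (+ suc n))))

    Q : ℤ
    Q = + r ℤ.* + r

    +q≡Q : + q ≡ Q
    +q≡Q = trans (cong +_ q≡r²) (ℤ.pos-* r r)

    moment-by-value : ∀ k → moment (2 ℕ.* k) ≡ sum (λ j → count j ℤ.* (+ multiple j ℤ.* + r) ℤ.^ (2 ℕ.* k))
    moment-by-value k = begin
      moment (2 ℕ.* k)                                                  ≡⟨ ∑³-cong (λ a b c → even-power k (S a b c)) ⟩
      ∑³ (λ a b c → (+ ℤ.∣ S a b c ∣) ℤ.^ (2 ℕ.* k))                    ≡⟨ ∑³-by-value (λ n → (+ n) ℤ.^ (2 ℕ.* k)) ⟩
      sum (λ j → count j ℤ.* (+ value j) ℤ.^ (2 ℕ.* k))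
        ≡⟨ sum-cong-≗ {5} (λ j → cong (λ t → count j ℤ.* t ℤ.^ (2 ℕ.* k)) (ℤ.pos-* (multiple j) r)) ⟩
      sum (λ j → count j ℤ.* (+ multiple j ℤ.* + r) ℤ.^ (2 ℕ.* k))      ∎

    instance
      Q-nonZero : ℤ.NonZero Q
      Q-nonZero = ℤ.i*j≢0 (+ r) (+ r)

    -- The linear system for the four unknown frequencies.

    module _ where
      open ℤ.+-*-Solver

      private
        b₀ b₁ b₂ b₃ : ℤ
        b₀ = count 0F
        b₁ = count 1F
        b₂ = count 2F
        b₃ = count 3F

      -- In this and the next three equations the contribution of the zero triple, with S = q, is
      -- subtracted from the moment of order 2k, and the rest is divided by Q^k = r^(2k).
      power-sum₀ : b₀ ℤ.+ b₁ ℤ.+ b₂ ℤ.+ b₃ ≡ Q ℤ.* Q ℤ.* Q ℤ.- 1ℤ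
      power-sum₀ = begin
        b₀ ℤ.+ b₁ ℤ.+ b₂ ℤ.+ b₃
          ≡⟨ solve 6 (λ r b₀ b₁ b₂ b₃ b₄ → b₀ :+ b₁ :+ b₂ :+ b₃
               := (b₀ :* (con 0ℤ :* r) :^ 0 :+ (b₁ :* (con 1ℤ :* r) :^ 0 :+ (b₂ :* (con (+ 2) :* r) :^ 0
                   :+ (b₃ :* (con (+ 4) :* r) :^ 0 :+ (b₄ :* (r :* r) :^ 0 :+ con 0ℤ)))))
                  :- b₄) refl (+ r) b₀ b₁ b₂ b₃ (count 4F) ⟩
        sum (λ j → count j ℤ.* (+ multiple j ℤ.* + r) ℤ.^ 0) ℤ.- count 4F
          ≡⟨ cong₂ ℤ._-_ (trans (sym (moment-by-value 0)) moment₀) count₄ ⟩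
        q³ ℤ.- 1ℤ                          ≡⟨ cong (λ t → t ℤ.* t ℤ.* t ℤ.- 1ℤ) +q≡Q ⟩
        Q ℤ.* Q ℤ.* Q ℤ.- 1ℤ               ∎
        where
        moment₀ : moment 0 ≡ q³
        moment₀ = trans (∑³-product (λ _ → 1ℤ) (λ _ → 1ℤ) (λ _ → 1ℤ))
          (cong (λ t → t ℤ.* t ℤ.* t) (trans (sum-const q 1ℤ) (ℤ.*-identityʳ (+ q))))

      power-sum₂ : b₁ ℤ.+ + 4 ℤ.* b₂ ℤ.+ + 16 ℤ.* b₃ ≡ Q ℤ.* Q ℤ.* Q ℤ.- Q
      power-sum₂ = ℤ.*-cancelˡ-≡ Q _ _ (begin
        Q ℤ.* (b₁ ℤ.+ + 4 ℤ.* b₂ ℤ.+ + 16 ℤ.* b₃)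
          ≡⟨ solve 6 (λ r b₀ b₁ b₂ b₃ b₄ → let Q = r :* r in
               Q :* (b₁ :+ con (+ 4) :* b₂ :+ con (+ 16) :* b₃)
               := (b₀ :* (con 0ℤ :* r) :^ 2 :+ (b₁ :* (con 1ℤ :* r) :^ 2 :+ (b₂ :* (con (+ 2) :* r) :^ 2
                   :+ (b₃ :* (con (+ 4) :* r) :^ 2 :+ (b₄ :* (r :* r) :^ 2 :+ con 0ℤ)))))
                  :- b₄ :* Q :* Q) refl (+ r) b₀ b₁ b₂ b₃ (count 4F) ⟩
        sum (λ j → count j ℤ.* (+ multiple j ℤ.* + r) ℤ.^ 2) ℤ.- count 4F ℤ.* Q ℤ.* Q
          ≡⟨ cong₂ (λ t b → t ℤ.- b ℤ.* Q ℤ.* Q) (trans (sym (moment-by-value 1)) moment₂) count₄ ⟩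
        q³ ℤ.* + q ℤ.- 1ℤ ℤ.* Q ℤ.* Q
          ≡⟨ cong (λ t → t ℤ.* t ℤ.* t ℤ.* t ℤ.- 1ℤ ℤ.* Q ℤ.* Q) +q≡Q ⟩
        Q ℤ.* Q ℤ.* Q ℤ.* Q ℤ.- 1ℤ ℤ.* Q ℤ.* Q
          ≡⟨ solve 1 (λ Q → Q :* Q :* Q :* Q :- con 1ℤ :* Q :* Q := Q :* (Q :* Q :* Q :- Q)) refl Q ⟩
        Q ℤ.* (Q ℤ.* Q ℤ.* Q ℤ.- Q)  ∎)

      power-sum₄ : b₁ ℤ.+ + 16 ℤ.* b₂ ℤ.+ + 256 ℤ.* b₃ ≡ + 3 ℤ.* Q ℤ.* Q ℤ.* Q ℤ.- + 3 ℤ.* Q ℤ.* Q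
      power-sum₄ = ℤ.*-cancelˡ-≡ Q _ _ (ℤ.*-cancelˡ-≡ Q _ _ (begin
        Q ℤ.* (Q ℤ.* (b₁ ℤ.+ + 16 ℤ.* b₂ ℤ.+ + 256 ℤ.* b₃))
          ≡⟨ solve 6 (λ r b₀ b₁ b₂ b₃ b₄ → let Q = r :* r in
               Q :* (Q :* (b₁ :+ con (+ 16) :* b₂ :+ con (+ 256) :* b₃))
               := (b₀ :* (con 0ℤ :* r) :^ 4 :+ (b₁ :* (con 1ℤ :* r) :^ 4 :+ (b₂ :* (con (+ 2) :* r) :^ 4
                   :+ (b₃ :* (con (+ 4) :* r) :^ 4 :+ (b₄ :* (r :* r) :^ 4 :+ con 0ℤ)))))
                  :- b₄ :* Q :* Q :* Q :* Q) refl (+ r) b₀ b₁ b₂ b₃ (count 4F) ⟩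
        sum (λ j → count j ℤ.* (+ multiple j ℤ.* + r) ℤ.^ 4) ℤ.- count 4F ℤ.* Q ℤ.* Q ℤ.* Q ℤ.* Q
          ≡⟨ cong₂ (λ t b → t ℤ.- b ℤ.* Q ℤ.* Q ℤ.* Q ℤ.* Q) (trans (sym (moment-by-value 2)) moment₄) count₄ ⟩
        q³ ℤ.* (+ 3 ℤ.* + q ℤ.* + q ℤ.- + 2 ℤ.* + q) ℤ.- 1ℤ ℤ.* Q ℤ.* Q ℤ.* Q ℤ.* Q
          ≡⟨ cong (λ t → t ℤ.* t ℤ.* t ℤ.* (+ 3 ℤ.* t ℤ.* t ℤ.- + 2 ℤ.* t) ℤ.- 1ℤ ℤ.* Q ℤ.* Q ℤ.* Q ℤ.* Q) +q≡Q ⟩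
        Q ℤ.* Q ℤ.* Q ℤ.* (+ 3 ℤ.* Q ℤ.* Q ℤ.- + 2 ℤ.* Q) ℤ.- 1ℤ ℤ.* Q ℤ.* Q ℤ.* Q ℤ.* Q
          ≡⟨ solve 1 (λ Q → Q :* Q :* Q :* (con (+ 3) :* Q :* Q :- con (+ 2) :* Q) :- con 1ℤ :* Q :* Q :* Q :* Q
               := Q :* (Q :* (con (+ 3) :* Q :* Q :* Q :- con (+ 3) :* Q :* Q))) refl Q ⟩
        Q ℤ.* (Q ℤ.* (+ 3 ℤ.* Q ℤ.* Q ℤ.* Q ℤ.- + 3 ℤ.* Q ℤ.* Q))  ∎))

      power-sum₆ : b₁ ℤ.+ + 64 ℤ.* b₂ ℤ.+ + 4096 ℤ.* b₃ ≡ + 14 ℤ.* Q ℤ.* Q ℤ.* Q ℤ.- + 30 ℤ.* Q ℤ.* Q ℤ.+ + 16 ℤ.* Q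
      power-sum₆ = ℤ.*-cancelˡ-≡ Q _ _ (ℤ.*-cancelˡ-≡ Q _ _ (ℤ.*-cancelˡ-≡ Q _ _ (begin
        Q ℤ.* (Q ℤ.* (Q ℤ.* (b₁ ℤ.+ + 64 ℤ.* b₂ ℤ.+ + 4096 ℤ.* b₃)))
          ≡⟨ solve 6 (λ r b₀ b₁ b₂ b₃ b₄ → let Q = r :* r in
               Q :* (Q :* (Q :* (b₁ :+ con (+ 64) :* b₂ :+ con (+ 4096) :* b₃)))
               := (b₀ :* (con 0ℤ :* r) :^ 6 :+ (b₁ :* (con 1ℤ :* r) :^ 6 :+ (b₂ :* (con (+ 2) :* r) :^ 6
                   :+ (b₃ :* (con (+ 4) :* r) :^ 6 :+ (b₄ :* (r :* r) :^ 6 :+ con 0ℤ)))))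
                  :- b₄ :* Q :* Q :* Q :* Q :* Q :* Q) refl (+ r) b₀ b₁ b₂ b₃ (count 4F) ⟩
        sum (λ j → count j ℤ.* (+ multiple j ℤ.* + r) ℤ.^ 6) ℤ.- count 4F ℤ.* Q ℤ.* Q ℤ.* Q ℤ.* Q ℤ.* Q ℤ.* Q
          ≡⟨ cong₂ (λ t b → t ℤ.- b ℤ.* Q ℤ.* Q ℤ.* Q ℤ.* Q ℤ.* Q ℤ.* Q) (trans (sym (moment-by-value 3)) moment₆) count₄ ⟩
        q³ ℤ.* (+ 15 ℤ.* + q ℤ.* + q ℤ.* + q ℤ.- + 30 ℤ.* + q ℤ.* + q ℤ.+ + 16 ℤ.* + q) ℤ.- 1ℤ ℤ.* Q ℤ.* Q ℤ.* Q ℤ.* Q ℤ.* Q ℤ.* Q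
          ≡⟨ cong (λ t → t ℤ.* t ℤ.* t ℤ.* (+ 15 ℤ.* t ℤ.* t ℤ.* t ℤ.- + 30 ℤ.* t ℤ.* t ℤ.+ + 16 ℤ.* t) ℤ.- 1ℤ ℤ.* Q ℤ.* Q ℤ.* Q ℤ.* Q ℤ.* Q ℤ.* Q) +q≡Q ⟩
        Q ℤ.* Q ℤ.* Q ℤ.* (+ 15 ℤ.* Q ℤ.* Q ℤ.* Q ℤ.- + 30 ℤ.* Q ℤ.* Q ℤ.+ + 16 ℤ.* Q) ℤ.- 1ℤ ℤ.* Q ℤ.* Q ℤ.* Q ℤ.* Q ℤ.* Q ℤ.* Q
          ≡⟨ solve 1 (λ Q → Q :* Q :* Q :* (con (+ 15) :* Q :* Q :* Q :- con (+ 30) :* Q :* Q :+ con (+ 16) :* Q) :- con 1ℤ :* Q :* Q :* Q :* Q :* Q :* Q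
               := Q :* (Q :* (Q :* (con (+ 14) :* Q :* Q :* Q :- con (+ 30) :* Q :* Q :+ con (+ 16) :* Q)))) refl Q ⟩
        Q ℤ.* (Q ℤ.* (Q ℤ.* (+ 14 ℤ.* Q ℤ.* Q ℤ.* Q ℤ.- + 30 ℤ.* Q ℤ.* Q ℤ.+ + 16 ℤ.* Q)))  ∎)))

      -- With u = (∣S∣ / r)², the combination of the orders 6, 4 and 2 with coefficients 1, -5 and 4
      -- gives u the weight u (u - 1) (u - 4). This vanishes at u = 0, 1 and 4 and is 16 · 15 · 12 =
      -- 3 · 960 at u = 16.
      count₃ : + 960 ℤ.* b₃ ≡ Q ℤ.* Q ℤ.* Q ℤ.- + 5 ℤ.* Q ℤ.* Q ℤ.+ + 4 ℤ.* Q
      count₃ = ℤ.*-cancelˡ-≡ (+ 3) _ _ (begin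
        + 3 ℤ.* (+ 960 ℤ.* b₃)
          ≡⟨ solve 3 (λ b₁ b₂ b₃ → con (+ 3) :* (con (+ 960) :* b₃)
               := (b₁ :+ con (+ 64) :* b₂ :+ con (+ 4096) :* b₃) :- con (+ 5) :* (b₁ :+ con (+ 16) :* b₂ :+ con (+ 256) :* b₃)
                  :+ con (+ 4) :* (b₁ :+ con (+ 4) :* b₂ :+ con (+ 16) :* b₃)) refl b₁ b₂ b₃ ⟩
        (b₁ ℤ.+ + 64 ℤ.* b₂ ℤ.+ + 4096 ℤ.* b₃) ℤ.- + 5 ℤ.* (b₁ ℤ.+ + 16 ℤ.* b₂ ℤ.+ + 256 ℤ.* b₃)
          ℤ.+ + 4 ℤ.* (b₁ ℤ.+ + 4 ℤ.* b₂ ℤ.+ + 16 ℤ.* b₃)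
          ≡⟨ cong₂ (λ s t → s ℤ.+ + 4 ℤ.* t) (cong₂ (λ s t → s ℤ.- + 5 ℤ.* t) power-sum₆ power-sum₄) power-sum₂ ⟩
        (+ 14 ℤ.* Q ℤ.* Q ℤ.* Q ℤ.- + 30 ℤ.* Q ℤ.* Q ℤ.+ + 16 ℤ.* Q) ℤ.- + 5 ℤ.* (+ 3 ℤ.* Q ℤ.* Q ℤ.* Q ℤ.- + 3 ℤ.* Q ℤ.* Q)
          ℤ.+ + 4 ℤ.* (Q ℤ.* Q ℤ.* Q ℤ.- Q)
          ≡⟨ solve 1 (λ Q → (con (+ 14) :* Q :* Q :* Q :- con (+ 30) :* Q :* Q :+ con (+ 16) :* Q)
                 :- con (+ 5) :* (con (+ 3) :* Q :* Q :* Q :- con (+ 3) :* Q :* Q) :+ con (+ 4) :* (Q :* Q :* Q :- Q)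
               := con (+ 3) :* (Q :* Q :* Q :- con (+ 5) :* Q :* Q :+ con (+ 4) :* Q)) refl Q ⟩
        + 3 ℤ.* (Q ℤ.* Q ℤ.* Q ℤ.- + 5 ℤ.* Q ℤ.* Q ℤ.+ + 4 ℤ.* Q)  ∎)

      -- The orders 4 and 2 differ by the weight u (u - 1), which leaves 12 b₂ + 240 b₃. The factor
      -- 4 turns the last term into the known 960 b₃.
      count₂ : + 48 ℤ.* b₂ ≡ + 7 ℤ.* Q ℤ.* Q ℤ.* Q ℤ.- + 7 ℤ.* Q ℤ.* Q
      count₂ = begin
        + 48 ℤ.* b₂
          ≡⟨ solve 3 (λ b₁ b₂ b₃ → con (+ 48) :* b₂
               := con (+ 4) :* ((b₁ :+ con (+ 16) :* b₂ :+ con (+ 256) :* b₃) :- (b₁ :+ con (+ 4) :* b₂ :+ con (+ 16) :* b₃))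
                  :- con (+ 960) :* b₃) refl b₁ b₂ b₃ ⟩
        + 4 ℤ.* ((b₁ ℤ.+ + 16 ℤ.* b₂ ℤ.+ + 256 ℤ.* b₃) ℤ.- (b₁ ℤ.+ + 4 ℤ.* b₂ ℤ.+ + 16 ℤ.* b₃)) ℤ.- + 960 ℤ.* b₃
          ≡⟨ cong₂ (λ s t → + 4 ℤ.* s ℤ.- t) (cong₂ ℤ._-_ power-sum₄ power-sum₂) count₃ ⟩
        + 4 ℤ.* ((+ 3 ℤ.* Q ℤ.* Q ℤ.* Q ℤ.- + 3 ℤ.* Q ℤ.* Q) ℤ.- (Q ℤ.* Q ℤ.* Q ℤ.- Q))
          ℤ.- (Q ℤ.* Q ℤ.* Q ℤ.- + 5 ℤ.* Q ℤ.* Q ℤ.+ + 4 ℤ.* Q)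
          ≡⟨ solve 1 (λ Q → con (+ 4) :* ((con (+ 3) :* Q :* Q :* Q :- con (+ 3) :* Q :* Q) :- (Q :* Q :* Q :- Q))
                 :- (Q :* Q :* Q :- con (+ 5) :* Q :* Q :+ con (+ 4) :* Q)
               := con (+ 7) :* Q :* Q :* Q :- con (+ 7) :* Q :* Q) refl Q ⟩
        + 7 ℤ.* Q ℤ.* Q ℤ.* Q ℤ.- + 7 ℤ.* Q ℤ.* Q  ∎

      count₁ : + 15 ℤ.* b₁ ≡ + 6 ℤ.* Q ℤ.* Q ℤ.* Q ℤ.+ + 10 ℤ.* Q ℤ.* Q ℤ.- + 16 ℤ.* Q
      count₁ = ℤ.*-cancelˡ-≡ (+ 4) _ _ (begin
        + 4 ℤ.* (+ 15 ℤ.* b₁)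
          ≡⟨ solve 3 (λ b₁ b₂ b₃ → con (+ 4) :* (con (+ 15) :* b₁)
               := con (+ 60) :* (b₁ :+ con (+ 4) :* b₂ :+ con (+ 16) :* b₃) :- con (+ 5) :* (con (+ 48) :* b₂)
                  :- con (+ 960) :* b₃) refl b₁ b₂ b₃ ⟩
        + 60 ℤ.* (b₁ ℤ.+ + 4 ℤ.* b₂ ℤ.+ + 16 ℤ.* b₃) ℤ.- + 5 ℤ.* (+ 48 ℤ.* b₂) ℤ.- + 960 ℤ.* b₃
          ≡⟨ cong₂ ℤ._-_ (cong₂ (λ s t → + 60 ℤ.* s ℤ.- + 5 ℤ.* t) power-sum₂ count₂) count₃ ⟩
        + 60 ℤ.* (Q ℤ.* Q ℤ.* Q ℤ.- Q) ℤ.- + 5 ℤ.* (+ 7 ℤ.* Q ℤ.* Q ℤ.* Q ℤ.- + 7 ℤ.* Q ℤ.* Q)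
          ℤ.- (Q ℤ.* Q ℤ.* Q ℤ.- + 5 ℤ.* Q ℤ.* Q ℤ.+ + 4 ℤ.* Q)
          ≡⟨ solve 1 (λ Q → con (+ 60) :* (Q :* Q :* Q :- Q) :- con (+ 5) :* (con (+ 7) :* Q :* Q :* Q :- con (+ 7) :* Q :* Q)
                 :- (Q :* Q :* Q :- con (+ 5) :* Q :* Q :+ con (+ 4) :* Q)
               := con (+ 4) :* (con (+ 6) :* Q :* Q :* Q :+ con (+ 10) :* Q :* Q :- con (+ 16) :* Q)) refl Q ⟩
        + 4 ℤ.* (+ 6 ℤ.* Q ℤ.* Q ℤ.* Q ℤ.+ + 10 ℤ.* Q ℤ.* Q ℤ.- + 16 ℤ.* Q)  ∎)

      count₀ : + 64 ℤ.* b₀ ≡ + 29 ℤ.* Q ℤ.* Q ℤ.* Q ℤ.- + 33 ℤ.* Q ℤ.* Q ℤ.+ + 68 ℤ.* Q ℤ.- + 64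
      count₀ = ℤ.*-cancelˡ-≡ (+ 15) _ _ (begin
        + 15 ℤ.* (+ 64 ℤ.* b₀)
          ≡⟨ solve 4 (λ b₀ b₁ b₂ b₃ → con (+ 15) :* (con (+ 64) :* b₀)
               := con (+ 960) :* (b₀ :+ b₁ :+ b₂ :+ b₃) :- con (+ 64) :* (con (+ 15) :* b₁)
                  :- con (+ 20) :* (con (+ 48) :* b₂) :- con (+ 960) :* b₃) refl b₀ b₁ b₂ b₃ ⟩
        + 960 ℤ.* (b₀ ℤ.+ b₁ ℤ.+ b₂ ℤ.+ b₃) ℤ.- + 64 ℤ.* (+ 15 ℤ.* b₁) ℤ.- + 20 ℤ.* (+ 48 ℤ.* b₂) ℤ.- + 960 ℤ.* b₃
          ≡⟨ cong₂ ℤ._-_ (cong₂ (λ s t → s ℤ.- + 20 ℤ.* t) (cong₂ (λ s t → + 960 ℤ.* s ℤ.- + 64 ℤ.* t) power-sum₀ count₁) count₂) count₃ ⟩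
        + 960 ℤ.* (Q ℤ.* Q ℤ.* Q ℤ.- 1ℤ) ℤ.- + 64 ℤ.* (+ 6 ℤ.* Q ℤ.* Q ℤ.* Q ℤ.+ + 10 ℤ.* Q ℤ.* Q ℤ.- + 16 ℤ.* Q)
          ℤ.- + 20 ℤ.* (+ 7 ℤ.* Q ℤ.* Q ℤ.* Q ℤ.- + 7 ℤ.* Q ℤ.* Q) ℤ.- (Q ℤ.* Q ℤ.* Q ℤ.- + 5 ℤ.* Q ℤ.* Q ℤ.+ + 4 ℤ.* Q)
          ≡⟨ solve 1 (λ Q → con (+ 960) :* (Q :* Q :* Q :- con 1ℤ) :- con (+ 64) :* (con (+ 6) :* Q :* Q :* Q :+ con (+ 10) :* Q :* Q :- con (+ 16) :* Q)
                 :- con (+ 20) :* (con (+ 7) :* Q :* Q :* Q :- con (+ 7) :* Q :* Q) :- (Q :* Q :* Q :- con (+ 5) :* Q :* Q :+ con (+ 4) :* Q)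
               := con (+ 15) :* (con (+ 29) :* Q :* Q :* Q :- con (+ 33) :* Q :* Q :+ con (+ 68) :* Q :- con (+ 64))) refl Q ⟩
        + 15 ℤ.* (+ 29 ℤ.* Q ℤ.* Q ℤ.* Q ℤ.- + 33 ℤ.* Q ℤ.* Q ℤ.+ + 68 ℤ.* Q ℤ.- + 64)  ∎)

    -- Enumeration of the codewords and of those of a given weight.

    listSum : ∀ {a} {A : Set a} → (A → ℤ) → List A → ℤ
    listSum f []       = 0ℤ
    listSum f (x ∷ xs) = f x ℤ.+ listSum f xs

    module _ {a b} {A : Set a} {B : Set b} where

      listSum-++ : ∀ (f : A → ℤ) xs ys → listSum f (xs ++ ys) ≡ listSum f xs ℤ.+ listSum f ys
      listSum-++ f []       ys = sym (ℤ.+-identityˡ _)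
      listSum-++ f (x ∷ xs) ys = trans (cong (λ t → f x ℤ.+ t) (listSum-++ f xs ys)) (sym (ℤ.+-assoc (f x) _ _))

      listSum-map : ∀ (f : B → ℤ) (g : A → B) xs → listSum f (List.map g xs) ≡ listSum (f ∘ g) xs
      listSum-map f g []       = refl
      listSum-map f g (x ∷ xs) = cong (λ t → f (g x) ℤ.+ t) (listSum-map f g xs)

    listSum-cartesianProduct : ∀ {a b} {A : Set a} {B : Set b} (f : A × B → ℤ) xs ys →
      listSum f (List.cartesianProduct xs ys) ≡ listSum (λ x → listSum (λ y → f (x , y)) ys) xs
    listSum-cartesianProduct f []       ys = refl
    listSum-cartesianProduct {A = A} {B} f (x ∷ xs) ys = trans
      (listSum-++ {B = B} f (List.map (x ,_) ys) (List.cartesianProduct xs ys))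
      (cong₂ ℤ._+_ (listSum-map f (x ,_) ys) (listSum-cartesianProduct f xs ys))

    listSum-tabulate : ∀ {a} {A : Set a} {n} (f : A → ℤ) (g : Fin n → A) → listSum f (List.tabulate g) ≡ sum (f ∘ g)
    listSum-tabulate {n = zero}  f g = refl
    listSum-tabulate {n = suc n} f g = cong (λ t → f (g zero) ℤ.+ t) (listSum-tabulate f (g ∘ suc))

    length-filter≡listSum : ∀ {a p} {A : Set a} {P : A → Set p} (P? : ∀ x → Dec (P x)) xs →
      + List.length (List.filter P? xs) ≡ listSum (λ x → [ does (P? x) ]) xs
    length-filter≡listSum P? []       = refl
    length-filter≡listSum P? (x ∷ xs) with P? x
    ... | yes _ = cong (λ t → 1ℤ ℤ.+ t) (length-filter≡listSum P? xs)
    ... | no _  = trans (length-filter≡listSum P? xs) (sym (ℤ.+-identityˡ _))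

    length≡listSum : ∀ {a} {A : Set a} (xs : List A) → + List.length xs ≡ listSum (λ _ → 1ℤ) xs
    length≡listSum []       = refl
    length≡listSum (x ∷ xs) = cong (λ t → 1ℤ ℤ.+ t) (length≡listSum xs)

    sum-σ : ∀ {n} (w : Word n) → sum (λ i → σ (Vec.lookup w i)) ≡ + n ℤ.- + 2 ℤ.* + weight w
    sum-σ []          = refl
    sum-σ {suc n} (true ∷ w)  = trans (cong (λ t → -1ℤ ℤ.+ t) (sum-σ w))
      (ℤ.+-*-Solver.solve 2 (λ n w → con -1ℤ :+ (n :- con (+ 2) :* w) := con 1ℤ :+ n :- con (+ 2) :* (con 1ℤ :+ w)) refl (+ n) (+ weight w))
      where
      open ℤ.+-*-Solver
    sum-σ {suc n} (false ∷ w) = trans (cong (λ t → 1ℤ ℤ.+ t) (sum-σ w))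
      (ℤ.+-*-Solver.solve 2 (λ n w → con 1ℤ :+ (n :- con (+ 2) :* w) := con 1ℤ :+ n :- con (+ 2) :* w) refl (+ n) (+ weight w))
      where
      open ℤ.+-*-Solver

    Coefficients : Set
    Coefficients = 𝔽 × 𝔽 × 𝔽 × Bool

    entry : Coefficients → 𝔽 → Bool
    entry (a , b , c , h) x = tr (form a b c x) xor h

    word : Coefficients → Word q
    word t = Vec.tabulate (entry t)

    lookup-word : ∀ t x → Vec.lookup (word t) x ≡ entry t x
    lookup-word t = Vec.lookup∘tabulate (entry t)

    word-ext : ∀ {w} t → (∀ x → Vec.lookup w x ≡ entry t x) → w ≡ word t
    word-ext {w} t eq = trans (sym (Vec.tabulate∘lookup w)) (Vec.tabulate-cong eq)

    signedS : Coefficients → ℤ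
    signedS (a , b , c , h) = S a b c ℤ.* σ h

    signedS≡ : ∀ t → signedS t ≡ + q ℤ.- + 2 ℤ.* + weight (word t)
    signedS≡ t@(a , b , c , h) = begin
      S a b c ℤ.* σ h                                ≡⟨ *-distribʳ-sum {q} (σ h) _ ⟩
      sum (λ x → χ (form a b c x) ℤ.* σ h)
        ≡⟨ sum-cong-≗ {q} (λ x → sym (trans (cong σ (lookup-word t x)) (σ-xor (tr (form a b c x)) h))) ⟩
      sum (λ x → σ (Vec.lookup (word t) x))          ≡⟨ sum-σ (word t) ⟩
      + q ℤ.- + 2 ℤ.* + weight (word t)              ∎

    form-0 : ∀ a b c → form a b c 0# ≡ 0#
    form-0 = Char2.solve 3 (λ a b c → a :* con false :^ 5 :+ b :* con false :^ 3 :+ c :* con false := con false) refl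
      where
      open Char2

    form-+ : ∀ a b c a′ b′ c′ x → form (a ⊞ a′) (b ⊞ b′) (c ⊞ c′) x ≡ form a b c x ⊞ form a′ b′ c′ x
    form-+ a b c a′ b′ c′ x = Char2.solve 9 (λ a b c a′ b′ c′ x₅ x₃ x → (a :+ a′) :* x₅ :+ (b :+ b′) :* x₃ :+ (c :+ c′) :* x
      := (a :* x₅ :+ b :* x₃ :+ c :* x) :+ (a′ :* x₅ :+ b′ :* x₃ :+ c′ :* x)) refl a b c a′ b′ c′ (x ^ 5) (x ^ 3) x
      where
      open Char2

    xor-interchange : ∀ s t u v → (s xor t) xor (u xor v) ≡ (s xor u) xor (t xor v)
    xor-interchange false t u     v = trans (sym (Bool.xor-assoc t u v)) (trans (cong (_xor v) (Bool.xor-comm t u)) (Bool.xor-assoc u t v))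
    xor-interchange true  t false v = sym (Bool.not-distribˡ-xor t v)
    xor-interchange true  t true  v = trans (sym (Bool.not-distribˡ-xor t (not v))) (trans (cong not (sym (Bool.not-distribʳ-xor t v))) (Bool.not-involutive _))

    _⊹_ : Coefficients → Coefficients → Coefficients
    (a , b , c , h) ⊹ (a′ , b′ , c′ , h′) = a ⊞ a′ , b ⊞ b′ , c ⊞ c′ , h xor h′

    entry-⊹ : ∀ t t′ x → entry (t ⊹ t′) x ≡ entry t x xor entry t′ x
    entry-⊹ (a , b , c , h) (a′ , b′ , c′ , h′) x = trans
      (cong (_xor (h xor h′)) (trans (cong tr (form-+ a b c a′ b′ c′ x)) (tr-+ (form a b c x) (form a′ b′ c′ x))))
      (xor-interchange (tr (form a b c x)) (tr (form a′ b′ c′ x)) h h′)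

    -- The form vanishes at x = 0, so the entry there is h, which must be `false`. All signs are
    -- then 1 and S = q, which only the zero triple attains.
    entry-constant : ∀ t → (∀ x → entry t x ≡ false) → t ≡ (0# , 0# , 0# , false)
    entry-constant (a , b , c , h) entry≡false with h≡false ← trans (cong (_xor h) (sym (trans (cong tr (form-0 a b c)) tr-0))) (entry≡false 0#)
      with refl ← h≡false
      with refl , refl , refl ← ∣S∣≡q⇒zero a b c (cong ℤ.∣_∣ (trans
             (sum-cong-≗ {q} λ x → cong σ (trans (sym (Bool.xor-identityʳ _)) (entry≡false x)))
             (trans (sum-const q 1ℤ) (ℤ.*-identityʳ (+ q)))))
      = refl

    word-injective : ∀ {t t′} → word t ≡ word t′ → t ≡ t′
    word-injective {t@(a , b , c , h)} {t′@(a′ , b′ , c′ , h′)} eq = combine (entry-constant (t ⊹ t′) λ x → begin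
      entry (t ⊹ t′) x                                            ≡⟨ entry-⊹ t t′ x ⟩
      entry t x xor entry t′ x                                    ≡⟨ cong₂ _xor_ (lookup-word t x) (lookup-word t′ x) ⟨
      Vec.lookup (word t) x xor Vec.lookup (word t′) x            ≡⟨ cong (λ w → Vec.lookup (word t) x xor Vec.lookup w x) (sym eq) ⟩
      Vec.lookup (word t) x xor Vec.lookup (word t) x             ≡⟨ Bool.xor-same (Vec.lookup (word t) x) ⟩
      false                                                       ∎)
      where
      xor≡false : ∀ h h′ → h xor h′ ≡ false → h ≡ h′
      xor≡false true  true  eq = refl
      xor≡false false false eq = refl
      combine : t ⊹ t′ ≡ (0# , 0# , 0# , false) → t ≡ t′
      combine eq = cong₂ _,_ (x+y≡0⇒x≡y (cong proj₁ eq)) (cong₂ _,_ (x+y≡0⇒x≡y (cong (proj₁ ∘ proj₂) eq))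
        (cong₂ _,_ (x+y≡0⇒x≡y (cong (proj₁ ∘ proj₂ ∘ proj₂) eq)) (xor≡false h h′ (cong (proj₂ ∘ proj₂ ∘ proj₂) eq))))

    allCoefficients : List Coefficients
    allCoefficients = List.cartesianProduct 𝔽s (List.cartesianProduct 𝔽s (List.cartesianProduct 𝔽s (false ∷ true ∷ [])))
      where 𝔽s = List.allFin q

    allCoefficients-complete : ∀ t → t ∈ allCoefficients
    allCoefficients-complete (a , b , c , h) = ∈-cartesianProduct⁺ (∈-allFin a)
      (∈-cartesianProduct⁺ (∈-allFin b) (∈-cartesianProduct⁺ (∈-allFin c) (bit h)))
      where
      bit : ∀ b → b ∈ false ∷ true ∷ []
      bit false = here refl
      bit true  = there (here refl)

    allCoefficients-unique : Unique allCoefficients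
    allCoefficients-unique = Unique.cartesianProduct⁺ 𝔽s! (Unique.cartesianProduct⁺ 𝔽s!
      (Unique.cartesianProduct⁺ 𝔽s! (((λ ()) ∷ []) ∷ [] ∷ [])))
      where 𝔽s! = Unique.allFin⁺ q

    listSum-allCoefficients : ∀ f → listSum f allCoefficients ≡ ∑³ (λ a b c → f (a , b , c , false) ℤ.+ f (a , b , c , true))
    listSum-allCoefficients f = trans (level _ _) (sum-cong-≗ {q} λ a → trans (level _ _) (sum-cong-≗ {q} λ b →
      trans (level _ _) (sum-cong-≗ {q} λ c → cong (λ t → f (a , b , c , false) ℤ.+ t) (ℤ.+-identityʳ _))))
      where
      level : ∀ {B : Set} (f : 𝔽 × B → ℤ) (ys : List B) →
        listSum f (List.cartesianProduct (List.allFin q) ys) ≡ sum (λ x → listSum (λ y → f (x , y)) ys)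
      level f ys = trans (listSum-cartesianProduct f (List.allFin q) ys) (listSum-tabulate {n = q} (λ x → listSum (λ y → f (x , y)) ys) id)

    codewords : List (Word q)
    codewords = List.map word allCoefficients

    codewords-unique : Unique codewords
    codewords-unique = Unique.map⁺ word-injective allCoefficients-unique

    length-codewords : List.length codewords ≡ 2 ℕ.^ (3 ℕ.* m ℕ.+ 1)
    length-codewords = ℤ.+-injective (begin
      + List.length codewords                        ≡⟨ cong +_ (List.length-map word allCoefficients) ⟩
      + List.length allCoefficients                  ≡⟨ length≡listSum allCoefficients ⟩
      listSum (λ _ → 1ℤ) allCoefficients             ≡⟨ listSum-allCoefficients (λ _ → 1ℤ) ⟩
      ∑³ (λ _ _ _ → + 2 ℤ.* 1ℤ)
        ≡⟨ trans (∑³-*ˡ (+ 2) (λ _ _ _ → 1ℤ)) (cong (λ t → + 2 ℤ.* t) (∑³-product (λ _ → 1ℤ) (λ _ → 1ℤ) (λ _ → 1ℤ))) ⟩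
      + 2 ℤ.* (sum {q} (λ _ → 1ℤ) ℤ.* sum {q} (λ _ → 1ℤ) ℤ.* sum {q} (λ _ → 1ℤ))
        ≡⟨ cong (λ t → + 2 ℤ.* (t ℤ.* t ℤ.* t)) (trans (sum-const q 1ℤ) (ℤ.*-identityʳ (+ q))) ⟩
      + 2 ℤ.* (+ q ℤ.* + q ℤ.* + q)
        ≡⟨ cong (λ t → + 2 ℤ.* t) (trans (cong (λ t → t ℤ.* + q) (sym (ℤ.pos-* q q))) (sym (ℤ.pos-* (q ℕ.* q) q))) ⟩
      + 2 ℤ.* + (q ℕ.* q ℕ.* q)                      ≡⟨ ℤ.pos-* 2 (q ℕ.* q ℕ.* q) ⟨
      + (2 ℕ.* (q ℕ.* q ℕ.* q))                      ≡⟨ cong (λ n → + (2 ℕ.* (n ℕ.* n ℕ.* n))) q≡2^m ⟩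
      + (2 ℕ.* (2 ℕ.^ m ℕ.* 2 ℕ.^ m ℕ.* 2 ℕ.^ m))    ≡⟨ cong (λ n → + (2 ℕ.* n)) cube ⟩
      + (2 ℕ.^ suc (3 ℕ.* m))                        ≡⟨ cong (λ n → + (2 ℕ.^ n)) (ℕ.+-comm 1 (3 ℕ.* m)) ⟩
      + (2 ℕ.^ (3 ℕ.* m ℕ.+ 1))                      ∎)
      where
      cube : 2 ℕ.^ m ℕ.* 2 ℕ.^ m ℕ.* 2 ℕ.^ m ≡ 2 ℕ.^ (3 ℕ.* m)
      cube = begin
        2 ℕ.^ m ℕ.* 2 ℕ.^ m ℕ.* 2 ℕ.^ m          ≡⟨ cong (ℕ._* 2 ℕ.^ m) (ℕ.^-distribˡ-+-* 2 m m) ⟨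
        2 ℕ.^ (m ℕ.+ m) ℕ.* 2 ℕ.^ m              ≡⟨ ℕ.^-distribˡ-+-* 2 (m ℕ.+ m) m ⟨
        2 ℕ.^ (m ℕ.+ m ℕ.+ m)
          ≡⟨ cong (2 ℕ.^_) (ℕ.+-*-Solver.solve 1 (λ m → m ℕ.+-*-Solver.:+ m ℕ.+-*-Solver.:+ m ℕ.+-*-Solver.:= ℕ.+-*-Solver.con 3 ℕ.+-*-Solver.:* m) refl m) ⟩
        2 ℕ.^ (3 ℕ.* m)                          ∎

    codewordsWithWeight : ℕ → List (Word q)
    codewordsWithWeight i = List.filter (λ w → weight w ℕ.≟ i) codewords

    length-codewordsWithWeight : ∀ i → + List.length (codewordsWithWeight i)
      ≡ ∑³ (λ a b c → [ does (weight (word (a , b , c , false)) ℕ.≟ i) ] ℤ.+ [ does (weight (word (a , b , c , true)) ℕ.≟ i) ])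
    length-codewordsWithWeight i = trans (length-filter≡listSum (λ w → weight w ℕ.≟ i) codewords)
      (trans (listSum-map _ word allCoefficients) (listSum-allCoefficients _))

    discrepancy : ℕ → ℤ
    discrepancy i = + q ℤ.- + 2 ℤ.* + i

    doubled : ∀ i → + 2 ℤ.* + i ≡ + q ℤ.- discrepancy i
    doubled i = solve 2 (λ q t → t := q :- (q :- t)) refl (+ q) (+ 2 ℤ.* + i)
      where
      open ℤ.+-*-Solver

    [weight≟] : ∀ t i → [ does (weight (word t) ℕ.≟ i) ] ≡ [ does (signedS t ℤ.≟ discrepancy i) ]
    [weight≟] t i = []-cong (weight (word t) ℕ.≟ i) (signedS t ℤ.≟ discrepancy i)
      (λ wt≡i → trans (signedS≡ t) (cong discrepancy wt≡i))
      (λ S≡ → discrepancy-injective (trans (sym (signedS≡ t)) S≡))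
      where
      discrepancy-injective : ∀ {i j} → discrepancy i ≡ discrepancy j → i ≡ j
      discrepancy-injective {i} {j} eq = ℤ.+-injective (ℤ.*-cancelˡ-≡ (+ 2) _ _
        (trans (doubled i) (trans (cong (λ t → + q ℤ.- t) eq) (sym (doubled j)))))

    i*1 : ∀ s → s ℤ.* 1ℤ ≡ s
    i*1 = ℤ.*-identityʳ

    i*-1 : ∀ s → s ℤ.* -1ℤ ≡ ℤ.- s
    i*-1 s = trans (ℤ.*-comm s -1ℤ) (ℤ.-1*i≡-i s)

    ∣i∣≡n⇒ : ∀ i {n} → ℤ.∣ i ∣ ≡ n → i ≡ + n ⊎ i ≡ ℤ.- (+ n)
    ∣i∣≡n⇒ (+ n)      refl = inj₁ refl
    ∣i∣≡n⇒ ℤ.-[1+ n ] refl = inj₂ refl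

    ∣i*σ∣≡∣i∣ : ∀ s h → ℤ.∣ s ℤ.* σ h ∣ ≡ ℤ.∣ s ∣
    ∣i*σ∣≡∣i∣ s false = cong ℤ.∣_∣ (i*1 s)
    ∣i*σ∣≡∣i∣ s true  = trans (cong ℤ.∣_∣ (i*-1 s)) (ℤ.∣-i∣≡∣i∣ s)

    -- For S = 0 both values of h give the weight q / 2, hence the factor 2 in the frequency of that
    -- weight.
    signs-zero : ∀ s d → d ≡ 0ℤ → [ does (s ℤ.* 1ℤ ℤ.≟ d) ] ℤ.+ [ does (s ℤ.* -1ℤ ℤ.≟ d) ] ≡ + 2 ℤ.* [ does (ℤ.∣ s ∣ ℕ.≟ 0) ]
    signs-zero s d refl = trans (cong₂ ℤ._+_
      ([]-cong (s ℤ.* 1ℤ ℤ.≟ 0ℤ) (ℤ.∣ s ∣ ℕ.≟ 0) (λ eq → trans (sym (∣i*σ∣≡∣i∣ s false)) (cong ℤ.∣_∣ eq)) (λ eq → trans (i*1 s) (ℤ.∣i∣≡0⇒i≡0 eq)))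
      ([]-cong (s ℤ.* -1ℤ ℤ.≟ 0ℤ) (ℤ.∣ s ∣ ℕ.≟ 0) (λ eq → trans (sym (∣i*σ∣≡∣i∣ s true)) (cong ℤ.∣_∣ eq)) (λ eq → trans (i*-1 s) (cong ℤ.-_ (ℤ.∣i∣≡0⇒i≡0 eq)))))
      (solve 1 (λ t → t :+ t := con (+ 2) :* t) refl [ does (ℤ.∣ s ∣ ℕ.≟ 0) ])
      where
      open ℤ.+-*-Solver

    -- When the absolute values agree and are nonzero, exactly one of s and -s equals d. Hence the
    -- weights (q - v) / 2 and (q + v) / 2 occur equally often, once for each triple with ∣S∣ = v.
    signs-nonzero : ∀ s d {v} → ℤ.∣ d ∣ ≡ suc v → [ does (s ℤ.* 1ℤ ℤ.≟ d) ] ℤ.+ [ does (s ℤ.* -1ℤ ℤ.≟ d) ] ≡ [ does (ℤ.∣ s ∣ ℕ.≟ suc v) ]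
    signs-nonzero s d {v} ∣d∣≡ = case ℤ.∣ s ∣ ℕ.≟ suc v of λ where
        (yes ∣s∣≡) → trans (exactly-one (∣i∣≡n⇒ s ∣s∣≡) (∣i∣≡n⇒ d ∣d∣≡)) (sym ([]-true (ℤ.∣ s ∣ ℕ.≟ suc v) ∣s∣≡))
        (no ∣s∣≢)  → trans (cong₂ ℤ._+_
            ([]-false (s ℤ.* 1ℤ ℤ.≟ d) (λ eq → ∣s∣≢ (trans (sym (∣i*σ∣≡∣i∣ s false)) (trans (cong ℤ.∣_∣ eq) ∣d∣≡))))
            ([]-false (s ℤ.* -1ℤ ℤ.≟ d) (λ eq → ∣s∣≢ (trans (sym (∣i*σ∣≡∣i∣ s true)) (trans (cong ℤ.∣_∣ eq) ∣d∣≡)))))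
          (sym ([]-false (ℤ.∣ s ∣ ℕ.≟ suc v) ∣s∣≢))
      where
      exactly-one : s ≡ + suc v ⊎ s ≡ ℤ.- (+ suc v) → d ≡ + suc v ⊎ d ≡ ℤ.- (+ suc v) →
        [ does (s ℤ.* 1ℤ ℤ.≟ d) ] ℤ.+ [ does (s ℤ.* -1ℤ ℤ.≟ d) ] ≡ 1ℤ
      exactly-one s± d± rewrite i*1 s | i*-1 s = go s± d±
        where
        go : s ≡ + suc v ⊎ s ≡ ℤ.- (+ suc v) → d ≡ + suc v ⊎ d ≡ ℤ.- (+ suc v) → [ does (s ℤ.≟ d) ] ℤ.+ [ does (ℤ.- s ℤ.≟ d) ] ≡ 1ℤ
        go (inj₁ refl) (inj₁ refl) = cong₂ ℤ._+_ ([]-true (+ suc v ℤ.≟ + suc v) refl) ([]-false (ℤ.-[1+ v ] ℤ.≟ + suc v) λ ())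
        go (inj₁ refl) (inj₂ refl) = cong₂ ℤ._+_ ([]-false (+ suc v ℤ.≟ ℤ.-[1+ v ]) λ ()) ([]-true (ℤ.-[1+ v ] ℤ.≟ ℤ.-[1+ v ]) refl)
        go (inj₂ refl) (inj₁ refl) = cong₂ ℤ._+_ ([]-false (ℤ.-[1+ v ] ℤ.≟ + suc v) λ ()) ([]-true (+ suc v ℤ.≟ + suc v) refl)
        go (inj₂ refl) (inj₂ refl) = cong₂ ℤ._+_ ([]-true (ℤ.-[1+ v ] ℤ.≟ ℤ.-[1+ v ]) refl) ([]-false (+ suc v ℤ.≟ ℤ.-[1+ v ]) λ ())

    -- The words with ∣S∣ = v have the weights (q ± v) / 2.
    AtDistance : ℕ → ℕ → Set
    AtDistance v i = 2 ℕ.* i ℕ.+ v ≡ q ⊎ 2 ℕ.* i ≡ q ℕ.+ v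

    distance⇒ : ∀ {v i} → AtDistance v i → ℤ.∣ discrepancy i ∣ ≡ v
    distance⇒ {v} {i} (inj₁ eq) = cong ℤ.∣_∣ (begin
      + q ℤ.- + 2 ℤ.* + i                                ≡⟨ cong (λ n → + n ℤ.- + 2 ℤ.* + i) eq ⟨
      + (2 ℕ.* i ℕ.+ v) ℤ.- + 2 ℤ.* + i                  ≡⟨ cong (λ t → t ℤ.+ + v ℤ.- + 2 ℤ.* + i) (ℤ.pos-* 2 i) ⟩
      + 2 ℤ.* + i ℤ.+ + v ℤ.- + 2 ℤ.* + i                ≡⟨ solve 2 (λ t v → t :+ v :- t := v) refl (+ 2 ℤ.* + i) (+ v) ⟩
      + v                                                ∎)
      where
      open ℤ.+-*-Solver
    distance⇒ {v} {i} (inj₂ eq) = trans (cong ℤ.∣_∣ (begin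
      + q ℤ.- + 2 ℤ.* + i                                ≡⟨ cong (λ t → + q ℤ.- t) (trans (sym (ℤ.pos-* 2 i)) (cong +_ eq)) ⟩
      + q ℤ.- (+ q ℤ.+ + v)                              ≡⟨ solve 2 (λ q v → q :- (q :+ v) := :- v) refl (+ q) (+ v) ⟩
      ℤ.- (+ v)                                          ∎)) (ℤ.∣-i∣≡∣i∣ (+ v))
      where
      open ℤ.+-*-Solver

    distance⇐ : ∀ {v} i → ℤ.∣ discrepancy i ∣ ≡ v → AtDistance v i
    distance⇐ {v} i eq with ∣i∣≡n⇒ (discrepancy i) eq
    ... | inj₁ d≡v  = inj₁ (ℤ.+-injective (begin
      + (2 ℕ.* i) ℤ.+ + v                    ≡⟨ cong₂ ℤ._+_ (trans (ℤ.pos-* 2 i) (doubled i)) (sym d≡v) ⟩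
      + q ℤ.- discrepancy i ℤ.+ discrepancy i ≡⟨ solve 2 (λ q d → q :- d :+ d := q) refl (+ q) (discrepancy i) ⟩
      + q                                    ∎))
      where
      open ℤ.+-*-Solver
    ... | inj₂ d≡-v = inj₂ (ℤ.+-injective (begin
      + (2 ℕ.* i)                            ≡⟨ trans (ℤ.pos-* 2 i) (doubled i) ⟩
      + q ℤ.- discrepancy i                  ≡⟨ cong (λ t → + q ℤ.- t) d≡-v ⟩
      + q ℤ.- ℤ.- (+ v)                      ≡⟨ cong (λ t → + q ℤ.+ t) (ℤ.neg-involutive (+ v)) ⟩
      + (q ℕ.+ v)                            ∎))

    length-by-sign : ∀ i → + List.length (codewordsWithWeight i)
      ≡ ∑³ (λ a b c → [ does (S a b c ℤ.* 1ℤ ℤ.≟ discrepancy i) ] ℤ.+ [ does (S a b c ℤ.* -1ℤ ℤ.≟ discrepancy i) ])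
    length-by-sign i = trans (length-codewordsWithWeight i) (∑³-cong λ a b c →
      cong₂ ℤ._+_ ([weight≟] (a , b , c , false) i) ([weight≟] (a , b , c , true) i))

    length-zero : ∀ i → AtDistance (value 0F) i → + List.length (codewordsWithWeight i) ≡ + 2 ℤ.* count 0F
    length-zero i dist = begin
      + List.length (codewordsWithWeight i)                              ≡⟨ length-by-sign i ⟩
      _                                                                  ≡⟨ ∑³-cong (λ a b c → signs-zero (S a b c) _ (ℤ.∣i∣≡0⇒i≡0 (distance⇒ {i = i} dist))) ⟩
      ∑³ (λ a b c → + 2 ℤ.* [ does (ℤ.∣ S a b c ∣ ℕ.≟ 0) ])              ≡⟨ ∑³-*ˡ (+ 2) _ ⟩
      + 2 ℤ.* count 0F                                                   ∎

    length-nonzero : ∀ i j → AtDistance (value (suc j)) i → + List.length (codewordsWithWeight i) ≡ count (suc j)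
    length-nonzero i j dist = trans (length-by-sign i) (∑³-cong λ a b c → begin
      [ does (S a b c ℤ.* 1ℤ ℤ.≟ discrepancy i) ] ℤ.+ [ does (S a b c ℤ.* -1ℤ ℤ.≟ discrepancy i) ]
        ≡⟨ signs-nonzero (S a b c) _ (trans (distance⇒ {i = i} dist) (sym suc-pred)) ⟩
      [ does (ℤ.∣ S a b c ∣ ℕ.≟ suc (ℕ.pred (value (suc j)))) ]
        ≡⟨ cong (λ n → [ does (ℤ.∣ S a b c ∣ ℕ.≟ n) ]) suc-pred ⟩
      [ does (ℤ.∣ S a b c ∣ ℕ.≟ value (suc j)) ]  ∎)
      where
      suc-pred : suc (ℕ.pred (value (suc j))) ≡ value (suc j)
      -- `value 0F` is 0, so injectivity makes every other value nonzero.
      suc-pred = ℕ.suc-pred (value (suc j)) {{ℕ.≢-nonZero λ eq → case value-injective (suc j) 0F eq of λ ()}}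

    length-absent : ∀ i → (∀ j → ¬ AtDistance (value j) i) → List.length (codewordsWithWeight i) ≡ 0
    length-absent i absent = cong List.length (List.filter-none (λ w → weight w ℕ.≟ i) {xs = codewords} (All.tabulate λ w∈ wt≡i →
      case ∈-map⁻ word w∈ of λ where
        (t@(a , b , c , h) , _ , refl) → case ∣S∣≡value a b c of λ where
          (j , ∣S∣≡) → absent j (distance⇐ i (trans (cong (ℤ.∣_∣ ∘ discrepancy) (sym wt≡i))
            (trans (cong ℤ.∣_∣ (sym (signedS≡ t))) (trans (∣i*σ∣≡∣i∣ (S a b c) h) ∣S∣≡))))))

    zeroCoefficients : Coefficients
    zeroCoefficients = 0# , 0# , 0# , false

    𝟎≡word : 𝟎 ≡ word zeroCoefficients
    𝟎≡word = word-ext zeroCoefficients λ x → begin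
      Vec.lookup 𝟎 x                               ≡⟨ Vec.lookup-replicate x false ⟩
      false                                        ≡⟨ trans (Bool.xor-identityʳ _) tr-0 ⟨
      tr 0# xor false                              ≡⟨ cong (λ t → tr t xor false) (Char2.solve 3
        (λ x₅ x₃ x → con false := con false :* x₅ :+ con false :* x₃ :+ con false :* x) refl (x ^ 5) (x ^ 3) x) ⟩
      entry zeroCoefficients x                     ∎
      where
      open Char2

    word-⊕ : ∀ t t′ → word t ⊕ word t′ ≡ word (t ⊹ t′)
    word-⊕ t t′ = word-ext (t ⊹ t′) λ x → begin
      Vec.lookup (word t ⊕ word t′) x                      ≡⟨ Vec.lookup-zipWith _xor_ x (word t) (word t′) ⟩
      Vec.lookup (word t) x xor Vec.lookup (word t′) x     ≡⟨ cong₂ _xor_ (lookup-word t x) (lookup-word t′ x) ⟩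
      entry t x xor entry t′ x                             ≡⟨ entry-⊹ t t′ x ⟨
      entry (t ⊹ t′) x                                     ∎

    -- Matching weights and frequencies with the table.

    2^-∸ : ∀ {j k} → j ℕ.≤ k → 2 ℕ.^ j ℕ.* 2 ℕ.^ (k ℕ.∸ j) ≡ 2 ℕ.^ k
    2^-∸ {j} {k} j≤k = trans (sym (ℕ.^-distribˡ-+-* 2 j (k ℕ.∸ j))) (cong (2 ℕ.^_) (ℕ.m+[n∸m]≡n j≤k))

    2^2s≡q : 2 ℕ.^ (2 ℕ.* s) ≡ q
    2^2s≡q = trans (cong (2 ℕ.^_) (sym m≡2s)) (sym q≡2^m)

    2^ks : ∀ k → 2 ℕ.^ (k ℕ.* s) ≡ r ℕ.^ k
    2^ks k = trans (cong (2 ℕ.^_) (ℕ.*-comm k s)) (sym (ℕ.^-*-assoc 2 s k))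

    bound : ∀ j k → j ℕ.≤ k ℕ.* 3 → j ℕ.≤ k ℕ.* s
    bound j k j≤3k = ℕ.≤-trans j≤3k (ℕ.*-monoʳ-≤ k 3≤s)

    -- From s ≥ 3 follows j ≤ 3k ≤ ks, so the subtraction in the exponent is exact.
    scaled-power : ∀ j k → j ℕ.≤ k ℕ.* 3 → + (2 ℕ.^ j) ℤ.* + (2 ℕ.^ (k ℕ.* s ℕ.∸ j)) ≡ (+ r) ℤ.^ k
    scaled-power j k j≤3k = begin
      + (2 ℕ.^ j) ℤ.* + (2 ℕ.^ (k ℕ.* s ℕ.∸ j))     ≡⟨ ℤ.pos-* (2 ℕ.^ j) _ ⟨
      + (2 ℕ.^ j ℕ.* 2 ℕ.^ (k ℕ.* s ℕ.∸ j))         ≡⟨ cong +_ (trans (2^-∸ (bound j k j≤3k)) (2^ks k)) ⟩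
      + (r ℕ.^ k)                                   ≡⟨ pos-^ r k ⟩
      (+ r) ℤ.^ k                                   ∎
      where
      pos-^ : ∀ n k → + (n ℕ.^ k) ≡ (+ n) ℤ.^ k
      pos-^ n zero    = refl
      pos-^ n (suc k) = trans (ℤ.pos-* n (n ℕ.^ k)) (cong (λ t → + n ℤ.* t) (pos-^ n k))

    scaled-Q : ∀ j → j ℕ.≤ 6 → + (2 ℕ.^ j) ℤ.* + (2 ℕ.^ (2 ℕ.* s ℕ.∸ j)) ≡ Q
    scaled-Q j j≤6 = trans (scaled-power j 2 j≤6) (solve 1 (λ r → r :^ 2 := r :* r) refl (+ r))
      where
      open ℤ.+-*-Solver

    scaled-Q² : ∀ j → j ℕ.≤ 12 → + (2 ℕ.^ j) ℤ.* + (2 ℕ.^ (4 ℕ.* s ℕ.∸ j)) ≡ Q ℤ.* Q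
    scaled-Q² j j≤12 = trans (scaled-power j 4 j≤12) (solve 1 (λ r → r :^ 4 := r :* r :* (r :* r)) refl (+ r))
      where
      open ℤ.+-*-Solver

    scaled-Q³ : ∀ j → j ℕ.≤ 18 → + (2 ℕ.^ j) ℤ.* + (2 ℕ.^ (6 ℕ.* s ℕ.∸ j)) ≡ Q ℤ.* Q ℤ.* Q
    scaled-Q³ j j≤18 = trans (scaled-power j 6 j≤18) (solve 1 (λ r → r :^ 6 := r :* r :* (r :* r) :* (r :* r)) refl (+ r))
      where
      open ℤ.+-*-Solver

    half : ℕ
    half = 2 ℕ.^ (2 ℕ.* s ℕ.∸ 1)

    2*half≡q : 2 ℕ.* half ≡ q
    2*half≡q = trans (2^-∸ (bound 1 2 (ℕ.m≤m+n 1 5))) 2^2s≡q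

    offset : Fin 4 → ℕ
    offset 0F = 0
    offset 1F = 2 ℕ.^ (s ℕ.∸ 1)
    offset 2F = 2 ℕ.^ s
    offset 3F = 2 ℕ.^ (s ℕ.+ 1)

    2*offset≡value : ∀ j → 2 ℕ.* offset j ≡ value (inject₁ j)
    2*offset≡value 0F = refl
    2*offset≡value 1F = trans (2^-∸ (ℕ.≤-trans (ℕ.m≤m+n 1 2) 3≤s)) (sym (ℕ.*-identityˡ r))
    2*offset≡value 2F = refl
    2*offset≡value 3F = trans (cong (λ n → 2 ℕ.* 2 ℕ.^ n) (ℕ.+-comm s 1)) (sym (ℕ.*-assoc 2 2 r))

    -- The weights (q - v) / 2 and (q + v) / 2 for v = `value j`, spelled as in the table so that
    -- membership there holds by `refl`.
    lower upper : Fin 5 → ℕ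
    lower 0F = half
    lower 1F = half ℕ.∸ 2 ℕ.^ (s ℕ.∸ 1)
    lower 2F = half ℕ.∸ 2 ℕ.^ s
    lower 3F = half ℕ.∸ 2 ℕ.^ (s ℕ.+ 1)
    lower 4F = 0
    upper 0F = half
    upper 1F = half ℕ.+ 2 ℕ.^ (s ℕ.∸ 1)
    upper 2F = half ℕ.+ 2 ℕ.^ s
    upper 3F = half ℕ.+ 2 ℕ.^ (s ℕ.+ 1)
    upper 4F = 2 ℕ.^ (2 ℕ.* s)

    upper-distance : ∀ j → 2 ℕ.* upper j ≡ q ℕ.+ value j
    upper-distance = λ where
        0F → trans 2*half≡q (sym (ℕ.+-identityʳ q))
        1F → shift 1F
        2F → shift 2F
        3F → shift 3F
        4F → trans (cong (2 ℕ.*_) 2^2s≡q) (cong (q ℕ.+_) (trans (ℕ.+-identityʳ q) q≡r²))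
      where
      shift : ∀ j → 2 ℕ.* (half ℕ.+ offset j) ≡ q ℕ.+ value (inject₁ j)
      shift j = trans (ℕ.*-distribˡ-+ 2 half (offset j)) (cong₂ ℕ._+_ 2*half≡q (2*offset≡value j))

    lower-distance : ∀ j → 2 ℕ.* lower j ℕ.+ value j ≡ q
    lower-distance = λ where
        0F → trans (ℕ.+-identityʳ _) 2*half≡q
        1F → shift 1F (ℕ.m≤m+n 1 7)
        2F → shift 2F (ℕ.m≤m+n 2 6)
        3F → shift 3F (ℕ.m≤m+n 4 4)
        4F → sym q≡r²
      where
      shift : ∀ j → multiple (inject₁ j) ℕ.≤ 8 → 2 ℕ.* (half ℕ.∸ offset j) ℕ.+ value (inject₁ j) ≡ q
      shift j ≤8 = begin
        2 ℕ.* (half ℕ.∸ offset j) ℕ.+ v                 ≡⟨ cong (ℕ._+ v) (ℕ.*-distribˡ-∸ 2 half (offset j)) ⟩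
        2 ℕ.* half ℕ.∸ 2 ℕ.* offset j ℕ.+ v             ≡⟨ cong₂ (λ a b → a ℕ.∸ b ℕ.+ v) 2*half≡q (2*offset≡value j) ⟩
        -- No truncation occurs, since v is at most 8 r, and 8 r ≤ r² = q.
        q ℕ.∸ v ℕ.+ v                                   ≡⟨ ℕ.m∸n+n≡m (subst (v ℕ.≤_) (sym q≡r²) (ℕ.*-monoˡ-≤ r (ℕ.≤-trans ≤8 8≤r))) ⟩
        q                                               ∎
        where v = value (inject₁ j)

    distance-unique : ∀ {i} j → AtDistance (value j) i → i ≡ lower j ⊎ i ≡ upper j
    distance-unique j (inj₁ eq) = inj₁ (ℕ.*-cancelˡ-≡ _ _ 2 (ℕ.+-cancelʳ-≡ (value j) _ _ (trans eq (sym (lower-distance j)))))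
    distance-unique j (inj₂ eq) = inj₂ (ℕ.*-cancelˡ-≡ _ _ 2 (trans eq (sym (upper-distance j))))

    lower∈table : ∀ j → lower j ∈ List.map proj₁ (weightTable s)
    lower∈table 0F = there (here refl)
    lower∈table 1F = there (there (here refl))
    lower∈table 2F = there (there (there (there (here refl))))
    lower∈table 3F = there (there (there (there (there (there (here refl))))))
    lower∈table 4F = here refl

    upper∈table : ∀ j → upper j ∈ List.map proj₁ (weightTable s)
    upper∈table 0F = there (here refl)
    upper∈table 1F = there (there (there (here refl)))
    upper∈table 2F = there (there (there (there (there (here refl)))))
    upper∈table 3F = there (there (there (there (there (there (there (here refl)))))))
    upper∈table 4F = there (there (there (there (there (there (there (there (here refl))))))))

    ∉table⇒absent : ∀ i → ¬ i ∈ List.map proj₁ (weightTable s) → ∀ j → ¬ AtDistance (value j) i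
    ∉table⇒absent i i∉ j dist =
      [ i∉ ∘ listed (lower∈table j) , i∉ ∘ listed (upper∈table j) ]′ (distance-unique {i} j dist)
      where
      listed : ∀ {k} → k ∈ List.map proj₁ (weightTable s) → i ≡ k → i ∈ List.map proj₁ (weightTable s)
      listed k∈ i≡k = subst (_∈ List.map proj₁ (weightTable s)) (sym i≡k) k∈

    size : ℕ → ℕ
    size i = List.length (codewordsWithWeight i)

    size-half : + 32 ℤ.* + size half ≡ + 29 ℤ.* Q ℤ.* Q ℤ.* Q ℤ.- + 33 ℤ.* Q ℤ.* Q ℤ.+ + 68 ℤ.* Q ℤ.- + 64
    size-half = begin
      + 32 ℤ.* + size half                ≡⟨ cong (λ t → + 32 ℤ.* t) (length-zero half (inj₁ (lower-distance 0F))) ⟩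
      + 32 ℤ.* (+ 2 ℤ.* count 0F)         ≡⟨ ℤ.*-assoc (+ 32) (+ 2) (count 0F) ⟨
      + 64 ℤ.* count 0F                   ≡⟨ count₀ ⟩
      _                                   ∎

    module _ (i : ℕ) where

      entry₁ : AtDistance (value 1F) i → fromℕ (size i) ≃ _
      entry₁ dist = formula₁ (size i) Q (2 ℕ.^ (2 ℕ.* s)) (2 ℕ.^ (4 ℕ.* s))
        (trans (cong (λ t → + 15 ℤ.* t) (length-nonzero i 0F dist)) count₁)
        (trans (sym (ℤ.*-identityˡ _)) (scaled-Q 0 ℕ.z≤n))
        (trans (sym (ℤ.*-identityˡ _)) (scaled-Q² 0 ℕ.z≤n))

      entry₂ : AtDistance (value 2F) i → fromℕ (size i) ≃ _
      entry₂ dist = formula₂ (size i) Q (2 ℕ.^ (4 ℕ.* s ℕ.∸ 4)) (2 ℕ.^ (2 ℕ.* s))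
        (trans (cong (λ t → + 48 ℤ.* t) (length-nonzero i 1F dist)) count₂)
        (scaled-Q² 4 (ℕ.m≤m+n 4 8))
        (trans (sym (ℤ.*-identityˡ _)) (scaled-Q 0 ℕ.z≤n))

      entry₃ : AtDistance (value 3F) i → fromℕ (size i) ≃ _
      entry₃ dist = formula₃ (size i) Q (2 ℕ.^ (2 ℕ.* s ℕ.∸ 4)) (2 ℕ.^ (4 ℕ.* s ℕ.∸ 2)) (2 ℕ.^ (2 ℕ.* s ℕ.∸ 2))
        (trans (cong (λ t → + 960 ℤ.* t) (length-nonzero i 2F dist)) count₃)
        (scaled-Q 4 (ℕ.m≤m+n 4 2)) (scaled-Q² 2 (ℕ.m≤m+n 2 10)) (scaled-Q 2 (ℕ.m≤m+n 2 4))

      entry₄ : AtDistance (value 4F) i → fromℕ (size i) ≃ fromℕ 1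
      entry₄ dist = *≡* (cong (λ t → t ℤ.* + 1) (trans (length-nonzero i 3F dist) count₄))

    -- Linearity, dimension and weight distribution of a code made of these words.

    module _ {ℓ} (C : Code q ℓ) (decode : ∀ {w} → C w → ∃[ t ] w ≡ word t) (encode : ∀ t → C (word t)) where

      isLinear : IsLinear C
      isLinear = record
        { 𝟎-member = 𝟎-member
        ; ⊕-closed = λ v∈C w∈C → ⊕-closed (decode v∈C) (decode w∈C)
        ; ·-closed = λ where
            true  {w} w∈C → subst C (sym (true· w)) w∈C
            false {w} w∈C → subst C (sym (false· w)) 𝟎-member
        }
        where
        𝟎-member : C 𝟎
        𝟎-member = subst C (sym 𝟎≡word) (encode zeroCoefficients)

        ⊕-closed : ∀ {v w} → ∃[ t ] v ≡ word t → ∃[ t ] w ≡ word t → C (v ⊕ w)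
        ⊕-closed (t , refl) (t′ , refl) = subst C (sym (word-⊕ t t′)) (encode (t ⊹ t′))

      complete : ∀ {w} → C w → w ∈ codewords
      complete w∈C with t , refl ← decode w∈C = ∈-map⁺ word (allCoefficients-complete t)

      sound : ∀ {w} → w ∈ codewords → C w
      sound w∈ with t , _ , refl ← ∈-map⁻ word w∈ = encode t

      hasDimension : HasDimension C (3 ℕ.* m ℕ.+ 1)
      hasDimension = dimension-from-size isLinear (3 ℕ.* m ℕ.+ 1) codewords-unique complete sound length-codewords

      cardinality : ∀ i → codewordsOfWeight C i HasCardinality size i
      cardinality i = enumeration-cardinality {P = λ w → C w × weight w ≡ i}
        (Unique.filter⁺ (λ w → weight w ℕ.≟ i) codewords-unique)
        (λ (w∈C , wt≡i) → ∈-filter⁺ (λ w → weight w ℕ.≟ i) (complete w∈C) wt≡i)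
        (λ w∈ → let w∈codewords , wt≡i = ∈-filter⁻ (λ w → weight w ℕ.≟ i) {xs = codewords} w∈ in sound w∈codewords , wt≡i)

      hasWeightDistribution : HasWeightDistribution C (weightTable s)
      hasWeightDistribution =
          ( at 0 (entry₄ 0 (inj₁ (lower-distance 4F)))
          ∷ at half (formula₀ (size half) Q (2 ℕ.^ (6 ℕ.* s ℕ.∸ 5)) (2 ℕ.^ (4 ℕ.* s ℕ.∸ 5)) (2 ℕ.^ (2 ℕ.* s ℕ.∸ 3))
              size-half (scaled-Q³ 5 (ℕ.m≤m+n 5 13)) (scaled-Q² 5 (ℕ.m≤m+n 5 7)) (scaled-Q 3 (ℕ.m≤m+n 3 3)))
          ∷ at (lower 1F) (entry₁ (lower 1F) (inj₁ (lower-distance 1F)))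
          ∷ at (upper 1F) (entry₁ (upper 1F) (inj₂ (upper-distance 1F)))
          ∷ at (lower 2F) (entry₂ (lower 2F) (inj₁ (lower-distance 2F)))
          ∷ at (upper 2F) (entry₂ (upper 2F) (inj₂ (upper-distance 2F)))
          ∷ at (lower 3F) (entry₃ (lower 3F) (inj₁ (lower-distance 3F)))
          ∷ at (upper 3F) (entry₃ (upper 3F) (inj₂ (upper-distance 3F)))
          ∷ at (upper 4F) (entry₄ (upper 4F) (inj₂ (upper-distance 4F)))
          ∷ [])
        , λ i i∉table → subst (codewordsOfWeight C i HasCardinality_) (length-absent i (∉table⇒absent i i∉table)) (cardinality i)
        where
        at : ∀ i {A} → fromℕ (size i) ≃ A → ∃[ N ] codewordsOfWeight C i HasCardinality N × fromℕ N ≃ A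
        at i size≃ = size i , cardinality i , size≃

open import Data.Nat.Base using (_+_; _*_; _^_; _≤_)

-- Transport of the field structure and of the code to `Fin q`.

module Transport {c ℓ₁ ℓ₂} (F : HeytingField c ℓ₁ ℓ₂) {q} (enum : HeytingField.setoid F HasCardinality q) where
  open HeytingField F using (heytingCommutativeRing; tight; #⇒invertible; invertible⇒#; #-irrefl)
  open CommutativeRing (HeytingCommutativeRing.commutativeRing heytingCommutativeRing)
    renaming (_+_ to _+ᶠ_; _*_ to _*ᶠ_; -_ to -ᶠ_)
  open Inverse enum using (to; from; to-cong; from-cong; strictlyInverseˡ; strictlyInverseʳ)
  open import Algebra.Properties.Semiring.Exp semiring using (^-congˡ; ^-assocʳ) renaming (_^_ to _^ᶠ_)
  open import Algebra.Properties.Semiring.Sum semiring using (sum; sum-cong-≋)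
  open import Algebra.Properties.Ring ring using (-0#≈0#)
  open import Relation.Binary.Reasoning.Setoid setoid

  -- The operations of `F` conjugated by the enumeration. Its ring laws are pulled back along
  -- `from`, an injective homomorphism.
  finRing : RawRing _ _
  finRing = record
    { Carrier = Fin q
    ; _≈_     = _≡_
    ; _+_     = λ i j → to (from i +ᶠ from j)
    ; _*_     = λ i j → to (from i *ᶠ from j)
    ; -_      = λ i → to (-ᶠ from i)
    ; 0#      = to 0#
    ; 1#      = to 1#
    }

  open RawRing finRing using () renaming (_+_ to _⊞_; _*_ to _⊠_; -_ to ⊟_; 0# to 0′; 1# to 1′)

  from-injective : ∀ {i j} → from i ≈ from j → i ≡ j
  from-injective {i} {j} eq = ≡.trans (≡.sym (strictlyInverseˡ i)) (≡.trans (to-cong eq) (strictlyInverseˡ j))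

  from-isRingMonomorphism : IsRingMonomorphism finRing rawRing from
  from-isRingMonomorphism = record
    { isRingHomomorphism = record
      { isSemiringHomomorphism = record
        { isNearSemiringHomomorphism = record
          { +-isMonoidHomomorphism = record
            { isMagmaHomomorphism = record
              { isRelHomomorphism = record { cong = from-cong }
              ; homo              = λ _ _ → strictlyInverseʳ _
              }
            ; ε-homo = strictlyInverseʳ _
            }
          ; *-homo = λ _ _ → strictlyInverseʳ _
          }
        ; 1#-homo = strictlyInverseʳ _
        }
      ; -‿homo = λ _ → strictlyInverseʳ _
      }
    ; injective = from-injective
    }

  open IsRingMonomorphism from-isRingMonomorphism using (+-homo; *-homo; 0#-homo; 1#-homo)

  finRing-isCommutativeRing : IsCommutativeRing _≡_ _⊞_ _⊠_ ⊟_ 0′ 1′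
  finRing-isCommutativeRing = RingMonomorphism.isCommutativeRing from-isRingMonomorphism isCommutativeRing

  x-0≈x : ∀ x → x - 0# ≈ x
  x-0≈x x = trans (+-congˡ -0#≈0#) (+-identityʳ x)

  -- Apartness is reached through invertibility: the difference of 1 and 0 is invertible, so the two
  -- are apart, and apartness is irreflexive.
  1≉0 : ¬ 1# ≈ 0#
  1≉0 1≈0 = #-irrefl 1≈0 (invertible⇒# (1# , left , trans (*-comm _ _) left))
    where
    left : 1# *ᶠ (1# - 0#) ≈ 1#
    left = trans (*-identityˡ _) (x-0≈x 1#)

  1′≢0′ : 1′ ≢ 0′
  1′≢0′ eq = 1≉0 (begin
    1#           ≈⟨ strictlyInverseʳ 1# ⟨
    from 1′      ≡⟨ ≡.cong from eq ⟩
    from 0′      ≈⟨ strictlyInverseʳ 0# ⟩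
    0#           ∎)

  -- Apartness is only known to be not-not-stable, but having an inverse is decidable on a finite carrier.
  finRing-inverse : ∀ i → i ≢ 0′ → ∃[ j ] i ⊠ j ≡ 1′
  finRing-inverse i i≢0 = decidable-stable (Fin.any? λ j → i ⊠ j Fin.≟ 1′) λ ∄j →
    i≢0 (from-injective (trans (proj₁ (tight (from i) 0#) λ i#0 → ∄j (invert (#⇒invertible i#0))) (sym 0#-homo)))
    where
    invert : ∃[ y ] (y *ᶠ (from i - 0#) ≈ 1#) × ((from i - 0#) *ᶠ y ≈ 1#) → ∃[ j ] i ⊠ j ≡ 1′
    invert (y , _ , xy≈1) = to y , to-cong (begin
      from i *ᶠ from (to y)      ≈⟨ *-cong (sym (x-0≈x (from i))) (strictlyInverseʳ y) ⟩
      (from i - 0#) *ᶠ y         ≈⟨ xy≈1 ⟩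
      1#                         ∎)

  module Codewords (m : ℕ) (q≡2^m : q ≡ 2 ^ m) (s : ℕ) (m≡2s : m ≡ 2 * s) (3≤s : 3 ≤ s) where

    module Field = FiniteField m q≡2^m finRing-isCommutativeRing 1′≢0′ finRing-inverse
    module Words = Field.EvenDegree s m≡2s 3≤s
    open Field using (trace; tr; embed₂; embed₂-xor; embed₂-tr; embed₂-injective; form)
    open Words using (Coefficients; entry; word; word-ext; lookup-word)

    from-embed₂ : ∀ b → from (embed₂ b) ≈ embed F b
    from-embed₂ true  = 1#-homo
    from-embed₂ false = 0#-homo

    from-^ : ∀ i k → from (i Field.^ k) ≈ from i ^ᶠ k
    from-^ i zero    = 1#-homo
    from-^ i (suc k) = trans (*-homo i _) (*-congˡ (from-^ i k))

    Tr-cong : ∀ k {x y} → x ≈ y → Tr F k x ≈ Tr F k y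
    Tr-cong k x≈y = sum-cong-≋ {k} λ i → ^-congˡ (2 ^ toℕ i) x≈y

    Tr-suc : ∀ k x → Tr F (suc k) x ≈ x +ᶠ Tr F k (x *ᶠ x)
    Tr-suc k x = +-cong (*-identityʳ x) (sum-cong-≋ {k} λ i → begin
      x ^ᶠ (2 * 2 ^ toℕ i)           ≈⟨ ^-assocʳ x 2 (2 ^ toℕ i) ⟨
      (x ^ᶠ 2) ^ᶠ (2 ^ toℕ i)        ≈⟨ ^-congˡ (2 ^ toℕ i) (*-congˡ (*-identityʳ x)) ⟩
      (x *ᶠ x) ^ᶠ (2 ^ toℕ i)        ∎)

    from-trace : ∀ k i → from (trace k i) ≈ Tr F k (from i)
    from-trace zero    i = 0#-homo
    from-trace (suc k) i = begin
      from (i ⊞ trace k (i ⊠ i))                 ≈⟨ +-homo i _ ⟩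
      from i +ᶠ from (trace k (i ⊠ i))           ≈⟨ +-congˡ (trans (from-trace k (i ⊠ i)) (Tr-cong k (*-homo i i))) ⟩
      from i +ᶠ Tr F k (from i *ᶠ from i)        ≈⟨ Tr-suc k (from i) ⟨
      Tr F (suc k) (from i)                      ∎

    from-form : ∀ a b c i → from (form a b c i) ≈ from a *ᶠ from i ^ᶠ 5 +ᶠ from b *ᶠ from i ^ᶠ 3 +ᶠ from c *ᶠ from i
    from-form a b c i = trans (+-homo _ _) (+-cong (trans (+-homo _ _) (+-cong
      (trans (*-homo a _) (*-congˡ (from-^ i 5))) (trans (*-homo b _) (*-congˡ (from-^ i 3))))) (*-homo c i))

    value : Carrier → Carrier → Carrier → Carrier → Carrier
    value a b c x = Tr F m (a *ᶠ x ^ᶠ 5 +ᶠ b *ᶠ x ^ᶠ 3 +ᶠ c *ᶠ x)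

    value-cong : ∀ {a a′ b b′ c c′ x x′} → a ≈ a′ → b ≈ b′ → c ≈ c′ → x ≈ x′ → value a b c x ≈ value a′ b′ c′ x′
    value-cong a≈ b≈ c≈ x≈ = Tr-cong m
      (+-cong (+-cong (*-cong a≈ (^-congˡ 5 x≈)) (*-cong b≈ (^-congˡ 3 x≈))) (*-cong c≈ x≈))

    from-entry : ∀ a b c h i → from (embed₂ (entry (a , b , c , h) i)) ≈ value (from a) (from b) (from c) (from i) +ᶠ embed F h
    from-entry a b c h i = begin
      from (embed₂ (tr (form a b c i) xor h))                ≡⟨ ≡.cong from (embed₂-xor (tr (form a b c i)) h) ⟩
      from (embed₂ (tr (form a b c i)) ⊞ embed₂ h)           ≈⟨ +-homo _ _ ⟩
      from (embed₂ (tr (form a b c i))) +ᶠ from (embed₂ h)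
        ≈⟨ +-cong (trans (reflexive (≡.cong from (embed₂-tr (form a b c i)))) (from-trace m (form a b c i))) (from-embed₂ h) ⟩
      Tr F m (from (form a b c i)) +ᶠ embed F h              ≈⟨ +-congʳ (Tr-cong m (from-form a b c i)) ⟩
      value (from a) (from b) (from c) (from i) +ᶠ embed F h ∎

    code = traceCode F enum m

    -- The defining equation at the element `from i` lies in `F`; pulled back along the injections
    -- `from` and `embed₂` it determines the bit at position i.
    decode : ∀ {w} → code w → ∃[ t ] w ≡ word t
    decode {w} (a , b , c , h , w≈) = t , word-ext t λ i → embed₂-injective (from-injective (begin
      from (embed₂ (Vec.lookup w i))                    ≈⟨ from-embed₂ (Vec.lookup w i) ⟩
      embed F (Vec.lookup w i)                          ≡⟨ ≡.cong (embed F ∘ Vec.lookup w) (strictlyInverseˡ i) ⟨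
      embed F (Vec.lookup w (to (from i)))              ≈⟨ w≈ (from i) ⟩
      value a b c (from i) +ᶠ embed F h
        ≈⟨ +-congʳ (value-cong (strictlyInverseʳ a) (strictlyInverseʳ b) (strictlyInverseʳ c) refl) ⟨
      value (from (to a)) (from (to b)) (from (to c)) (from i) +ᶠ embed F h
        ≈⟨ from-entry (to a) (to b) (to c) h i ⟨
      from (embed₂ (entry t i))                         ∎))
      where
      t : Coefficients
      t = to a , to b , to c , h

    encode : ∀ t → code (word t)
    encode t@(a , b , c , h) = from a , from b , from c , h , λ x → begin
      embed F (Vec.lookup (word t) (to x))                        ≡⟨ ≡.cong (embed F) (lookup-word t (to x)) ⟩
      embed F (entry t (to x))                                    ≈⟨ from-embed₂ (entry t (to x)) ⟨
      from (embed₂ (entry t (to x)))                              ≈⟨ from-entry a b c h (to x) ⟩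
      value (from a) (from b) (from c) (from (to x)) +ᶠ embed F h ≈⟨ +-congʳ (value-cong refl refl refl (strictlyInverseʳ x)) ⟩
      value (from a) (from b) (from c) x +ᶠ embed F h             ∎

theorem4 : ∀ {c ℓ₁ ℓ₂ : Level} (s m q : ℕ) → 3 ≤ s → m ≡ 2 * s → q ≡ 2 ^ m →
    (F : HeytingField c ℓ₁ ℓ₂) (enum : HeytingField.setoid F HasCardinality q) →
    let C = traceCode F enum m in
    IsLinear C
    × length C ≡ 2 ^ m
    × HasDimension C (3 * m + 1)
    × HasWeightDistribution C (weightTable s)
theorem4 s m q 3≤s m≡2s q≡2^m F enum =
    Words.isLinear C (λ {w} → decode {w}) encode
  , q≡2^m
  , Words.hasDimension C (λ {w} → decode {w}) encode
  , Words.hasWeightDistribution C (λ {w} → decode {w}) encode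
  where
  open Transport.Codewords F enum m q≡2^m s m≡2s 3≤s
  C = traceCode F enum m
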